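{- Let $k\ge 8$ be an integer and let $f(v)=\min\{d(v),k\}$ for all $v\in V(G)$. If $G$ is a $K_5$-minor-free graph with $d(S_k)\ge 3$ such that no connected component of $G$ is a Gallai tree, then $G$ is $f$-list colorable.
   Context: For a graph $G$, $d(v)$ denotes the degree of $v$. For an integer $k$, $S_k=\{v\in V(G): d(v)<k\}$, and $d(S_k)$ denotes the smallest distance in $G$ between two distinct connected components of the induced subgraph $G[S_k]$ (taken as $+\infty$ for components in different components of $G$); if $G[S_k]$ has at most one component, $d(S_k)=0$. A Gallai tree is a graph in which every block is a complete graph or an odd cycle. A list assignment $L$ assigns a set $L(v)$ of colors to each vertex; $G$ is $L$-colorable if there is a proper coloring $\varphi$ with $\varphi(v)\in L(v)$ for all $v$. For $f:V(G)\to\mathbb{N}$, $G$ is $f$-list colorable if it is $L$-colorable for every list assignment $L$ with $|L(v)|=f(v)$ for all $v$. A graph is $K_5$-minor-free if it has no minor isomorphic to $K_5$. -}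

module Defs where

open import Data.Nat using (ℕ; zero; suc; _+_; _*_; _≤_; _⊓_)
open import Data.Fin using (Fin; toℕ) renaming (zero to fzero; suc to fsuc)
open import Data.Bool using (Bool; true; false; if_then_else_; _∧_; not)
open import Data.List using (List; length)
open import Data.List.Membership.Propositional using (_∈_)
open import Data.List.Relation.Unary.Unique.Propositional using (Unique)
open import Data.Product using (Σ; ∃; ∃-syntax; _×_; _,_)
open import Data.Sum using (_⊎_)
open import Data.Empty using (⊥)
open import Function using (_∘_)
open import Function.Definitions using (Injective)
open import Relation.Nullary using (¬_)
open import Relation.Binary.PropositionalEquality using (_≡_; _≢_)

record Graph (n : ℕ) : Set where
  field
    adj    : Fin n → Fin n → Bool
    sym    : ∀ u v → adj u v ≡ adj v u
    irrefl : ∀ v → adj v v ≡ false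

open Graph public

E : ∀ {n} → Graph n → Fin n → Fin n → Set
E G u v = adj G u v ≡ true

countTrue : ∀ {n} → (Fin n → Bool) → ℕ
countTrue {zero}  f = 0
countTrue {suc n} f = (if f fzero then 1 else 0) + countTrue (f ∘ fsuc)

deg : ∀ {n} → Graph n → Fin n → ℕ
deg G v = countTrue (adj G v)

VSet : ℕ → Set
VSet n = Fin n → Bool

_∈ᵥ_ : ∀ {n} → Fin n → VSet n → Set
v ∈ᵥ S = S v ≡ true

_⊆ᵥ_ : ∀ {n} → VSet n → VSet n → Set
A ⊆ᵥ B = ∀ v → v ∈ᵥ A → v ∈ᵥ B

fullSet : ∀ {n} → VSet n
fullSet _ = true

_─_ : ∀ {n} → VSet n → Fin n → VSet n
(S ─ w) v = S v ∧ not (adj-eq v w)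
  where
  adj-eq : ∀ {n} → Fin n → Fin n → Bool
  adj-eq fzero    fzero    = true
  adj-eq (fsuc a) (fsuc b) = adj-eq a b
  adj-eq _        _        = false

NonEmpty : ∀ {n} → VSet n → Set
NonEmpty S = ∃[ v ] v ∈ᵥ S

S< : ∀ {n} → Graph n → ℕ → VSet n
S< G k v = Data.Nat._<ᵇ_ (deg G v) k
  where import Data.Nat

data Walk {n} (G : Graph n) (P : VSet n) : Fin n → Fin n → ℕ → Set where
  here : ∀ {v} → v ∈ᵥ P → Walk G P v v 0
  step : ∀ {u w v ℓ} → u ∈ᵥ P → E G u w → Walk G P w v ℓ → Walk G P u v (suc ℓ)

Joined : ∀ {n} → Graph n → VSet n → Fin n → Fin n → Set
Joined G P u v = ∃[ ℓ ] Walk G P u v ℓ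

-- G[P] is connected (the empty graph counts as connected)
ConnectedIn : ∀ {n} → Graph n → VSet n → Set
ConnectedIn G P = ∀ u v → u ∈ᵥ P → v ∈ᵥ P → Joined G P u v

-- d(S_k) ≥ 3, with the conventions of the paper:
--  * d(S_k) = 0 if G[S_k] has at most one component, so G[S_k] must have
--    at least two components;
--  * the distance of two distinct components of G[S_k] is the least
--    distance in G between their vertices (∞ if no path), hence every
--    walk in G between vertices of different components of G[S_k] has
--    length ≥ 3.

DistS≥3 : ∀ {n} → Graph n → ℕ → Set
DistS≥3 G k =
  (∃[ u ] ∃[ v ] (u ∈ᵥ S< G k × v ∈ᵥ S< G k × ¬ Joined G (S< G k) u v))
  × (∀ u v → u ∈ᵥ S< G k → v ∈ᵥ S< G k → ¬ Joined G (S< G k) u v →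
       ∀ ℓ → Walk G fullSet u v ℓ → 3 ≤ ℓ)

record K5Minor {n} (G : Graph n) : Set where
  field
    branch    : Fin 5 → VSet n
    disjoint  : ∀ i j v → v ∈ᵥ branch i → v ∈ᵥ branch j → i ≡ j
    nonempty  : ∀ i → NonEmpty (branch i)
    connected : ∀ i → ConnectedIn G (branch i)
    joined    : ∀ i j → i ≢ j →
                ∃[ u ] ∃[ v ] (u ∈ᵥ branch i × v ∈ᵥ branch j × E G u v)

K5MinorFree : ∀ {n} → Graph n → Set
K5MinorFree G = ¬ K5Minor G

IsComponent : ∀ {n} → Graph n → VSet n → Set
IsComponent G C =
  NonEmpty C × ConnectedIn G C ×
  (∀ D → C ⊆ᵥ D → ConnectedIn G D → D ⊆ᵥ C)

NoCutVertex : ∀ {n} → Graph n → VSet n → Set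
NoCutVertex G B =
  ConnectedIn G B × (∀ w → w ∈ᵥ B → ConnectedIn G (B ─ w))

-- B is a block of G[C]: a maximal connected subgraph of G[C] without a
-- cut vertex (blocks are induced subgraphs, so given by vertex sets)
IsBlockOf : ∀ {n} → Graph n → VSet n → VSet n → Set
IsBlockOf G C B =
  B ⊆ᵥ C × NonEmpty B × NoCutVertex G B ×
  (∀ D → D ⊆ᵥ C → B ⊆ᵥ D → NoCutVertex G D → D ⊆ᵥ B)

IsComplete : ∀ {n} → Graph n → VSet n → Set
IsComplete G B = ∀ u v → u ∈ᵥ B → v ∈ᵥ B → u ≢ v → E G u v

Consecutive : ∀ {m} → Fin (suc m) → Fin (suc m) → Set
Consecutive {m} i j = toℕ j ≡ suc (toℕ i) ⊎ (toℕ i ≡ m × toℕ j ≡ 0)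

IsOddCycle : ∀ {n} → Graph n → VSet n → Set
IsOddCycle {n} G B =
  ∃[ r ] Σ (Fin (suc (2 + 2 * r)) → Fin n) λ c →
    Injective _≡_ _≡_ c ×
    (∀ v → (v ∈ᵥ B → ∃[ i ] c i ≡ v) × (∃[ i ] c i ≡ v → v ∈ᵥ B)) ×
    (∀ i j → (E G (c i) (c j) → Consecutive i j ⊎ Consecutive j i)
           × (Consecutive i j ⊎ Consecutive j i → E G (c i) (c j)))

-- G[C] is a Gallai tree: every block is a complete graph or an odd cycle
-- (used for connected components C, so G[C] is connected)
IsGallaiTree : ∀ {n} → Graph n → VSet n → Set
IsGallaiTree G C = ∀ B → IsBlockOf G C B → IsComplete G B ⊎ IsOddCycle G B

IsListAssignment : ∀ {n} → (Fin n → ℕ) → (Fin n → List ℕ) → Set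
IsListAssignment f L = ∀ v → Unique (L v) × length (L v) ≡ f v

LColorable : ∀ {n} → Graph n → (Fin n → List ℕ) → Set
LColorable {n} G L =
  Σ (Fin n → ℕ) λ φ → (∀ v → φ v ∈ L v) × (∀ u v → E G u v → φ u ≢ φ v)

FListColorable : ∀ {n} → Graph n → (Fin n → ℕ) → Set
FListColorable G f = ∀ L → IsListAssignment f L → LColorable G L

{-# OPTIONS --safe #-}
module Submission where

open import Defs
open import Data.Bool using (Bool; true; false; not; if_then_else_)
open import Data.Bool.Properties using (not-involutive; not-¬; T-≡) renaming (_≟_ to _≟B_)
open import Data.Empty using (⊥; ⊥-elim)
open import Data.Fin using (Fin; toℕ; fromℕ<) renaming (zero to fzero; suc to fsuc)
open import Data.Fin.Properties using (any?; toℕ-fromℕ<; toℕ<n) renaming (_≟_ to _≟F_)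
open import Data.List using (List; []; _∷_; _++_; _∷ʳ_; length; filter; map; allFin; tabulate; lookup;
  take; drop; initLast; _∷ʳ′_)
open import Data.List.Membership.Propositional using () renaming (_∈_ to _∈ₗ_; _∉_ to _∉ₗ_)
open import Data.List.Membership.Propositional.Properties
  using (∈-filter⁺; ∈-filter⁻; ∈-allFin; ∈-map⁺; ∈-map⁻; ∈-++⁺ˡ; ∈-++⁺ʳ; ∈-++⁻; ∈-∃++; ∈-lookup)
open import Data.List.Properties
  using (length-map; length-++; length-take; length-drop; take++drop≡id; ++-assoc; ++-identityʳ)
open import Data.List.Relation.Unary.All as All using (All; []; _∷_)
import Data.List.Relation.Unary.All.Properties as AllP
open import Data.List.Relation.Unary.AllPairs using (AllPairs; []; _∷_)
open import Data.List.Relation.Unary.Any using (here; there; index)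
open import Data.List.Relation.Unary.Any.Properties using (lookup-index)
open import Data.List.Relation.Unary.Linked using (Linked; []; [-]; _∷_)
open import Data.List.Relation.Unary.Unique.Propositional using (Unique)
import Data.List.Relation.Unary.Unique.Propositional.Properties as UniqueP
open import Data.Nat using (ℕ; zero; suc; _+_; _*_; _∸_; _≤_; _<_; _⊓_; _≟_; _≤?_; _<?_; z≤n; s≤s; s≤s⁻¹)
import Data.List.Membership.DecPropositional as DecMem
open DecMem _≟_ using () renaming (_∈?_ to _∈ₗ?_)
open import Data.Nat.Properties hiding (_≟_; _≤?_; _<?_)
open import Data.Product using (Σ; ∃; _×_; _,_; proj₁; proj₂)
open import Data.Sum using (_⊎_; inj₁; inj₂) renaming (swap to swap⊎)
open import Data.Unit using (⊤; tt)
open import Function using (_∘_; id; case_of_)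
open import Function.Bundles using (Equivalence)
open import Relation.Binary.PropositionalEquality
  using (_≡_; _≢_; refl; cong; subst; trans; ≢-sym) renaming (sym to esym)
open import Relation.Nullary using (¬_; Dec; yes; no; does; ¬?; _×-dec_; _⊎-dec_)
open import Relation.Nullary.Decidable using (dec-true; dec-false; map′)
open import Relation.Unary using (Decidable)

-- Call a vertex low if its degree is below k. Low components that are whole components of G are
-- coloured by the degree-choosability theorem, through Brooks-type arguments inside one block.
-- For any other low component C it suffices to forbid at most k − 5 colours at each high
-- neighbour of C so that every colouring of the rest extends to C; since low components are far
-- apart, these restrictions do not accumulate, and the high vertices keep five colours each.
-- The restrictions are found at a leaf block of C. The only hard case is a K₄ whose three
-- non-cut vertices have high neighbours: a high vertex adjacent to all three is either separated
-- from the rest of C by them, in which case the two sides are coloured one after the other, or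
-- gives a K₅ minor.
-- Five-choosability of K₅-minor-free graphs follows Thomassen's proof for planar graphs, with
-- the outer face replaced by a connected set R disjoint from the graph: the rim is the
-- neighbourhood of R, deleting a rim vertex amounts to moving it into R, and a chord becomes a
-- separating pair of rim vertices, found from a cycle in the rim: three attachments on it
-- would give a K₄ minor all of whose bags meet the rim, which R completes to K₅.

-- The obstacle is a leaf block that is a clique: lists as long as the degrees need not suffice
-- there, so help can only come from the colours of high neighbours. The constant 8 is the least `k`
-- for which `k − 5` allows three forbidden colours, and three is what a vertex with at most two
-- neighbours in its component needs to gain a spare colour. Once such vertices are dealt with,
-- every non-root vertex of a leaf block that has a high neighbour has three neighbours in the
-- block, so an odd cycle is impossible and a clique is exactly a K₄. Its three non-root vertices
-- share a list of at most `k − 1` colours. Setting three of them aside leaves up to `k − 4`, one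
-- more than may be forbidden; this single excess colour is handled by two high neighbours of one
-- vertex: if both receive it, they agree, and the vertex has a colour to spare. Degrees and
-- distances of the given graph mean little for a partly coloured one, so the induction carries an
-- invariant on list sizes instead. For five-choosability the graph itself varies in the induction,
-- because splitting at a separating pair adds an edge.

private variable
  n : ℕ
  A : Set

-- Finite vertex sets

infix 4 _∈_ _∉_ _∈?_ _⊆_

-- The record lets `v` and `S` be inferred from a membership proof. The bare equation `S v ≡ true`
-- may reduce, and unification cannot recover `S` from it.
record _∈_ {n : ℕ} (v : Fin n) (S : VSet n) : Set where
  constructor mem
  field get : v ∈ᵥ S

open _∈_

_∉_ : Fin n → VSet n → Set
v ∉ S = ¬ (v ∈ S)

_⊆_ : VSet n → VSet n → Set
S ⊆ T = ∀ {v} → v ∈ S → v ∈ T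

_∈?_ : (v : Fin n) (S : VSet n) → Dec (v ∈ S)
v ∈? S = map′ mem get (S v ≟B true)

module _ {P : Fin n → Set} (P? : Decidable P) where

  find : (∃ λ v → P v) ⊎ (∀ v → ¬ P v)
  find with any? P?
  ... | yes p = inj₁ p
  ... | no ¬p = inj₂ λ v q → ¬p (v , q)

  opaque
    ⟦_⟧ : VSet n
    ⟦_⟧ v = does (P? v)

    ⟦⟧-in : ∀ {v} → P v → v ∈ ⟦_⟧
    ⟦⟧-in p = mem (dec-true (P? _) p)

    ⟦⟧-out : ∀ {v} → v ∈ ⟦_⟧ → P v
    ⟦⟧-out {v} (mem e) with P? v | e
    ... | yes p | _ = p
    ... | no _ | ()

opaque
  _∖_ : VSet n → VSet n → VSet n
  S ∖ T = ⟦ (λ v → (v ∈? S) ×-dec ¬? (v ∈? T)) ⟧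

  ∖-in : {S T : VSet n} {v : Fin n} → v ∈ S → v ∉ T → v ∈ S ∖ T
  ∖-in {S = S} {T} p q = ⟦⟧-in (λ v → (v ∈? S) ×-dec ¬? (v ∈? T)) (p , q)

  ∖-out : {S T : VSet n} {v : Fin n} → v ∈ S ∖ T → v ∈ S × v ∉ T
  ∖-out {S = S} {T} = ⟦⟧-out (λ v → (v ∈? S) ×-dec ¬? (v ∈? T))

  _∪_ : VSet n → VSet n → VSet n
  S ∪ T = ⟦ (λ v → (v ∈? S) ⊎-dec (v ∈? T)) ⟧

  ∪-in : {S T : VSet n} {v : Fin n} → v ∈ S ⊎ v ∈ T → v ∈ S ∪ T
  ∪-in {S = S} {T} = ⟦⟧-in (λ v → (v ∈? S) ⊎-dec (v ∈? T))

  ∪-out : {S T : VSet n} {v : Fin n} → v ∈ S ∪ T → v ∈ S ⊎ v ∈ T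
  ∪-out {S = S} {T} = ⟦⟧-out (λ v → (v ∈? S) ⊎-dec (v ∈? T))

  _∩_ : VSet n → VSet n → VSet n
  S ∩ T = ⟦ (λ v → (v ∈? S) ×-dec (v ∈? T)) ⟧

  ∩-in : {S T : VSet n} {v : Fin n} → v ∈ S → v ∈ T → v ∈ S ∩ T
  ∩-in {S = S} {T} p q = ⟦⟧-in (λ v → (v ∈? S) ×-dec (v ∈? T)) (p , q)

  ∩-out : {S T : VSet n} {v : Fin n} → v ∈ S ∩ T → v ∈ S × v ∈ T
  ∩-out {S = S} {T} = ⟦⟧-out (λ v → (v ∈? S) ×-dec (v ∈? T))

  ｛_｝ : Fin n → VSet n
  ｛ a ｝ = ⟦ (_≟F a) ⟧

  ｛｝-in : {a : Fin n} → a ∈ ｛ a ｝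
  ｛｝-in {a = a} = ⟦⟧-in (_≟F a) refl

  ｛｝-out : {a v : Fin n} → v ∈ ｛ a ｝ → v ≡ a
  ｛｝-out {a = a} = ⟦⟧-out (_≟F a)

  _-_ : VSet n → Fin n → VSet n
  S - a = S ∖ ｛ a ｝

  minus-in : {S : VSet n} {a v : Fin n} → v ∈ S → v ≢ a → v ∈ S - a
  minus-in p q = ∖-in p (q ∘ ｛｝-out)

  minus-out : {S : VSet n} {a v : Fin n} → v ∈ S - a → v ∈ S × v ≢ a
  minus-out p with ∖-out p
  ... | q , r = q , λ { refl → r ｛｝-in }

infixl 6 _∪_ _∖_ _-_
infixl 7 _∩_

∖⊆ : {S T : VSet n} → S ∖ T ⊆ S
∖⊆ = proj₁ ∘ ∖-out

minus⊆ : {S : VSet n} {a : Fin n} → S - a ⊆ S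
minus⊆ = proj₁ ∘ minus-out

｛｝⊆ : {S : VSet n} {a : Fin n} → a ∈ S → ｛ a ｝ ⊆ S
｛｝⊆ p q with ｛｝-out q
... | refl = p

∖-cover : (S : VSet n) {U : VSet n} {v : Fin n} → v ∈ U → v ∈ U ∖ S ⊎ v ∈ S
∖-cover S {v = v} p with v ∈? S
... | yes q = inj₂ q
... | no q = inj₁ (∖-in p q)

cover-∖ : (S : VSet n) {U : VSet n} {v : Fin n} → v ∈ U → v ∈ S ⊎ v ∈ U ∖ S
cover-∖ S = swap⊎ ∘ ∖-cover S

minus-cover : (a : Fin n) {U : VSet n} {v : Fin n} → v ∈ U → v ∈ ｛ a ｝ ⊎ v ∈ U - a
minus-cover a {v = v} p with v ≟F a
... | yes refl = inj₁ ｛｝-in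
... | no q = inj₂ (minus-in p q)

∈-≢ : {S : VSet n} {u v : Fin n} → u ∈ S → v ∉ S → u ≢ v
∈-≢ p q refl = q p

module _ {P Q R : A → Set} (P? : Decidable P) (Q? : Decidable Q) (R? : Decidable R) where

  -- Sizes of vertex sets, degrees and list lengths are all compared through this one inequality.
  filter-disjoint : ∀ xs → (∀ {x} → P x → R x) → (∀ {x} → Q x → R x) → (∀ {x} → P x → Q x → ⊥) →
                    length (filter P? xs) + length (filter Q? xs) ≤ length (filter R? xs)
  filter-disjoint [] pr qr pq = z≤n
  filter-disjoint (x ∷ xs) pr qr pq with filter-disjoint xs pr qr pq | P? x | Q? x | R? x
  ... | ih | yes p | yes q | _ = ⊥-elim (pq p q)
  ... | ih | yes p | no _ | yes _ = s≤s ih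
  ... | ih | yes p | no _ | no ¬r = ⊥-elim (¬r (pr p))
  ... | ih | no _ | yes q | yes _ =
    subst (_≤ suc (length (filter R? xs))) (esym (+-suc (length (filter P? xs)) _)) (s≤s ih)
  ... | ih | no _ | yes q | no ¬r = ⊥-elim (¬r (qr q))
  ... | ih | no _ | no _ | yes _ = m≤n⇒m≤1+n ih
  ... | ih | no _ | no _ | no _ = ih

∈⇒0<length : {x : A} {xs : List A} → x ∈ₗ xs → 0 < length xs
∈⇒0<length (here _) = s≤s z≤n
∈⇒0<length (there _) = s≤s z≤n

opaque
  ∣_∣ : VSet n → ℕ
  ∣ S ∣ = length (filter (_∈? S) (allFin _))

  ∣∣-< : {S T : VSet n} {z : Fin n} → S ⊆ T → z ∈ T → z ∉ S → ∣ S ∣ < ∣ T ∣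
  ∣∣-< {S = S} {T} {z} S⊆T z∈T z∉S = begin
    suc ∣ S ∣ ≡⟨ +-comm 1 ∣ S ∣ ⟩
    ∣ S ∣ + 1 ≤⟨ +-monoʳ-≤ ∣ S ∣ (∈⇒0<length (∈-filter⁺ (_≟F z) (∈-allFin z) refl)) ⟩
    ∣ S ∣ + length (filter (_≟F z) (allFin _))
      ≤⟨ filter-disjoint (_∈? S) (_≟F z) (_∈? T) (allFin _) S⊆T (λ { refl → z∈T }) (λ { p refl → z∉S p }) ⟩
    ∣ T ∣ ∎
    where open ≤-Reasoning

minus-< : {S : VSet n} {a : Fin n} → a ∈ S → ∣ S - a ∣ < ∣ S ∣
minus-< a∈ = ∣∣-< minus⊆ a∈ (λ p → proj₂ (minus-out p) refl)

∖-< : {S T : VSet n} {a : Fin n} → a ∈ S → a ∈ T → ∣ S ∖ T ∣ < ∣ S ∣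
∖-< a∈S a∈T = ∣∣-< ∖⊆ a∈S (λ p → proj₂ (∖-out p) a∈T)

-- Colour lists

record Colours : Set where
  constructor colours
  field
    list   : List ℕ
    unique : Unique list

open Colours

infix 4 _∈ᶜ_ _∉ᶜ_
infixl 6 _∖ᶜ_

_∈ᶜ_ : ℕ → Colours → Set
c ∈ᶜ l = c ∈ₗ list l

_∉ᶜ_ : ℕ → Colours → Set
c ∉ᶜ l = ¬ (c ∈ᶜ l)

_∈ᶜ?_ : ∀ c l → Dec (c ∈ᶜ l)
c ∈ᶜ? l = c ∈ₗ? list l

size : Colours → ℕ
size l = length (list l)

singleton : ℕ → Colours
singleton c = colours (c ∷ []) ([] ∷ [])

size-≥ : {l l′ : Colours} {m : ℕ} → l ≡ l′ → m ≤ size l′ → m ≤ size l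
size-≥ refl h = h

-- Pigeonhole by induction on `xs`: deleting all copies of the head of `xs` from `ys` costs `ys` at
-- least one entry and leaves it large enough to contain the tail. Repetitions in `ys` do no harm.
unique⊆⇒length≤ : (∀ (x y : A) → Dec (x ≡ y)) → {xs ys : List A} → Unique xs →
                  (∀ {c} → c ∈ₗ xs → c ∈ₗ ys) → length xs ≤ length ys
unique⊆⇒length≤ _ {[]} _ _ = z≤n
unique⊆⇒length≤ _≟_ {x ∷ xs} {ys} (x∉ ∷ u) sub = begin
  suc (length xs) ≤⟨ s≤s (unique⊆⇒length≤ _≟_ u λ c∈ →
      ∈-filter⁺ (λ c → ¬? (c ≟ x)) (sub (there c∈)) (λ { refl → All.lookup x∉ c∈ refl })) ⟩
  suc (length (filter (λ c → ¬? (c ≟ x)) ys)) ≡⟨ +-comm 1 _ ⟩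
  length (filter (λ c → ¬? (c ≟ x)) ys) + 1
    ≤⟨ +-monoʳ-≤ _ (∈⇒0<length (∈-filter⁺ (_≟ x) (sub (here refl)) refl)) ⟩
  length (filter (λ c → ¬? (c ≟ x)) ys) + length (filter (_≟ x) ys)
    ≤⟨ filter-disjoint (λ c → ¬? (c ≟ x)) (_≟ x) (λ _ → yes _) ys (λ _ → _) (λ _ → _) (λ p q → p q) ⟩
  length (filter (λ _ → yes _) ys) ≤⟨ filter-yes ys ⟩
  length ys ∎
  where
  open ≤-Reasoning
  filter-yes : ∀ zs → length (filter {P = λ _ → ⊤} (λ _ → yes tt) zs) ≤ length zs
  filter-yes [] = z≤n
  filter-yes (_ ∷ zs) = s≤s (filter-yes zs)

size-⊆ : {l l′ : Colours} → (∀ {c} → c ∈ᶜ l → c ∈ᶜ l′) → size l ≤ size l′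
size-⊆ {l} = unique⊆⇒length≤ _≟_ (unique l)

opaque
  _∖ᶜ_ : Colours → List ℕ → Colours
  l ∖ᶜ F = colours (filter (λ c → ¬? (c ∈ₗ? F)) (list l))
                   (UniqueP.filter⁺ (λ c → ¬? (c ∈ₗ? F)) (unique l))

  ∖ᶜ-in : {l : Colours} {F : List ℕ} {c : ℕ} → c ∈ᶜ l → c ∉ₗ F → c ∈ᶜ l ∖ᶜ F
  ∖ᶜ-in {F = F} = ∈-filter⁺ (λ c → ¬? (c ∈ₗ? F))

  ∖ᶜ-out : {l : Colours} {F : List ℕ} {c : ℕ} → c ∈ᶜ l ∖ᶜ F → c ∈ᶜ l × c ∉ₗ F
  ∖ᶜ-out {F = F} = ∈-filter⁻ (λ c → ¬? (c ∈ₗ? F))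

∖ᶜ-size : ∀ l F → size l ≤ size (l ∖ᶜ F) + length F
∖ᶜ-size l F = subst (size l ≤_) (length-++ (list (l ∖ᶜ F)))
  (unique⊆⇒length≤ _≟_ (unique l) λ {c} c∈ → case c ∈ₗ? F of λ where
    (yes q) → ∈-++⁺ʳ (list (l ∖ᶜ F)) q
    (no ¬q) → ∈-++⁺ˡ (∖ᶜ-in {l} c∈ ¬q))

pick : ∀ l → 0 < size l → ∃ λ c → c ∈ᶜ l
pick (colours (c ∷ _) _) _ = c , here refl

pick-avoiding : ∀ l F → length F < size l → ∃ λ c → c ∈ᶜ l × c ∉ₗ F
pick-avoiding l F lt with pick (l ∖ᶜ F) (+-cancelʳ-< (length F) 0 _ (<-≤-trans lt (∖ᶜ-size l F)))
... | c , c∈ = c , ∖ᶜ-out {l} c∈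

-- Connectivity and list colourings

module OnGraph (G : Graph n) where

  E? : ∀ u v → Dec (E G u v)
  E? u v = adj G u v ≟B true

  E-sym : ∀ {u v} → E G u v → E G v u
  E-sym {u} {v} e = trans (Graph.sym G v u) e

  E-irrefl : ∀ {u v} → E G u v → u ≢ v
  E-irrefl {u} e refl with trans (esym (irrefl G u)) e
  ... | ()

  opaque
    nb : VSet n → Fin n → List (Fin n)
    nb U v = filter (λ u → (u ∈? U) ×-dec E? v u) (allFin n)

    nb-in : ∀ {U v u} → u ∈ U → E G v u → u ∈ₗ nb U v
    nb-in {U} {v} p e = ∈-filter⁺ (λ u → (u ∈? U) ×-dec E? v u) (∈-allFin _) (p , e)

    nb-out : ∀ {U v u} → u ∈ₗ nb U v → u ∈ U × E G v u
    nb-out {U} {v} p = proj₂ (∈-filter⁻ (λ u → (u ∈? U) ×-dec E? v u) {xs = allFin n} p)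

    nb-unique : ∀ U v → Unique (nb U v)
    nb-unique U v = UniqueP.filter⁺ (λ u → (u ∈? U) ×-dec E? v u) (UniqueP.allFin⁺ n)

  degIn : VSet n → Fin n → ℕ
  degIn U v = length (nb U v)

  opaque
    unfolding nb

    degIn-+ : ∀ {S T U v} → (∀ {u} → u ∈ S → E G v u → u ∈ U) → (∀ {u} → u ∈ T → E G v u → u ∈ U) →
              (∀ {u} → u ∈ S → u ∈ T → ⊥) → degIn S v + degIn T v ≤ degIn U v
    degIn-+ p q r = filter-disjoint _ _ _ (allFin n) (λ (a , e) → p a e , e) (λ (a , e) → q a e , e)
      (λ (a , _) (b , _) → r a b)

    degIn-full : ∀ v → degIn fullSet v ≡ deg G v
    degIn-full v = go id
      where
      go : ∀ {m} (g : Fin m → Fin n) →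
           length (filter (λ u → (u ∈? fullSet) ×-dec E? v u) (tabulate g)) ≡ countTrue (λ i → adj G v (g i))
      go {zero} g = refl
      go {suc m} g with adj G v (g fzero)
      ... | true = cong suc (go (g ∘ fsuc))
      ... | false = go (g ∘ fsuc)

  degIn-pos : ∀ {U u v} → u ∈ U → E G v u → 0 < degIn U v
  degIn-pos p e = ∈⇒0<length (nb-in p e)

  degIn-zero : ∀ {U v} → (∀ {u} → u ∈ U → ¬ E G v u) → degIn U v ≡ 0
  degIn-zero {U} {v} h with nb U v in eq
  ... | [] = refl
  ... | u ∷ _ = let p , e = nb-out (subst (u ∈ₗ_) (esym eq) (here refl)) in ⊥-elim (h p e)

  degIn-mono : ∀ {S U v} → (∀ {u} → u ∈ S → E G v u → u ∈ U) → degIn S v ≤ degIn U v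
  degIn-mono {S} {U} {v} p = ≤-trans (m≤m+n _ (degIn ⟦ none ⟧ v))
    (degIn-+ p (λ q → ⊥-elim (⟦⟧-out none q)) (λ _ → ⟦⟧-out none))
    where
    none : Decidable {A = Fin n} (λ _ → ⊥)
    none _ = no λ ()

  data Path (P : VSet n) : Fin n → Fin n → Set where
    nil  : ∀ {v} → v ∈ P → Path P v v
    cons : ∀ {u w v} → u ∈ P → E G u w → Path P w v → Path P u v

  Path-start : ∀ {P u v} → Path P u v → u ∈ P
  Path-start (nil p) = p
  Path-start (cons p _ _) = p

  Path-end : ∀ {P u v} → Path P u v → v ∈ P
  Path-end (nil p) = p
  Path-end (cons _ _ r) = Path-end r

  infixr 5 _◅◅_
  _◅◅_ : ∀ {P u v w} → Path P u v → Path P v w → Path P u w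
  nil _ ◅◅ q = q
  cons p e r ◅◅ q = cons p e (r ◅◅ q)

  Path-sym : ∀ {P u v} → Path P u v → Path P v u
  Path-sym (nil p) = nil p
  Path-sym (cons p e r) = Path-sym r ◅◅ cons (Path-start r) (E-sym e) (nil p)

  Path-mono : ∀ {P Q u v} → P ⊆ Q → Path P u v → Path Q u v
  Path-mono s (nil p) = nil (s p)
  Path-mono s (cons p e r) = cons (s p) e (Path-mono s r)

  edge-path : ∀ {P u v} → u ∈ P → v ∈ P → E G u v → Path P u v
  edge-path p q e = cons p e (nil q)

  -- The part of `S` inside `P` is then a union of connected components of G[P]; `S` itself may
  -- reach beyond `P`.
  Closed : VSet n → VSet n → Set
  Closed P S = ∀ {u v} → u ∈ S → v ∈ P → E G u v → v ∈ S

  Path-closed : ∀ {P S u v} → Closed P S → u ∈ S → Path P u v → Path (P ∩ S) u v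
  Path-closed cl p (nil q) = nil (∩-in q p)
  Path-closed cl p (cons q e r) = cons (∩-in q p) e (Path-closed cl (cl p (Path-start r) e) r)

  Closed-end : ∀ {P S u v} → Closed P S → u ∈ S → Path P u v → v ∈ S
  Closed-end cl p r = proj₂ (∩-out (Path-end (Path-closed cl p r)))

  Path-avoid : ∀ {P S u v} → Closed P S → u ∉ S → Path P u v → Path (P ∖ S) u v
  Path-avoid cl p (nil q) = nil (∖-in q p)
  Path-avoid cl p (cons q e r) =
    cons (∖-in q p) e (Path-avoid cl (λ w → p (cl w q (E-sym e))) r)

  first-entry : ∀ {P u v} S → Path P u v → u ∉ S → v ∈ S →
                ∃ λ a → ∃ λ b → Path (P ∖ S) u a × b ∈ P × b ∈ S × E G a b
  first-entry S (nil _) p q = ⊥-elim (p q)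
  first-entry S (cons {u} {w} p e r) u∉ q with w ∈? S
  ... | yes w∈ = u , w , nil (∖-in p u∉) , Path-start r , w∈ , e
  ... | no w∉ = let a , b , r′ , rest = first-entry S r w∉ q in a , b , cons (∖-in p u∉) e r′ , rest

  Conn : VSet n → Set
  Conn P = ∀ {u v} → u ∈ P → v ∈ P → Path P u v

  star-conn : ∀ {P r} → (∀ {u} → u ∈ P → Path P u r) → Conn P
  star-conn h p q = h p ◅◅ Path-sym (h q)

  Conn-∪ : ∀ {P Q a b} → Conn P → Conn Q → a ∈ P → b ∈ Q → E G a b → Conn (P ∪ Q)
  Conn-∪ {P} {Q} {a} {b} cP cQ a∈ b∈ e = star-conn {r = a} λ u∈ → case ∪-out u∈ of λ where
    (inj₁ p) → Path-mono (∪-in ∘ inj₁) (cP p a∈)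
    (inj₂ q) → Path-mono (∪-in ∘ inj₂) (cQ q b∈) ◅◅ edge-path (∪-in (inj₂ b∈)) (∪-in (inj₁ a∈)) (E-sym e)

  Conn-｛｝ : ∀ {a} → Conn ｛ a ｝
  Conn-｛｝ p q with ｛｝-out p | ｛｝-out q
  ... | refl | refl = nil ｛｝-in

  Conn-≐ : ∀ {P Q} → P ⊆ Q → Q ⊆ P → Conn P → Conn Q
  Conn-≐ s t c p q = Path-mono s (c (t p) (t q))

  -- A construction sequence from `S` to `U` in which each new vertex has an earlier neighbour;
  -- colourings run through it backwards. Both constructors work up to extensional equality, since
  -- sets are Boolean functions.
  data Grow (S : VSet n) : VSet n → Set where
    base : ∀ {U} → S ⊆ U → U ⊆ S → Grow S U
    add  : ∀ {Z U u v} → Grow S Z → u ∈ Z → v ∉ Z → E G u v →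
           (Z ⊆ U) → v ∈ U → (∀ {w} → w ∈ U → w ∈ Z ⊎ w ≡ v) → Grow S U

  Grow-⊆ : ∀ {S U} → Grow S U → S ⊆ U
  Grow-⊆ (base s _) = s
  Grow-⊆ (add g _ _ _ s _ _) p = s (Grow-⊆ g p)

  Grow-≐ : ∀ {S U W} → U ⊆ W → W ⊆ U → Grow S U → Grow S W
  Grow-≐ s t (base p q) = base (s ∘ p) (q ∘ t)
  Grow-≐ s t (add g u∈ v∉ e p q r) = add g u∈ v∉ e (s ∘ p) (s q) (r ∘ t)

  Grow-conn : ∀ {S U} → Conn S → Grow S U → Conn U
  Grow-conn c (base s t) = Conn-≐ s t c
  Grow-conn c (add g u∈ v∉ e s v∈ r) =
    Conn-≐ (λ w → case ∪-out w of λ where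
              (inj₁ p) → s p
              (inj₂ p) → ｛｝⊆ v∈ p)
           (λ w → case r w of λ where
              (inj₁ p) → ∪-in (inj₁ p)
              (inj₂ refl) → ∪-in (inj₂ ｛｝-in))
           (Conn-∪ (Grow-conn c g) Conn-｛｝ u∈ ｛｝-in e)

  closure : ∀ {S P} → S ⊆ P → Σ (VSet n) λ Z → Grow S Z × Z ⊆ P × Closed P Z
  closure {S} {P} S⊆P = go ∣ P ∖ S ∣ S (base id id) S⊆P ≤-refl
    where
    go : ∀ m Z → Grow S Z → Z ⊆ P → ∣ P ∖ Z ∣ ≤ m → Σ (VSet n) λ Z → Grow S Z × Z ⊆ P × Closed P Z
    go m Z g Z⊆P le with find (λ v → ((v ∈? P) ×-dec ¬? (v ∈? Z)) ×-dec any? (λ u → (u ∈? Z) ×-dec E? u v))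
    ... | inj₂ none = Z , g , Z⊆P , λ {u} {v} u∈ v∈ e → case v ∈? Z of λ where
          (yes p) → p
          (no v∉) → ⊥-elim (none v ((v∈ , v∉) , u , u∈ , e))
    ... | inj₁ (v , (v∈P , v∉Z) , u , u∈Z , e) = enlarge m le
      where
      Z′ = Z ∪ ｛ v ｝
      Z′⊆P : Z′ ⊆ P
      Z′⊆P w with ∪-out w
      ... | inj₁ p = Z⊆P p
      ... | inj₂ p = ｛｝⊆ v∈P p
      smaller : ∣ P ∖ Z′ ∣ < ∣ P ∖ Z ∣
      smaller = ∣∣-< (λ w → let a , b = ∖-out w in ∖-in a (b ∘ ∪-in ∘ inj₁))
        (∖-in v∈P v∉Z) (λ w → proj₂ (∖-out w) (∪-in (inj₂ ｛｝-in)))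
      enlarge : ∀ m → ∣ P ∖ Z ∣ ≤ m → Σ (VSet n) λ Z → Grow S Z × Z ⊆ P × Closed P Z
      enlarge zero le′ = case <-≤-trans smaller le′ of λ ()
      enlarge (suc m) le′ = go m Z′
        (add g u∈Z v∉Z e (∪-in ∘ inj₁) (∪-in (inj₂ ｛｝-in))
          (λ w → case ∪-out w of λ where
            (inj₁ p) → inj₁ p
            (inj₂ p) → inj₂ (｛｝-out p)))
        Z′⊆P (s≤s⁻¹ (<-≤-trans smaller le′))

  record Component (P : VSet n) (z : Fin n) : Set where
    field
      set    : VSet n
      root   : z ∈ set
      sub    : set ⊆ P
      closed : Closed P set
      conn   : Conn set

  component : ∀ {P z} → z ∈ P → Component P z
  component {P} {z} z∈ with closure {｛ z ｝} {P} (｛｝⊆ z∈)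
  ... | Z , g , s , c = record
    { set = Z ; root = Grow-⊆ g ｛｝-in ; sub = s ; closed = c ; conn = Grow-conn Conn-｛｝ g }

  conn-grow : ∀ {S P s} → Conn P → S ⊆ P → s ∈ S → Grow S P
  conn-grow c S⊆P s∈ with closure S⊆P
  ... | Z , g , Z⊆P , cl = Grow-≐ Z⊆P (λ p → Closed-end cl (Grow-⊆ g s∈) (c (S⊆P s∈) p)) g

  Lists : Set
  Lists = Fin n → Colours

  record Col (U : VSet n) (L : Lists) : Set where
    field
      φ      : Fin n → ℕ
      chosen : ∀ {v} → v ∈ U → φ v ∈ᶜ L v
      proper : ∀ {u v} → u ∈ U → v ∈ U → E G u v → φ u ≢ φ v

  open Col

  opaque
    res : (Fin n → ℕ) → VSet n → Lists → Lists
    res f U L v = L v ∖ᶜ map f (nb U v)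

    res-in : ∀ {f U L v c} → c ∈ᶜ L v → (∀ {u} → u ∈ U → E G v u → f u ≢ c) → c ∈ᶜ res f U L v
    res-in {f} {U} {L} {v} c∈ h = ∖ᶜ-in {L v} c∈ λ m →
      let u , u∈ , eq = ∈-map⁻ f m ; p , e = nb-out u∈ in h p e (esym eq)

    res-out : ∀ {f U L v c} → c ∈ᶜ res f U L v → c ∈ᶜ L v × (∀ {u} → u ∈ U → E G v u → f u ≢ c)
    res-out {f} {U} {L} {v} c∈ = let p , q = ∖ᶜ-out {L v} c∈ in
      p , λ u∈ e eq → q (subst (_∈ₗ _) eq (∈-map⁺ f (nb-in u∈ e)))

    res-size : ∀ f U L v → size (L v) ≤ size (res f U L v) + degIn U v
    res-size f U L v = subst (λ k → size (L v) ≤ size (res f U L v) + k) (length-map f (nb U v))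
      (∖ᶜ-size (L v) (map f (nb U v)))

  -- The neighbour w of v costs no colour of v.
  res-size-spare : ∀ {f U L v w} → w ∈ U → E G v w →
    (f w ∉ᶜ L v ⊎ ∃ λ w′ → w′ ∈ U × w′ ≢ w × E G v w′ × f w′ ≡ f w) →
    size (L v) < size (res f U L v) + degIn U v
  res-size-spare {f} {U} {L} {v} {w} w∈ e h = begin
    suc (size (L v)) ≤⟨ s≤s (res-size f (U - w) L v) ⟩
    suc (size (res f (U - w) L v) + degIn (U - w) v)
      ≤⟨ s≤s (+-monoˡ-≤ (degIn (U - w) v) (size-⊆ {res f (U - w) L v} {res f U L v} same)) ⟩
    suc (size (res f U L v) + degIn (U - w) v) ≡⟨ esym (+-suc (size (res f U L v)) (degIn (U - w) v)) ⟩
    size (res f U L v) + suc (degIn (U - w) v) ≤⟨ +-monoʳ-≤ (size (res f U L v)) less ⟩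
    size (res f U L v) + degIn U v ∎
    where
    open ≤-Reasoning
    less : suc (degIn (U - w) v) ≤ degIn U v
    less = begin
      suc (degIn (U - w) v) ≡⟨ +-comm 1 _ ⟩
      degIn (U - w) v + 1 ≤⟨ +-monoʳ-≤ _ (degIn-pos ｛｝-in e) ⟩
      degIn (U - w) v + degIn ｛ w ｝ v
        ≤⟨ degIn-+ (λ p _ → minus⊆ p) (λ p _ → ｛｝⊆ w∈ p)
                   (λ p q → proj₂ (minus-out p) (｛｝-out q)) ⟩
      degIn U v ∎
    same : ∀ {c} → c ∈ᶜ res f (U - w) L v → c ∈ᶜ res f U L v
    same {c} c∈ with res-out c∈
    ... | c∈L , av = res-in c∈L λ {u} u∈ e′ eq → case u ≟F w of λ where
        (no u≢w) → av (minus-in u∈ u≢w) e′ eq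
        (yes refl) → case h of λ where
          (inj₁ ∉L) → ∉L (subst (_∈ᶜ L v) (esym eq) c∈L)
          (inj₂ (w′ , w′∈ , ne , e″ , eq′)) → av (minus-in w′∈ ne) e″ (trans eq′ eq)

  merge : ∀ {S T U L} (c : Col S L) → Col T (res (φ c) S L) → (∀ {v} → v ∈ U → v ∈ S ⊎ v ∈ T) → Col U L
  merge {S} {T} {U} {L} c d cov = record { φ = f ; chosen = ch ; proper = pr }
    where
    f : Fin n → ℕ
    f v with v ∈? S
    ... | yes _ = φ c v
    ... | no _ = φ d v
    inT : ∀ {v} → v ∈ U → v ∉ S → v ∈ T
    inT p q with cov p
    ... | inj₁ s = ⊥-elim (q s)
    ... | inj₂ t = t
    ch : ∀ {v} → v ∈ U → f v ∈ᶜ L v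
    ch {v} p with v ∈? S
    ... | yes q = chosen c q
    ... | no q = proj₁ (res-out (chosen d (inT p q)))
    pr : ∀ {u v} → u ∈ U → v ∈ U → E G u v → f u ≢ f v
    pr {u} {v} p q e with u ∈? S | v ∈? S
    ... | yes a | yes b = proper c a b e
    ... | yes a | no b = proj₂ (res-out (chosen d (inT q b))) a (E-sym e)
    ... | no a | yes b = λ eq → proj₂ (res-out (chosen d (inT p a))) b e (esym eq)
    ... | no a | no b = proper d (inT p a) (inT q b) e

  Col-lists : ∀ {U L L′} → (∀ {v} → v ∈ U → ∀ {c} → c ∈ᶜ L v → c ∈ᶜ L′ v) → Col U L → Col U L′
  Col-lists h c = record { φ = φ c ; chosen = λ p → h p (chosen c p) ; proper = proper c }

  single-col : ∀ {v L c} → c ∈ᶜ L v → Col ｛ v ｝ L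
  single-col {v} {L} {c} c∈ = record
    { φ = λ _ → c
    ; chosen = λ p → subst (λ u → c ∈ᶜ L u) (esym (｛｝-out p)) c∈
    ; proper = λ p q e → ⊥-elim (E-irrefl e (trans (｛｝-out p) (esym (｛｝-out q)))) }

  -- A coloured neighbour in `S` costs a vertex at most one colour and exactly one unit of remaining
  -- degree, so lists stay as long as the degrees.
  res-deg : ∀ f {S T U L v} → (∀ {u} → u ∈ S → E G v u → u ∈ U) → (∀ {u} → u ∈ T → E G v u → u ∈ U) →
            (∀ {u} → u ∈ S → u ∈ T → ⊥) → degIn U v ≤ size (L v) → degIn T v ≤ size (res f S L v)
  res-deg f {S} {T} {U} {L} {v} s t d le = +-cancelʳ-≤ (degIn S v) _ _ (begin
    degIn T v + degIn S v ≤⟨ degIn-+ t s (λ p q → d q p) ⟩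
    degIn U v ≤⟨ le ⟩
    size (L v) ≤⟨ res-size f S L v ⟩
    size (res f S L v) + degIn S v ∎)
    where open ≤-Reasoning

  res-deg< : ∀ f {S T U L v} → (∀ {u} → u ∈ S → E G v u → u ∈ U) → (∀ {u} → u ∈ T → E G v u → u ∈ U) →
            (∀ {u} → u ∈ S → u ∈ T → ⊥) → degIn U v < size (L v) → degIn T v < size (res f S L v)
  res-deg< f {S} {T} {U} {L} {v} s t d le = +-cancelʳ-< (degIn S v) _ _ (begin-strict
    degIn T v + degIn S v ≤⟨ degIn-+ t s (λ p q → d q p) ⟩
    degIn U v <⟨ le ⟩
    size (L v) ≤⟨ res-size f S L v ⟩
    size (res f S L v) + degIn S v ∎)
    where open ≤-Reasoning

  -- Vertices are coloured in the reverse of the order in which they were added. Each still has an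
  -- uncoloured neighbour when its turn comes, hence a positive remaining degree and a nonempty
  -- list.
  outside : ∀ {S U L} → Grow S U → (∀ {v} → v ∈ U → v ∉ S → degIn U v ≤ size (L v)) → Col (U ∖ S) L
  outside (base _ t) h = record
    { φ = λ _ → 0
    ; chosen = λ p → let a , b = ∖-out p in ⊥-elim (b (t a))
    ; proper = λ p _ _ → let a , b = ∖-out p in ⊥-elim (b (t a)) }
  outside {S} {U} {L} (add {Z} {u = u} {v} g u∈ v∉ e Z⊆U v∈U r) h
    with pick (L v) (<-≤-trans (degIn-pos (Z⊆U u∈) (E-sym e)) (h v∈U (v∉ ∘ Grow-⊆ g)))
  ... | c , c∈ = merge (single-col c∈) (outside g less) λ w∈ →
        let a , b = ∖-out w∈ in case r a of λ where
          (inj₁ z) → inj₂ (∖-in z b)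
          (inj₂ refl) → inj₁ ｛｝-in
    where
    less : ∀ {w} → w ∈ Z → w ∉ S → degIn Z w ≤ size (res (λ _ → c) ｛ v ｝ L w)
    less {w} w∈ w∉ = res-deg (λ _ → c) {U = U} {L = L}
      (λ p _ → ｛｝⊆ v∈U p) (λ p _ → Z⊆U p)
      (λ p q → v∉ (subst (_∈ Z) (｛｝-out p) q)) (h (Z⊆U w∈) w∉)

  -- Everything is coloured towards `r`, which comes last, when its surplus leaves it one colour.
  greedy : ∀ {U L r} → Conn U → r ∈ U → (∀ {v} → v ∈ U → degIn U v ≤ size (L v)) →
           degIn U r < size (L r) → Col U L
  greedy {U} {L} {r} cU r∈ h lt
    with outside {L = L} (conn-grow {｛ r ｝} cU (｛｝⊆ r∈) ｛｝-in) (λ p _ → h p)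
  ... | c with pick (res (φ c) (U ∖ ｛ r ｝) L r)
                    (≤-<-trans z≤n (res-deg< (φ c) {T = ｛ r ｝} {U = U} {L = L} (λ p _ → ∖⊆ p)
                      (λ p _ → ｛｝⊆ r∈ p) (λ p q → proj₂ (∖-out p) q) lt))
  ... | k , k∈ = merge c (single-col k∈) (∖-cover ｛ r ｝)

  -- Giving `a` a colour that `b` does not have costs `b` nothing but lowers its degree, so `b`
  -- becomes a surplus root for `greedy` on the rest.
  swap : ∀ {U L a b c} → (∀ {v} → v ∈ U → degIn U v ≤ size (L v)) → Conn (U - a) →
         a ∈ U → b ∈ U → E G a b → c ∈ᶜ L a → c ∉ᶜ L b → Col U L
  swap {U} {L} {a} {b} {c} h cn a∈ b∈ e c∈ c∉ =
    merge (single-col c∈)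
      (greedy cn (minus-in b∈ (E-irrefl (E-sym e)))
        (λ v∈ → res-deg (λ _ → c) {U = U} {L = L} sub1 (λ p _ → minus⊆ p) dis (h (minus⊆ v∈)))
        (begin-strict
          degIn (U - a) b <⟨ m<m+n _ (degIn-pos ｛｝-in (E-sym e)) ⟩
          degIn (U - a) b + degIn ｛ a ｝ b ≤⟨ degIn-+ (λ p _ → minus⊆ p) sub1 (λ p q → dis q p) ⟩
          degIn U b ≤⟨ h b∈ ⟩
          size (L b) ≤⟨ size-⊆ {L b} {res (λ _ → c) ｛ a ｝ L b} (λ k∈ → res-in k∈ λ _ _ eq → c∉ (subst (_∈ᶜ L b) (esym eq) k∈)) ⟩
          size (res (λ _ → c) ｛ a ｝ L b) ∎))
      (minus-cover a)
    where
    open ≤-Reasoning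
    sub1 : ∀ {v u} → u ∈ ｛ a ｝ → E G v u → u ∈ U
    sub1 p _ = ｛｝⊆ a∈ p
    dis : ∀ {u} → u ∈ ｛ a ｝ → u ∈ U - a → ⊥
    dis p q = proj₂ (minus-out q) (｛｝-out p)

-- Lists, cycles and K₅ models

pair : Fin n → Fin n → VSet n
pair a b = ｛ a ｝ ∪ ｛ b ｝

pairˡ : {a b : Fin n} → a ∈ pair a b
pairˡ = ∪-in (inj₁ ｛｝-in)

pairʳ : {a b : Fin n} → b ∈ pair a b
pairʳ = ∪-in (inj₂ ｛｝-in)

pair-out : {a b v : Fin n} → v ∈ pair a b → v ≡ a ⊎ v ≡ b
pair-out p with ∪-out p
... | inj₁ q = inj₁ (｛｝-out q)
... | inj₂ q = inj₂ (｛｝-out q)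

infix 4 _∈ₗF?_
_∈ₗF?_ : (v : Fin n) (l : List (Fin n)) → Dec (v ∈ₗ l)
_∈ₗF?_ = DecMem._∈?_ _≟F_

opaque
  setOf : List (Fin n) → VSet n
  setOf l = ⟦ _∈ₗF? l ⟧

  setOf-in : {l : List (Fin n)} {v : Fin n} → v ∈ₗ l → v ∈ setOf l
  setOf-in {l = l} = ⟦⟧-in (_∈ₗF? l)

  setOf-out : {l : List (Fin n)} {v : Fin n} → v ∈ setOf l → v ∈ₗ l
  setOf-out {l = l} = ⟦⟧-out (_∈ₗF? l)

lastOf : A → List A → A
lastOf h [] = h
lastOf _ (h ∷ t) = lastOf h t

lastOf-∈ : (h : A) (t : List A) → lastOf h t ∈ₗ h ∷ t
lastOf-∈ h [] = here refl
lastOf-∈ h (h′ ∷ t) = there (lastOf-∈ h′ t)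

lastOf-++ : (h : A) (p : List A) (c : A) (q : List A) → lastOf h (p ++ c ∷ q) ≡ lastOf c q
lastOf-++ h [] c q = refl
lastOf-++ h (h′ ∷ p) c q = lastOf-++ h′ p c q

unique-++ : {p q : List A} → Unique (p ++ q) → ∀ {v} → v ∈ₗ p → v ∈ₗ q → ⊥
unique-++ {p = x ∷ p} (x∉ ∷ u) (here refl) w = All.lookup x∉ (∈-++⁺ʳ p w) refl
unique-++ {p = x ∷ p} (x∉ ∷ u) (there v) w = unique-++ u v w

unique-++ˡ : (p : List A) {q : List A} → Unique (p ++ q) → Unique p
unique-++ˡ [] u = []
unique-++ˡ (x ∷ p) (x∉ ∷ u) = AllP.++⁻ˡ p x∉ ∷ unique-++ˡ p u

unique-++ʳ : (p : List A) {q : List A} → Unique (p ++ q) → Unique q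
unique-++ʳ [] u = u
unique-++ʳ (x ∷ p) (_ ∷ u) = unique-++ʳ p u

module _ {R : A → A → Set} where

  linked-prefix : (p : List A) {c : A} {q : List A} → Linked R (p ++ c ∷ q) → Linked R (p ++ c ∷ [])
  linked-prefix [] l = [-]
  linked-prefix (x ∷ []) (r ∷ l) = r ∷ [-]
  linked-prefix (x ∷ y ∷ p) (r ∷ l) = r ∷ linked-prefix (y ∷ p) l

  linked-suffix : (p : List A) {q : List A} → Linked R (p ++ q) → Linked R q
  linked-suffix [] l = l
  linked-suffix (x ∷ []) {[]} l = []
  linked-suffix (x ∷ []) {y ∷ q} (_ ∷ l) = l
  linked-suffix (x ∷ y ∷ p) (_ ∷ l) = linked-suffix (y ∷ p) l

  linked-init : (p : List A) {q : List A} → Linked R (p ++ q) → Linked R p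
  linked-init [] l = []
  linked-init (x ∷ []) l = [-]
  linked-init (x ∷ y ∷ p) (r ∷ l) = r ∷ linked-init (y ∷ p) l

  linked-last : (h : A) (p : List A) {c : A} {q : List A} → Linked R (h ∷ p ++ c ∷ q) → R (lastOf h p) c
  linked-last h [] (r ∷ _) = r
  linked-last h (h′ ∷ p) (_ ∷ l) = linked-last h′ p l

data First {A : Set} (P : A → Set) (l : List A) : Set where
  none  : (∀ {v} → v ∈ₗ l → ¬ P v) → First P l
  found : ∀ p c q → l ≡ p ++ c ∷ q → (∀ {v} → v ∈ₗ p → ¬ P v) → P c → First P l

first : {P : A → Set} → Decidable P → ∀ l → First P l
first P? [] = none λ ()
first P? (x ∷ l) with P? x | first P? l
... | yes p | _ = found [] x l refl (λ ()) p
... | no ¬p | none h = none λ { (here refl) → ¬p ; (there v) → h v }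
... | no ¬p | found p c q refl h pc = found (x ∷ p) c q refl (λ { (here refl) → ¬p ; (there v) → h v }) pc

third : (∀ (u v : A) → Dec (u ≡ v)) → {h : A} {t : List A} → Unique (h ∷ t) → 2 ≤ length t → ∀ a b →
        ∃ λ w → w ∈ₗ h ∷ t × w ≢ a × w ≢ b
third _≟_ {h} {g ∷ k ∷ t} ((h≢g ∷ h≢k ∷ _) ∷ (g≢k ∷ _) ∷ _) _ a b with h ≟ a | h ≟ b | g ≟ a | g ≟ b
... | no p | no q | _ | _ = h , here refl , p , q
... | _ | _ | no p | no q = g , there (here refl) , p , q
... | yes refl | _ | _ | yes refl = k , there (there (here refl)) , ≢-sym h≢k , ≢-sym g≢k
... | _ | yes refl | yes refl | _ = k , there (there (here refl)) , ≢-sym g≢k , ≢-sym h≢k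
... | yes refl | _ | yes refl | _ = ⊥-elim (h≢g refl)
... | _ | yes refl | _ | yes refl = ⊥-elim (h≢g refl)
third _ {t = []} _ ()
third _ {t = _ ∷ []} _ (s≤s ())

allPairs-lookup : {R : A → A → Set} → (∀ {u v} → R u v → R v u) → {l : List A} → AllPairs R l →
                  ∀ {i j} → i ≢ j → R (lookup l i) (lookup l j)
allPairs-lookup s (r ∷ _) {fzero} {fzero} ne = ⊥-elim (ne refl)
allPairs-lookup s (r ∷ _) {fzero} {fsuc j} ne = All.lookup r (∈-lookup j)
allPairs-lookup s (_ ∷ rs) {fsuc i} {fsuc j} ne = allPairs-lookup s rs (ne ∘ cong fsuc)
allPairs-lookup s (r ∷ _) {fsuc i} {fzero} ne = s (All.lookup r (∈-lookup i))

module Minors (G : Graph n) where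
  open OnGraph G

  Touch : VSet n → VSet n → Set
  Touch S T = ∃ λ u → ∃ λ v → u ∈ S × v ∈ T × E G u v

  Apart : VSet n → VSet n → Set
  Apart S T = (∀ {v} → v ∈ S → v ∉ T) × Touch S T

  Apart-sym : ∀ {S T} → Apart S T → Apart T S
  Apart-sym (d , u , v , p , q , e) = (λ x y → d y x) , v , u , q , p , E-sym e

  record Model (M : VSet n) : Set where
    field
      bag   : Fin 5 → VSet n
      bag⊆  : ∀ i → bag i ⊆ M
      conn  : ∀ i → Conn (bag i)
      apart : ∀ {i j} → i ≢ j → Apart (bag i) (bag j)

  Free : VSet n → Set
  Free M = ¬ Model M

  Good-bag : VSet n → VSet n → Set
  Good-bag M S = S ⊆ M × Conn S

  model : ∀ {M B₀ B₁ B₂ B₃ B₄} → let Bs = B₀ ∷ B₁ ∷ B₂ ∷ B₃ ∷ B₄ ∷ [] in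
          All (Good-bag M) Bs → AllPairs Apart Bs → Model M
  model {B₀ = B₀} {B₁} {B₂} {B₃} {B₄} g ap = record
    { bag = lookup Bs
    ; bag⊆ = λ i → proj₁ (All.lookup g (∈-lookup i))
    ; conn = λ i → proj₂ (All.lookup g (∈-lookup i))
    ; apart = allPairs-lookup (λ {S} {T} → Apart-sym {S} {T}) ap }
    where Bs = B₀ ∷ B₁ ∷ B₂ ∷ B₃ ∷ B₄ ∷ []

  Free-mono : ∀ {M N} → N ⊆ M → Free M → Free N
  Free-mono s f m = f (record
    { bag = bag ; bag⊆ = λ i p → s (bag⊆ i p) ; conn = conn ; apart = apart })
    where open Model m

  linked-conn : ∀ {l} → Linked (E G) l → Conn (setOf l)
  linked-conn {[]} _ p _ = case setOf-out p of λ ()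
  linked-conn {h ∷ t} l = star-conn (to-head l ∘ setOf-out)
    where
    to-head : ∀ {h t v} → Linked (E G) (h ∷ t) → v ∈ₗ h ∷ t → Path (setOf (h ∷ t)) v h
    to-head l (here refl) = nil (setOf-in (here refl))
    to-head (e ∷ l) (there p) = Path-mono (setOf-in ∘ there ∘ setOf-out) (to-head l p)
      ◅◅ edge-path (setOf-in (there (here refl))) (setOf-in (here refl)) (E-sym e)

  record Cycle (h : Fin n) (t : List (Fin n)) : Set where
    field
      linked   : Linked (E G) (h ∷ t)
      close    : E G (lastOf h t) h
      distinct : Unique (h ∷ t)
      long     : 2 ≤ length t

  record Arc (l : List (Fin n)) (a b : Fin n) : Set where
    field
      set   : VSet n
      sub   : set ⊆ setOf l
      conn  : Conn set
      a∉    : a ∉ set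
      b∉    : b ∉ set
      {s t} : Fin n
      s∈    : s ∈ set
      a~s   : E G a s
      t∈    : t ∈ set
      b~t   : E G b t

  -- `a` and `b` are meant to be a separating pair. If there are fewer than two attachments, the
  -- pair is completed to two consecutive vertices of the cycle, so that the edge case of `link`
  -- applies. Otherwise both are attachments and `link` offers two connections between them: through
  -- the attached set, or along the arc of the cycle.
  record Attach (l : List (Fin n)) (Att : Fin n → Set) : Set where
    field
      {a b} : Fin n
      a∈    : a ∈ₗ l
      b∈    : b ∈ₗ l
      a≢b   : a ≢ b
      only  : ∀ {c} → c ∈ₗ l → Att c → c ≡ a ⊎ c ≡ b
      link  : E G a b ⊎ (Att a × Att b × Arc l a b)

  record Three (l : List (Fin n)) (Att : Fin n → Set) : Set where
    field
      {p₁ p₂ q}    : List (Fin n)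
      {c₁ c₂ c₃}   : Fin n
      split        : l ≡ p₁ ++ c₁ ∷ p₂ ++ c₂ ∷ q
      c₃∈          : c₃ ∈ₗ q
      att₁         : Att c₁
      att₂         : Att c₂
      att₃         : Att c₃

  analyse : ∀ {h t Att} → Cycle h t → Decidable Att → Attach (h ∷ t) Att ⊎ Three (h ∷ t) Att
  analyse {h} {g ∷ t} {Att} cyc att? with first att? (h ∷ g ∷ t)
  ... | none no₀ = inj₁ record
    { a∈ = here refl ; b∈ = there (here refl) ; a≢b = E-irrefl (edge (Cycle.linked cyc))
    ; only = λ p q → ⊥-elim (no₀ p q) ; link = inj₁ (edge (Cycle.linked cyc)) }
    where
    edge : ∀ {u v r} → Linked (E G) (u ∷ v ∷ r) → E G u v
    edge (e ∷ _) = e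
  ... | found p c q eq no₁ ac with first att? q
  analyse {h} {g ∷ t} {Att} cyc att? | found p c [] eq no₁ ac | none no₂ = inj₁ record
    { a∈ = subst (c ∈ₗ_) (esym eq) (∈-++⁺ʳ p (here refl)) ; b∈ = here refl
    ; a≢b = E-irrefl edge
    ; only = λ m a → case ∈-++⁻ p (subst (_ ∈ₗ_) eq m) of λ where
        (inj₁ m′) → ⊥-elim (no₁ m′ a)
        (inj₂ (here e)) → inj₁ e
    ; link = inj₁ edge }
    where
    last≡ : ∀ p {h t} → h ∷ t ≡ p ++ c ∷ [] → lastOf h t ≡ c
    last≡ [] refl = refl
    last≡ (x ∷ p) refl = lastOf-++ x p c []
    edge : E G c h
    edge = subst (λ u → E G u h) (last≡ p eq) (Cycle.close cyc)
  analyse {h} {g ∷ t} {Att} cyc att? | found p c (d ∷ q) eq no₁ ac | none no₂ = inj₁ record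
    { a∈ = subst (c ∈ₗ_) (esym eq) (∈-++⁺ʳ p (here refl))
    ; b∈ = subst (d ∈ₗ_) (esym eq) (∈-++⁺ʳ p (there (here refl)))
    ; a≢b = E-irrefl edge
    ; only = λ m a → case ∈-++⁻ p (subst (_ ∈ₗ_) eq m) of λ where
        (inj₁ m′) → ⊥-elim (no₁ m′ a)
        (inj₂ (here e)) → inj₁ e
        (inj₂ (there m′)) → ⊥-elim (no₂ m′ a)
    ; link = inj₁ edge }
    where
    edge : E G c d
    edge with linked-suffix p (subst (Linked (E G)) eq (Cycle.linked cyc))
    ... | e ∷ _ = e
  analyse {h} {g ∷ t} {Att} cyc att? | found p c q eq no₁ ac | found p₂ c₂ q₂ eq₂ no₂ ac₂
    with first att? q₂
  ... | found p₃ c₃ q₃ eq₃ no₃ ac₃ = inj₂ record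
    { split = trans eq (cong (λ z → p ++ c ∷ z) eq₂)
    ; c₃∈ = subst (c₃ ∈ₗ_) (esym eq₃) (∈-++⁺ʳ p₃ (here refl))
    ; att₁ = ac ; att₂ = ac₂ ; att₃ = ac₃ }
  ... | none no₃ = inj₁ record
    { a∈ = mem-l (∈-++⁺ʳ p (here refl))
    ; b∈ = mem-l (∈-++⁺ʳ p (there (∈-++⁺ʳ p₂ (here refl))))
    ; a≢b = λ { refl → unique-++ {p = c ∷ p₂} un′ (here refl) (here refl) }
    ; only = λ m a → case ∈-++⁻ p (subst (_ ∈ₗ_) eq′ m) of λ where
        (inj₁ m′) → ⊥-elim (no₁ m′ a)
        (inj₂ (here e)) → inj₁ e
        (inj₂ (there m′)) → case ∈-++⁻ p₂ m′ of λ where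
          (inj₁ m″) → ⊥-elim (no₂ m″ a)
          (inj₂ (here e)) → inj₂ e
          (inj₂ (there m″)) → ⊥-elim (no₃ m″ a)
    ; link = link p₂ refl }
    where
    l = h ∷ g ∷ t
    eq′ : l ≡ p ++ c ∷ p₂ ++ c₂ ∷ q₂
    eq′ = trans eq (cong (λ z → p ++ c ∷ z) eq₂)
    mem-l : ∀ {v} → v ∈ₗ p ++ c ∷ p₂ ++ c₂ ∷ q₂ → v ∈ₗ l
    mem-l = subst (_ ∈ₗ_) (esym eq′)
    lk : Linked (E G) (c ∷ p₂ ++ c₂ ∷ q₂)
    lk = linked-suffix p (subst (Linked (E G)) eq′ (Cycle.linked cyc))
    un′ : Unique (c ∷ p₂ ++ c₂ ∷ q₂)
    un′ = unique-++ʳ p (subst Unique eq′ (Cycle.distinct cyc))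
    link : ∀ s → s ≡ p₂ → E G c c₂ ⊎ (Att c × Att c₂ × Arc l c c₂)
    link [] refl = inj₁ (linked-last c [] lk)
    link (s ∷ ss) refl = inj₂ (ac , ac₂ , record
      { set = setOf (s ∷ ss)
      ; sub = λ v∈ → setOf-in (mem-l (∈-++⁺ʳ p (there (∈-++⁺ˡ (setOf-out v∈)))))
      ; conn = linked-conn (linked-init (s ∷ ss) (linked-suffix (c ∷ []) lk))
      ; a∉ = λ v∈ → unique-++ {p = c ∷ []} un′ (here refl) (∈-++⁺ˡ (setOf-out v∈))
      ; b∉ = λ v∈ → unique-++ {p = c ∷ s ∷ ss} un′ (there (setOf-out v∈)) (here refl)
      ; s∈ = setOf-in (here refl)
      ; a~s = linked-last c [] lk
      ; t∈ = setOf-in (lastOf-∈ s ss)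
      ; b~t = E-sym (linked-last c (s ∷ ss) lk) })

  -- Three attachments cut the cycle into three segments; with Z and R they form a K₅ minor.
  K₅-cycle : ∀ {M h t Z R} → Cycle h t → Three (h ∷ t) (λ c → ∃ λ z → z ∈ Z × E G c z) →
             (∀ {v} → v ∈ₗ h ∷ t → v ∈ M × v ∉ Z × v ∉ R × (∃ λ r → r ∈ R × E G v r)) →
             Z ⊆ M → R ⊆ M → Conn Z → Conn R → Apart Z R → Model M
  K₅-cycle {M} {h} {t} {Z} {R} cyc
    record { p₁ = p₁ ; p₂ = p₂ ; q = d ∷ q ; c₁ = c₁ ; c₂ = c₂ ; c₃ = c₃ ; split = eq ; c₃∈ = c₃∈
           ; att₁ = z₁ , z₁∈ , e₁ ; att₂ = z₂ , z₂∈ , e₂ ; att₃ = z₃ , z₃∈ , e₃ }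
    on Z⊆ R⊆ cZ cR ap =
    model (good lkS₁ in₁ ∷ good lkS₂ in₂ ∷ good lkS₃ in₃ ∷ (Z⊆ , cZ) ∷ (R⊆ , cR) ∷ [])
          ((ap₁₂ ∷ ap₁₃ ∷ toZ in₁ c₁∈ z₁∈ e₁ ∷ toR in₁ c₁∈ ∷ []) ∷
           (ap₂₃ ∷ toZ in₂ c₂∈ z₂∈ e₂ ∷ toR in₂ c₂∈ ∷ []) ∷
           (toZ in₃ c₃∈ z₃∈ e₃ ∷ toR in₃ c₃∈ ∷ []) ∷
           (ap ∷ []) ∷ [] ∷ [])
    where
    -- The cuts lie right after `c₁` and right after `c₂`. Consecutive segments then meet along the
    -- cycle, and `S₃` meets `S₁` through the closing edge.
    S₁ = p₁ ++ c₁ ∷ []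
    S₂ = p₂ ++ c₂ ∷ []
    S₃ = d ∷ q
    rest = p₂ ++ c₂ ∷ S₃
    c₁∈ : c₁ ∈ₗ S₁
    c₁∈ = ∈-++⁺ʳ p₁ (here refl)
    c₂∈ : c₂ ∈ₗ S₂
    c₂∈ = ∈-++⁺ʳ p₂ (here refl)
    eq₁ : h ∷ t ≡ S₁ ++ rest
    eq₁ = trans eq (esym (++-assoc p₁ (c₁ ∷ []) rest))
    eq₂ : rest ≡ S₂ ++ S₃
    eq₂ = esym (++-assoc p₂ (c₂ ∷ []) S₃)
    in₁ : ∀ {v} → v ∈ₗ S₁ → v ∈ₗ h ∷ t
    in₁ m = subst (_ ∈ₗ_) (esym eq₁) (∈-++⁺ˡ m)
    in-rest : ∀ {v} → v ∈ₗ rest → v ∈ₗ h ∷ t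
    in-rest m = subst (_ ∈ₗ_) (esym eq₁) (∈-++⁺ʳ S₁ m)
    in₂ : ∀ {v} → v ∈ₗ S₂ → v ∈ₗ h ∷ t
    in₂ m = in-rest (subst (_ ∈ₗ_) (esym eq₂) (∈-++⁺ˡ m))
    in₃ : ∀ {v} → v ∈ₗ S₃ → v ∈ₗ h ∷ t
    in₃ m = in-rest (subst (_ ∈ₗ_) (esym eq₂) (∈-++⁺ʳ S₂ m))
    un : Unique (S₁ ++ rest)
    un = subst Unique eq₁ (Cycle.distinct cyc)
    un₂ : Unique (S₂ ++ S₃)
    un₂ = subst Unique eq₂ (unique-++ʳ S₁ un)
    lk : Linked (E G) (p₁ ++ c₁ ∷ rest)
    lk = subst (Linked (E G)) eq (Cycle.linked cyc)
    lkS₁ : Linked (E G) S₁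
    lkS₁ = linked-prefix p₁ lk
    lk-rest : Linked (E G) (c₁ ∷ rest)
    lk-rest = linked-suffix p₁ lk
    lkS₂ : Linked (E G) S₂
    lkS₂ = linked-prefix p₂ (linked-suffix (c₁ ∷ []) lk-rest)
    lk₃ : Linked (E G) (c₂ ∷ S₃)
    lk₃ = linked-suffix p₂ (linked-suffix (c₁ ∷ []) lk-rest)
    lkS₃ : Linked (E G) S₃
    lkS₃ = linked-suffix (c₂ ∷ []) lk₃
    good : ∀ {S} → Linked (E G) S → (∀ {v} → v ∈ₗ S → v ∈ₗ h ∷ t) → Good-bag M (setOf S)
    good l i = (λ m → proj₁ (on (i (setOf-out m)))) , linked-conn l
    toZ : ∀ {S c z} → (∀ {v} → v ∈ₗ S → v ∈ₗ h ∷ t) → c ∈ₗ S → z ∈ Z → E G c z → Apart (setOf S) Z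
    toZ i c∈ z∈ e = (λ m → proj₁ (proj₂ (on (i (setOf-out m))))) , _ , _ , setOf-in c∈ , z∈ , e
    toR : ∀ {S c} → (∀ {v} → v ∈ₗ S → v ∈ₗ h ∷ t) → c ∈ₗ S → Apart (setOf S) R
    toR i c∈ = let _ , _ , _ , r , r∈ , e = on (i c∈) in
      (λ m → proj₁ (proj₂ (proj₂ (on (i (setOf-out m)))))) , _ , r , setOf-in c∈ , r∈ , e
    next : ∀ p {c q c′} → Linked (E G) (c ∷ p ++ c′ ∷ q) → ∃ λ w → w ∈ₗ p ++ c′ ∷ [] × E G c w
    next [] (e ∷ _) = _ , here refl , e
    next (x ∷ p) (e ∷ _) = _ , here refl , e
    ends : ∀ p {h t c r} → h ∷ t ≡ p ++ c ∷ r → h ∈ₗ p ++ c ∷ [] × lastOf h t ≡ lastOf c r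
    ends [] refl = here refl , refl
    ends (x ∷ p) {c = c} {r} refl = here refl , lastOf-++ x p c r
    last≡ : lastOf h t ≡ lastOf d q
    last≡ = trans (proj₂ (ends p₁ eq)) (lastOf-++ c₁ p₂ c₂ S₃)
    ap₁₂ : Apart (setOf S₁) (setOf S₂)
    ap₁₂ = let w , w∈ , e = next p₂ lk-rest in
      (λ a b → unique-++ un (setOf-out a) (subst (_ ∈ₗ_) (esym eq₂) (∈-++⁺ˡ (setOf-out b))))
      , _ , w , setOf-in c₁∈ , setOf-in w∈ , e
    ap₂₃ : Apart (setOf S₂) (setOf S₃)
    ap₂₃ = (λ a b → unique-++ un₂ (setOf-out a) (setOf-out b))
      , _ , d , setOf-in c₂∈ , setOf-in (here refl) , linked-last c₂ [] lk₃
    ap₁₃ : Apart (setOf S₁) (setOf S₃)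
    ap₁₃ = (λ a b → unique-++ un (setOf-out a) (subst (_ ∈ₗ_) (esym eq₂) (∈-++⁺ʳ S₂ (setOf-out b))))
      , h , _ , setOf-in (proj₁ (ends p₁ eq)) , setOf-in (lastOf-∈ d q)
      , E-sym (subst (λ u → E G u h) last≡ (Cycle.close cyc))

  open Cycle public

-- Adding an edge without creating a K₅ minor

does-cong : {P Q : Set} (p? : Dec P) (q? : Dec Q) → (P → Q) → (Q → P) → does p? ≡ does q?
does-cong (yes p) (yes q) f g = refl
does-cong (yes p) (no ¬q) f g = ⊥-elim (¬q (f p))
does-cong (no ¬p) (yes q) f g = ⊥-elim (¬p (g q))
does-cong (no ¬p) (no ¬q) f g = refl

does-out : {P : Set} (p? : Dec P) → does p? ≡ true → P
does-out (yes p) _ = p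

module _ (G : Graph n) (a b : Fin n) where

  Edge⁺ : Fin n → Fin n → Set
  Edge⁺ u v = E G u v ⊎ ((u ≡ a × v ≡ b) ⊎ (u ≡ b × v ≡ a))

  edge⁺? : ∀ u v → Dec (Edge⁺ u v)
  edge⁺? u v = OnGraph.E? G u v ⊎-dec (((u ≟F a) ×-dec (v ≟F b)) ⊎-dec ((u ≟F b) ×-dec (v ≟F a)))

  edge⁺-sym : ∀ {u v} → Edge⁺ u v → Edge⁺ v u
  edge⁺-sym (inj₁ e) = inj₁ (OnGraph.E-sym G e)
  edge⁺-sym (inj₂ (inj₁ (p , q))) = inj₂ (inj₂ (q , p))
  edge⁺-sym (inj₂ (inj₂ (p , q))) = inj₂ (inj₁ (q , p))

  addEdge : a ≢ b → Graph n
  addEdge a≢b = record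
    { adj = λ u v → does (edge⁺? u v)
    ; sym = λ u v → does-cong (edge⁺? u v) (edge⁺? v u) edge⁺-sym edge⁺-sym
    ; irrefl = λ v → dec-false (edge⁺? v v) λ where
        (inj₁ e) → OnGraph.E-irrefl G e refl
        (inj₂ (inj₁ (p , q))) → a≢b (trans (esym p) q)
        (inj₂ (inj₂ (p , q))) → a≢b (trans (esym q) p) }

module AddEdge (G : Graph n) (a b : Fin n) (a≢b : a ≢ b) where
  G⁺ : Graph n
  G⁺ = addEdge G a b a≢b

  private
    module M = Minors G
    module M⁺ = Minors G⁺
  open OnGraph G
  private module O⁺ = OnGraph G⁺

  old : ∀ {u v} → E G u v → E G⁺ u v
  old {u} {v} e = dec-true (edge⁺? G a b u v) (inj₁ e)

  new : E G⁺ a b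
  new = dec-true (edge⁺? G a b a b) (inj₂ (inj₁ (refl , refl)))

  which : ∀ {u v} → E G⁺ u v → Edge⁺ G a b u v
  which {u} {v} = does-out (edge⁺? G a b u v)

  Path-old : ∀ {P u v} → Path P u v → O⁺.Path P u v
  Path-old (nil p) = O⁺.nil p
  Path-old (cons p e r) = O⁺.cons p (old e) (Path-old r)

  Path-new : ∀ {P P′ u v} → P ⊆ P′ → (a ∈ P → b ∈ P → Path P′ a b) → O⁺.Path P u v → Path P′ u v
  Path-new s d (O⁺.nil p) = nil (s p)
  Path-new s d (O⁺.cons p e r) with which e
  ... | inj₁ e′ = cons (s p) e′ (Path-new s d r)
  ... | inj₂ (inj₁ (refl , refl)) = d p (O⁺.Path-start r) ◅◅ Path-new s d r
  ... | inj₂ (inj₂ (refl , refl)) = Path-sym (d (O⁺.Path-start r) p) ◅◅ Path-new s d r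

  -- A bag containing a absorbs the detour, which replaces the new edge.
  free-detour : ∀ {M N Q s t} → M.Free M → N ⊆ M → Q ⊆ M → (∀ {v} → v ∈ Q → v ∉ N) → Conn Q →
                s ∈ Q → E G a s → t ∈ Q → E G b t → M⁺.Free N
  free-detour {M} {N} {Q} {s} {t} fr N⊆ Q⊆ dis cQ s∈ a~s t∈ b~t m = fr record
    { bag = bag′ ; bag⊆ = bag′⊆ ; conn = conn′ ; apart = λ ne → (disj ne) , touch ne }
    where
    open M⁺.Model m
    Extra : Fin 5 → Fin n → Set
    Extra i v = v ∈ bag i ⊎ (v ∈ Q × a ∈ bag i)
    extra? : ∀ i v → Dec (Extra i v)
    extra? i v = (v ∈? bag i) ⊎-dec ((v ∈? Q) ×-dec (a ∈? bag i))
    bag′ : Fin 5 → VSet n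
    bag′ i = ⟦ extra? i ⟧
    inc : ∀ {i} → bag i ⊆ bag′ i
    inc {i} p = ⟦⟧-in (extra? i) (inj₁ p)
    incQ : ∀ {i} → a ∈ bag i → Q ⊆ bag′ i
    incQ {i} p q = ⟦⟧-in (extra? i) (inj₂ (q , p))
    bag′⊆ : ∀ i → bag′ i ⊆ M
    bag′⊆ i p with ⟦⟧-out (extra? i) p
    ... | inj₁ q = N⊆ (bag⊆ i q)
    ... | inj₂ (q , _) = Q⊆ q
    aQ : ∀ {i v} → a ∈ bag i → v ∈ Q → Path (bag′ i) v a
    aQ a∈ v∈ = Path-mono (incQ a∈) (cQ v∈ s∈) ◅◅ edge-path (incQ a∈ s∈) (inc a∈) (E-sym a~s)
    detour : ∀ {i} → a ∈ bag i → b ∈ bag i → Path (bag′ i) a b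
    detour a∈ b∈ = Path-sym (edge-path (inc b∈) (incQ a∈ t∈) b~t ◅◅ aQ a∈ t∈)
    old-path : ∀ {i u v} → u ∈ bag i → v ∈ bag i → Path (bag′ i) u v
    old-path {i} p q = Path-new inc detour (conn i p q)
    conn′ : ∀ i → Conn (bag′ i)
    conn′ i {u} {v} p q with ⟦⟧-out (extra? i) p | ⟦⟧-out (extra? i) q
    ... | inj₁ x | inj₁ y = old-path x y
    ... | inj₁ x | inj₂ (y , a∈) = old-path x a∈ ◅◅ Path-sym (aQ a∈ y)
    ... | inj₂ (x , a∈) | inj₁ y = aQ a∈ x ◅◅ old-path a∈ y
    ... | inj₂ (x , a∈) | inj₂ (y , _) = aQ a∈ x ◅◅ Path-sym (aQ a∈ y)
    disj : ∀ {i j v} → i ≢ j → v ∈ bag′ i → v ∉ bag′ j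
    disj {i} {j} ne p q with ⟦⟧-out (extra? i) p | ⟦⟧-out (extra? j) q
    ... | inj₁ x | inj₁ y = proj₁ (apart ne) x y
    ... | inj₁ x | inj₂ (y , _) = dis y (bag⊆ i x)
    ... | inj₂ (x , _) | inj₁ y = dis x (bag⊆ j y)
    ... | inj₂ (_ , x) | inj₂ (_ , y) = proj₁ (apart ne) x y
    touch : ∀ {i j} → i ≢ j → M.Touch (bag′ i) (bag′ j)
    touch {i} {j} ne with apart ne
    ... | _ , u , v , u∈ , v∈ , e with which e
    ... | inj₁ e′ = u , v , inc u∈ , inc v∈ , e′
    ... | inj₂ (inj₁ (refl , refl)) = t , v , incQ u∈ t∈ , inc v∈ , E-sym b~t
    ... | inj₂ (inj₂ (refl , refl)) = u , t , inc u∈ , incQ v∈ t∈ , b~t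

  free-present : ∀ {M N} → M.Free M → N ⊆ M → E G a b → M⁺.Free N
  free-present fr N⊆ e m = fr record
    { bag = bag ; bag⊆ = λ i p → N⊆ (bag⊆ i p)
    ; conn = λ i p q → Path-new id (λ x y → edge-path x y e) (conn i p q)
    ; apart = λ ne → let d , u , v , u∈ , v∈ , e′ = apart ne in d , u , v , u∈ , v∈ , back (which e′) }
    where
    open M⁺.Model m
    back : ∀ {u v} → Edge⁺ G a b u v → E G u v
    back (inj₁ e′) = e′
    back (inj₂ (inj₁ (refl , refl))) = e
    back (inj₂ (inj₂ (refl , refl))) = E-sym e

-- Five-choosability of K₅-minor-free graphs

module Rims (G : Graph n) where
  open OnGraph G
  open Minors G

  opaque
    rim : VSet n → VSet n → VSet n
    rim R U = ⟦ (λ v → (v ∈? U) ×-dec any? (λ r → (r ∈? R) ×-dec E? v r)) ⟧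

    rim-in : ∀ {R U v r} → v ∈ U → r ∈ R → E G v r → v ∈ rim R U
    rim-in {R} {U} p q e =
      ⟦⟧-in (λ v → (v ∈? U) ×-dec any? (λ r → (r ∈? R) ×-dec E? v r)) (p , _ , q , e)

    rim-out : ∀ {R U v} → v ∈ rim R U → v ∈ U × ∃ λ r → r ∈ R × E G v r
    rim-out {R} {U} = ⟦⟧-out (λ v → (v ∈? U) ×-dec any? (λ r → (r ∈? R) ×-dec E? v r))

  rim⊆ : ∀ {R U} → rim R U ⊆ U
  rim⊆ p = proj₁ (rim-out p)

  rim-mono : ∀ {R R′ U U′ v} → v ∈ rim R U → R ⊆ R′ → v ∈ U′ → v ∈ rim R′ U′
  rim-mono p s q = let _ , r , r∈ , e = rim-out p in rim-in q (s r∈) e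

  -- R plays the role of the outer face: contracted to a vertex, it sees exactly the rim.
  -- P is the set of precoloured vertices.
  record Hyp (P R U : VSet n) (L : Lists) : Set where
    field
      conn-R   : Conn R
      disj     : ∀ {v} → v ∈ R → v ∉ U
      free     : Free (R ∪ U)
      pre-rim  : P ⊆ rim R U
      pre-size : ∀ {v} → v ∈ P → 1 ≤ size (L v)
      rim-size : ∀ {v} → v ∈ rim R U → v ∉ P → 3 ≤ size (L v)
      in-size  : ∀ {v} → v ∈ U → v ∉ rim R U → 5 ≤ size (L v)

  -- Edges inside `P` are exempt because `Hyp` does not ask the prescribed colours to be different.
  -- A precoloured vertex can therefore be deleted without regard to the other one.
  record Ext (P U : VSet n) (L : Lists) : Set where
    field
      φ      : Fin n → ℕ
      chosen : ∀ {v} → v ∈ U → φ v ∈ᶜ L v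
      proper : ∀ {u v} → u ∈ U → v ∈ U → E G u v → (u ∈ P → v ∈ P → ⊥) → φ u ≢ φ v

  extend : ∀ {P P′ U L L′ v c} (d : Ext P′ (U - v) L′) → P′ ⊆ P → c ∈ᶜ L v →
           (∀ {u k} → u ∈ U - v → k ∈ᶜ L′ u → k ∈ᶜ L u) →
           (∀ {u} → u ∈ U - v → E G v u → (v ∈ P → u ∈ P → ⊥) → Ext.φ d u ≢ c) → Ext P U L
  extend {P} {P′} {U} {L} {L′} {v} {c} d P′⊆ c∈ L′⊆ av = record { φ = f ; chosen = ch ; proper = pr }
    where
    open Ext d
    f : Fin n → ℕ
    f u with u ≟F v
    ... | yes _ = c
    ... | no _ = φ u
    ch : ∀ {u} → u ∈ U → f u ∈ᶜ L u
    ch {u} p with u ≟F v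
    ... | yes refl = c∈
    ... | no ne = L′⊆ (minus-in p ne) (chosen (minus-in p ne))
    pr : ∀ {u w} → u ∈ U → w ∈ U → E G u w → (u ∈ P → w ∈ P → ⊥) → f u ≢ f w
    pr {u} {w} p q e np with u ≟F v | w ≟F v
    ... | yes refl | yes refl = ⊥-elim (E-irrefl e refl)
    ... | yes refl | no ne = λ eq → av (minus-in q ne) e np (esym eq)
    ... | no ne | yes refl = av (minus-in p ne) (E-sym e) (λ x y → np y x)
    ... | no ne | no ne′ = proper (minus-in p ne) (minus-in q ne′) e (λ x y → np (P′⊆ x) (P′⊆ y))

  module Absorb {P R U L} (H : Hyp P R U L) {v} (v∈ : v ∈ rim R U) where
    open Hyp H

    R⁺ = R ∪ ｛ v ｝
    U⁻ = U - v

    conn⁺ : Conn R⁺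
    conn⁺ = let _ , r , r∈ , e = rim-out v∈ in Conn-∪ conn-R Conn-｛｝ r∈ ｛｝-in (E-sym e)

    disj⁺ : ∀ {w} → w ∈ R⁺ → w ∉ U⁻
    disj⁺ p q with ∪-out p
    ... | inj₁ r = disj r (minus⊆ q)
    ... | inj₂ r = proj₂ (minus-out q) (｛｝-out r)

    free⁺ : Free (R⁺ ∪ U⁻)
    free⁺ = Free-mono (λ p → case ∪-out p of λ where
        (inj₁ q) → case ∪-out q of λ where
          (inj₁ r) → ∪-in (inj₁ r)
          (inj₂ r) → ∪-in (inj₂ (｛｝⊆ (rim⊆ v∈) r))
        (inj₂ q) → ∪-in (inj₂ (minus⊆ q))) free

    rim-old : ∀ {u} → u ∈ rim R U → u ≢ v → u ∈ rim R⁺ U⁻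
    rim-old p ne = rim-mono p (∪-in ∘ inj₁) (minus-in (rim⊆ p) ne)

    rim-new : ∀ {u} → u ∈ U → E G v u → u ∈ rim R⁺ U⁻
    rim-new p e = rim-in (minus-in p (E-irrefl (E-sym e))) (∪-in (inj₂ ｛｝-in)) (E-sym e)

    rim⁻ : ∀ {u} → u ∈ rim R⁺ U⁻ → u ∈ U × (u ∈ rim R U ⊎ E G v u)
    rim⁻ {u} p with rim-out p
    ... | q , r , r∈ , e with ∪-out r∈
    ... | inj₁ s = minus⊆ q , inj₁ (rim-in (minus⊆ q) s e)
    ... | inj₂ s = minus⊆ q , inj₂ (E-sym (subst (E G u) (｛｝-out s) e))

    not-rim : ∀ {u} → u ∈ U⁻ → u ∉ rim R⁺ U⁻ → u ∉ rim R U × ¬ E G v u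
    not-rim p q = (λ r → q (rim-old r (proj₂ (minus-out p)))) , λ e → q (rim-new (minus⊆ p) e)

    smaller : ∣ U⁻ ∣ < ∣ U ∣
    smaller = minus-< (rim⊆ v∈)

  -- v keeps the colours S for itself: removing them from its non-rim neighbours, which then
  -- join the rim, v can be coloured last.
  record Good (P R U : VSet n) (L : Lists) (cp : Fin n → ℕ) (v : Fin n) : Set where
    field
      S      : List ℕ
      sub    : ∀ {c} → c ∈ₗ S → c ∈ᶜ L v
      -- A neighbour off the rim has five colours and must keep three when it joins the rim.
      short  : length S ≤ 2
      avoid  : ∀ {u} → u ∈ P → E G v u → cp u ∉ₗ S
      choose : ∀ (f : Fin n → ℕ) → ∃ λ c → c ∈ₗ S × (∀ {u} → u ∈ rim R U → u ∉ P → E G v u → f u ≢ c)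

  remove-good : ∀ {P R U L cp v} (H : Hyp P R U L) (v∈ : v ∈ rim R U) → v ∉ P →
                (∀ {u} → u ∈ P → cp u ∈ᶜ L u) → Good P R U L cp v → let open Absorb H v∈ in
                (∀ L′ → Hyp P R⁺ U⁻ L′ → Ext P U⁻ L′) → Ext P U L
  remove-good {P} {R} {U} {L} {cp} {v} H v∈ v∉ cp∈ gd ih =
    extend d id (sub c∈) (λ _ → L′⊆) av
    where
    open Hyp H
    open Absorb H v∈
    open Good gd
    open ≤-Reasoning
    -- Precoloured vertices are pinned to `cp`: the set `S` is fixed before the recursive call and
    -- avoids exactly these colours.
    L′ : Lists
    L′ u with u ∈? P | u ∈? rim R U | E? v u
    ... | yes _ | _ | _ = singleton (cp u)
    ... | no _ | no _ | yes _ = L u ∖ᶜ S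
    ... | no _ | _ | _ = L u
    L′-pre : ∀ {u} → u ∈ P → L′ u ≡ singleton (cp u)
    L′-pre {u} p with u ∈? P
    ... | yes _ = refl
    ... | no q = ⊥-elim (q p)
    L′-new : ∀ {u} → u ∉ P → u ∉ rim R U → E G v u → L′ u ≡ L u ∖ᶜ S
    L′-new {u} p q e with u ∈? P | u ∈? rim R U | E? v u
    ... | yes p′ | _ | _ = ⊥-elim (p p′)
    ... | no _ | yes q′ | _ = ⊥-elim (q q′)
    ... | no _ | no _ | yes _ = refl
    ... | no _ | no _ | no e′ = ⊥-elim (e′ e)
    L′-rim : ∀ {u} → u ∉ P → u ∈ rim R U → L′ u ≡ L u
    L′-rim {u} p q with u ∈? P | u ∈? rim R U
    ... | yes p′ | _ = ⊥-elim (p p′)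
    ... | no _ | yes q′ = refl
    ... | no _ | no q′ = ⊥-elim (q′ q)
    L′-far : ∀ {u} → u ∉ P → ¬ E G v u → L′ u ≡ L u
    L′-far {u} p e with u ∈? P | u ∈? rim R U | E? v u
    ... | yes p′ | _ | _ = ⊥-elim (p p′)
    ... | no _ | _ | yes e′ = ⊥-elim (e e′)
    ... | no _ | yes _ | no _ = refl
    ... | no _ | no _ | no _ = refl
    L′⊆ : ∀ {u k} → k ∈ᶜ L′ u → k ∈ᶜ L u
    L′⊆ {u} m with u ∈? P | u ∈? rim R U | E? v u
    L′⊆ {u} (here refl) | yes p | _ | _ = cp∈ p
    ... | no _ | no _ | yes _ = proj₁ (∖ᶜ-out {L u} m)
    ... | no _ | no _ | no _ = m
    ... | no _ | yes _ | _ = m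
    H′ : Hyp P R⁺ U⁻ L′
    H′ = record
      { conn-R = conn⁺ ; disj = disj⁺ ; free = free⁺
      ; pre-rim = λ p → rim-old (pre-rim p) (∈-≢ p v∉)
      ; pre-size = λ {u} p → size-≥ (L′-pre p) ≤-refl
      ; rim-size = λ {u} p q → case u ∈? rim R U of λ where
          (yes r) → size-≥ (L′-rim q r) (rim-size r q)
          (no r) → case proj₂ (rim⁻ p) of λ where
            (inj₁ r′) → ⊥-elim (r r′)
            (inj₂ e) → size-≥ (L′-new q r e) (+-cancelʳ-≤ 2 3 _ (begin
              5 ≤⟨ in-size (proj₁ (rim⁻ p)) r ⟩
              size (L u) ≤⟨ ∖ᶜ-size (L u) S ⟩
              size (L u ∖ᶜ S) + length S ≤⟨ +-monoʳ-≤ _ short ⟩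
              size (L u ∖ᶜ S) + 2 ∎))
      ; in-size = λ {u} p q → let r , e = not-rim p q in
          size-≥ (L′-far (r ∘ pre-rim) e) (in-size (minus⊆ p) r) }
    d : Ext P U⁻ L′
    d = ih L′ H′
    open Ext d
    c = proj₁ (choose φ)
    c∈ : c ∈ₗ S
    c∈ = proj₁ (proj₂ (choose φ))
    av : ∀ {u} → u ∈ U⁻ → E G v u → (v ∈ P → u ∈ P → ⊥) → φ u ≢ c
    av {u} p e _ eq with u ∈? P | u ∈? rim R U
    ... | yes q | _ = case subst (φ u ∈ᶜ_) (L′-pre q) (chosen p) of λ where
          (here eq′) → avoid q e (subst (_∈ₗ S) (trans (esym eq) eq′) c∈)
    ... | no q | yes r = proj₂ (proj₂ (choose φ)) r q e eq
    ... | no q | no r = proj₂ (∖ᶜ-out {L u} (subst (φ u ∈ᶜ_) (L′-new q r e) (chosen p)))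
          (subst (_∈ₗ S) (esym eq) c∈)

  -- All neighbours of `v` outside `P` are off the rim and have five colours. Each can give up the
  -- colour of `v` and still has more than the three that the new rim demands.
  remove-pre : ∀ {P P′ R U L v} (H : Hyp P R U L) → (v∈ : v ∈ P) → P′ ⊆ P → v ∉ P′ →
               (∀ {u} → u ∈ P → u ≢ v → u ∈ P′) →
               (∀ {u} → u ∈ rim R U → E G v u → u ∈ P) →
               let open Absorb H (Hyp.pre-rim H v∈) in
               (∀ L′ → Hyp P′ R⁺ U⁻ L′ → Ext P′ U⁻ L′) → Ext P U L
  remove-pre {P} {P′} {R} {U} {L} {v} H v∈ P′⊆ v∉ rest only ih =
    extend d P′⊆ c∈ (λ _ → L′⊆) av
    where
    open Hyp H
    open Absorb H (pre-rim v∈)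
    open ≤-Reasoning
    c = proj₁ (pick (L v) (pre-size v∈))
    c∈ : c ∈ᶜ L v
    c∈ = proj₂ (pick (L v) (pre-size v∈))
    L′ : Lists
    L′ u with u ∈? P | E? v u
    ... | no _ | yes _ = L u ∖ᶜ (c ∷ [])
    ... | _ | _ = L u
    L′-near : ∀ {u} → u ∉ P → E G v u → L′ u ≡ L u ∖ᶜ (c ∷ [])
    L′-near {u} p e with u ∈? P | E? v u
    ... | yes q | _ = ⊥-elim (p q)
    ... | no _ | yes _ = refl
    ... | no _ | no e′ = ⊥-elim (e′ e)
    L′-pre : ∀ {u} → u ∈ P → L′ u ≡ L u
    L′-pre {u} p with u ∈? P | E? v u
    ... | yes q | _ = refl
    ... | no q | _ = ⊥-elim (q p)
    L′-far : ∀ {u} → ¬ E G v u → L′ u ≡ L u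
    L′-far {u} e with u ∈? P | E? v u
    ... | yes q | _ = refl
    ... | no _ | yes e′ = ⊥-elim (e e′)
    ... | no _ | no _ = refl
    L′⊆ : ∀ {u k} → k ∈ᶜ L′ u → k ∈ᶜ L u
    L′⊆ {u} m with u ∈? P | E? v u
    ... | yes _ | _ = m
    ... | no _ | yes _ = proj₁ (∖ᶜ-out {L u} m)
    ... | no _ | no _ = m
    H′ : Hyp P′ R⁺ U⁻ L′
    H′ = record
      { conn-R = conn⁺ ; disj = disj⁺ ; free = free⁺
      ; pre-rim = λ p → rim-old (pre-rim (P′⊆ p)) (∈-≢ p v∉)
      ; pre-size = λ {u} p → size-≥ (L′-pre (P′⊆ p)) (pre-size (P′⊆ p))
      ; rim-size = λ {u} p q →
          let u∉P : u ∉ P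
              u∉P r = q (rest r (proj₂ (minus-out (rim⊆ p)))) in
          case E? v u of λ where
          (no e) → size-≥ (L′-far e) (case proj₂ (rim⁻ p) of λ where
            (inj₁ r) → rim-size r u∉P
            (inj₂ e′) → ⊥-elim (e e′))
          (yes e) → size-≥ (L′-near u∉P e) (+-cancelʳ-≤ 1 3 _ (begin
              4 ≤⟨ n≤1+n 4 ⟩
              5 ≤⟨ in-size (proj₁ (rim⁻ p)) (λ r → u∉P (only r e)) ⟩
              size (L u) ≤⟨ ∖ᶜ-size (L u) (c ∷ []) ⟩
              size (L u ∖ᶜ (c ∷ [])) + 1 ∎))
      ; in-size = λ {u} p q → let r , e = not-rim p q in
          size-≥ (L′-far e) (in-size (minus⊆ p) r) }
    d : Ext P′ U⁻ L′
    d = ih L′ H′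
    open Ext d
    av : ∀ {u} → u ∈ U⁻ → E G v u → (v ∈ P → u ∈ P → ⊥) → φ u ≢ c
    av {u} p e np eq = proj₂ (∖ᶜ-out {L u} (subst (φ u ∈ᶜ_) (L′-near (np v∈) e) (chosen p)))
      (here eq)

-- Splitting along two rim vertices

module Splitting (G : Graph n) where
  open OnGraph G
  open Minors G
  open Rims G

  record Detour (U W : VSet n) (a b : Fin n) : Set where
    field
      Q     : VSet n
      sub   : Q ⊆ U
      off-W : ∀ {v} → v ∈ Q → v ∉ W
      a∉    : a ∉ Q
      b∉    : b ∉ Q
      conn  : Conn Q
      {s t} : Fin n
      s∈    : s ∈ Q
      a~s   : E G a s
      t∈    : t ∈ Q
      b~t   : E G b t

  -- `W` is the side without precoloured vertices. The vertex `z` makes the other side smaller than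
  -- `U`, and `k` does the same for `W` together with `a` and `b`, so both sides are open to
  -- induction.
  record Separation (P R U : VSet n) : Set where
    field
      {a b}  : Fin n
      W      : VSet n
      a≢b    : a ≢ b
      a-rim  : a ∈ rim R U
      b-rim  : b ∈ rim R U
      W⊆     : W ⊆ U
      a∉     : a ∉ W
      b∉     : b ∉ W
      off-P  : ∀ {v} → v ∈ P → v ∉ W
      closed : ∀ {u w} → u ∈ W → w ∈ U → E G u w → w ∈ W ⊎ (w ≡ a ⊎ w ≡ b)
      {z}    : Fin n
      z∈     : z ∈ W
      {k}    : Fin n
      k∈     : k ∈ U
      k∉     : k ∉ W
      k≢a    : k ≢ a
      k≢b    : k ≢ b
      link   : E G a b ⊎ Detour U W a b

  -- Colour the side of P first; a and b are then precoloured on the other side, where the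
  -- edge ab is available since a and b are linked through the first side.
  separate : ∀ {P R U L} → Hyp P R U L → Separation P R U →
             (∀ U′ → Hyp P R U′ L → ∣ U′ ∣ < ∣ U ∣ → Ext P U′ L) →
             (∀ G′ a b U′ L′ → E G′ a b → Rims.Hyp G′ (pair a b) R U′ L′ → ∣ U′ ∣ < ∣ U ∣ →
                Rims.Ext G′ (pair a b) U′ L′) →
             Ext P U L
  separate {P} {R} {U} {L} H sep ih ih⁺ = record { φ = f ; chosen = ch ; proper = pr }
    where
    open Hyp H
    open Separation sep
    U₁ = U ∖ W
    U₂ = W ∪ pair a b
    H₁ : Hyp P R U₁ L
    H₁ = record
      { conn-R = conn-R ; disj = λ p q → disj p (∖⊆ q)
      ; free = Free-mono (λ p → case ∪-out p of λ where
            (inj₁ q) → ∪-in (inj₁ q)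
            (inj₂ q) → ∪-in (inj₂ (∖⊆ q))) free
      ; pre-rim = λ p → rim-mono (pre-rim p) id (∖-in (rim⊆ (pre-rim p)) (off-P p))
      ; pre-size = pre-size
      ; rim-size = λ p → rim-size (rim-mono p id (∖⊆ (rim⊆ p)))
      ; in-size = λ p q → in-size (∖⊆ p) (λ r → q (rim-mono r id p)) }
    d₁ : Ext P U₁ L
    d₁ = ih U₁ H₁ (∖-< (W⊆ z∈) z∈)
    module D₁ = Ext d₁
    -- The second side needs adjacent precoloured vertices. This is the one place where the graph
    -- changes, and the reason why the induction ranges over all graphs on the vertex set.
    open AddEdge G a b a≢b
    module R⁺ = Rims G⁺
    L₂ : Lists
    L₂ u with u ∈? pair a b
    ... | yes _ = singleton (D₁.φ u)
    ... | no _ = L u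
    L₂-pair : ∀ {u} → u ∈ pair a b → L₂ u ≡ singleton (D₁.φ u)
    L₂-pair {u} p with u ∈? pair a b
    ... | yes _ = refl
    ... | no q = ⊥-elim (q p)
    L₂-off : ∀ {u} → u ∉ pair a b → L₂ u ≡ L u
    L₂-off {u} p with u ∈? pair a b
    ... | yes q = ⊥-elim (p q)
    ... | no _ = refl
    pair⊆ : ∀ {u} → u ∈ pair a b → u ∈ rim R U
    pair⊆ p with pair-out p
    ... | inj₁ refl = a-rim
    ... | inj₂ refl = b-rim
    pair∉ : ∀ {u} → u ∈ pair a b → u ∉ W
    pair∉ p with pair-out p
    ... | inj₁ refl = a∉
    ... | inj₂ refl = b∉
    U₂⊆ : U₂ ⊆ U
    U₂⊆ p with ∪-out p
    ... | inj₁ q = W⊆ q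
    ... | inj₂ q = rim⊆ (pair⊆ q)
    M⊆ : R ∪ U₂ ⊆ R ∪ U
    M⊆ p with ∪-out p
    ... | inj₁ q = ∪-in (inj₁ q)
    ... | inj₂ q = ∪-in (inj₂ (U₂⊆ q))
    free₂ : Minors.Free G⁺ (R ∪ U₂)
    free₂ with link
    ... | inj₁ e = free-present free M⊆ e
    ... | inj₂ δ = free-detour free M⊆ (∪-in ∘ inj₂ ∘ sub)
          (λ q p → case ∪-out p of λ where
            (inj₁ r) → disj r (sub q)
            (inj₂ r) → case ∪-out r of λ where
              (inj₁ w) → off-W q w
              (inj₂ w) → case pair-out w of λ where
                (inj₁ refl) → Detour.a∉ δ q
                (inj₂ refl) → Detour.b∉ δ q)
          conn s∈ a~s t∈ b~t
          where open Detour δ hiding (a∉; b∉)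
    rim⁺ : ∀ {v} → v ∈ R⁺.rim R U₂ → v ∈ rim R U
    rim⁺ p with R⁺.rim-out p
    ... | q , r , r∈ , e with which e
    ... | inj₁ e′ = rim-in (U₂⊆ q) r∈ e′
    ... | inj₂ (inj₁ (_ , refl)) = ⊥-elim (disj r∈ (rim⊆ b-rim))
    ... | inj₂ (inj₂ (_ , refl)) = ⊥-elim (disj r∈ (rim⊆ a-rim))
    ⁺rim : ∀ {v} → v ∈ rim R U → v ∈ U₂ → v ∈ R⁺.rim R U₂
    ⁺rim p q with rim-out p
    ... | _ , r , r∈ , e = R⁺.rim-in q r∈ (old e)
    H₂ : R⁺.Hyp (pair a b) R U₂ L₂
    H₂ = record
      { conn-R = λ p q → Path-old (conn-R p q)
      ; disj = λ p q → disj p (U₂⊆ q)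
      ; free = free₂
      ; pre-rim = λ p → ⁺rim (pair⊆ p) (∪-in (inj₂ p))
      ; pre-size = λ p → size-≥ (L₂-pair p) ≤-refl
      ; rim-size = λ p q → size-≥ (L₂-off q)
          (rim-size (rim⁺ p) (λ r → case ∪-out (R⁺.rim⊆ p) of λ where
            (inj₁ w) → off-P r w
            (inj₂ w) → q w))
      ; in-size = λ p q → subst (λ l → 5 ≤ size l)
          (esym (L₂-off (λ r → q (⁺rim (pair⊆ r) p)))) (in-size (U₂⊆ p) (λ r → q (⁺rim r p))) }
    d₂ : R⁺.Ext (pair a b) U₂ L₂
    d₂ = ih⁺ G⁺ a b U₂ L₂ new H₂ (∣∣-< U₂⊆ k∈ λ p → case ∪-out p of λ where
      (inj₁ q) → k∉ q
      (inj₂ q) → case pair-out q of λ where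
        (inj₁ e) → k≢a e
        (inj₂ e) → k≢b e)
    module D₂ = R⁺.Ext d₂
    f : Fin n → ℕ
    f u with u ∈? W
    ... | yes _ = D₂.φ u
    ... | no _ = D₁.φ u
    ch : ∀ {u} → u ∈ U → f u ∈ᶜ L u
    ch {u} p with u ∈? W
    ... | yes q = subst (D₂.φ u ∈ᶜ_) (L₂-off (λ r → pair∉ r q)) (D₂.chosen (∪-in (inj₁ q)))
    ... | no q = D₁.chosen (∖-in p q)
    agree : ∀ {u} → u ∈ pair a b → D₂.φ u ≡ D₁.φ u
    agree {u} p with subst (D₂.φ u ∈ᶜ_) (L₂-pair p) (D₂.chosen (∪-in (inj₂ p)))
    ... | here e = e
    cross : ∀ {u v} → u ∈ W → v ∈ U → v ∉ W → E G u v → D₂.φ u ≢ D₁.φ v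
    cross {u} {v} p q r e eq with closed p q e
    ... | inj₁ w = r w
    ... | inj₂ w = D₂.proper (∪-in (inj₁ p)) (∪-in (inj₂ v∈)) (old e) (λ x _ → pair∉ x p)
            (trans eq (esym (agree v∈)))
      where
      v∈ : v ∈ pair a b
      v∈ = ∪-in (case w of λ where
        (inj₁ refl) → inj₁ ｛｝-in
        (inj₂ refl) → inj₂ ｛｝-in)
    pr : ∀ {u v} → u ∈ U → v ∈ U → E G u v → (u ∈ P → v ∈ P → ⊥) → f u ≢ f v
    pr {u} {v} p q e np with u ∈? W | v ∈? W
    ... | yes a | yes b = D₂.proper (∪-in (inj₁ a)) (∪-in (inj₁ b)) (old e) (λ x _ → pair∉ x a)
    ... | yes a | no b = cross a q b e
    ... | no a | yes b = λ eq → cross b p a (E-sym e) (esym eq)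
    ... | no a | no b = D₁.proper (∖-in p a) (∖-in q b) e np

-- Two adjacent precoloured vertices

module TwoPrecoloured (G : Graph n) (R U : VSet n) (L : Fin n → Colours) (x y : Fin n) (x~y : E G x y)
  (H : Rims.Hyp G (pair x y) R U L)
  (ih₁ : ∀ (R′ U′ : VSet n) (L′ : Fin n → Colours) (y′ : Fin n) → Rims.Hyp G ｛ y′ ｝ R′ U′ L′ → ∣ U′ ∣ < ∣ U ∣ → Rims.Ext G ｛ y′ ｝ U′ L′)
  (ih₂ : ∀ (G′ : Graph n) (R′ U′ : VSet n) (L′ : Fin n → Colours) (x′ y′ : Fin n) → E G′ x′ y′ →
         Rims.Hyp G′ (pair x′ y′) R′ U′ L′ → ∣ U′ ∣ < ∣ U ∣ →
         Rims.Ext G′ (pair x′ y′) U′ L′)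
  where
  open OnGraph G
  open Minors G
  open Rims G
  open Splitting G
  open Hyp H

  private
    P X F : VSet n
    P = pair x y
    X = rim R U
    F = X ∖ P

    Goal : Set
    Goal = Ext P U L

  x≢y : x ≢ y
  x≢y = E-irrefl x~y

  ∉P : ∀ {v} → v ∉ P → v ≢ x × v ≢ y
  ∉P p = (λ { refl → p pairˡ }) , (λ { refl → p pairʳ })

  cp : Fin n → ℕ
  cp v with v ∈? P
  ... | yes p = proj₁ (pick (L v) (pre-size p))
  ... | no _ = 0

  cp∈ : ∀ {v} → v ∈ P → cp v ∈ᶜ L v
  cp∈ {v} p with v ∈? P
  ... | yes q = proj₂ (pick (L v) (pre-size q))
  ... | no q = ⊥-elim (q p)

  data Bad (v : Fin n) : Set where
    triangle : ∀ {z} → E G v x → E G v y → z ∈ F → E G v z → Bad v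
    two      : ∀ {w₁ w₂} → w₁ ≢ w₂ → w₁ ∈ F → E G v w₁ → w₂ ∈ F → E G v w₂ → Bad v

  -- A rim vertex outside `P` has three colours. Without rim neighbours outside `P` it can keep one
  -- colour different from `cp x` and `cp y`. With one such neighbour and at most one neighbour in
  -- `P` it can keep two, of which the rim neighbour takes at most one. `Bad` is what remains.
  classify : ∀ {v} → v ∈ F → Good P R U L cp v ⊎ Bad v
  classify {v} v∈ with nb F v in eq | ∖-out v∈
  ... | [] | v∈X , v∉P = inj₁ record
    { S = c ∷ []
    ; sub = λ { (here refl) → proj₁ (proj₂ ch) }
    ; short = s≤s z≤n
    ; avoid = λ p e → λ where
        (here e′) → proj₂ (proj₂ ch) (case pair-out p of λ where
          (inj₁ refl) → here (esym e′)
          (inj₂ refl) → there (here (esym e′)))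
    ; choose = λ f → c , here refl , λ {u} p q e → case subst (_ ∈ₗ_) eq (nb-in (∖-in p q) e) of λ () }
    where
    ch = pick-avoiding (L v) (cp x ∷ cp y ∷ []) (rim-size v∈X v∉P)
    c = proj₁ ch
  ... | w₁ ∷ w₂ ∷ r | _ = inj₂ (two w₁≢w₂ (proj₁ m₁) (proj₂ m₁) (proj₁ m₂) (proj₂ m₂))
    where
    m₁ = nb-out (subst (w₁ ∈ₗ_) (esym eq) (here refl))
    m₂ = nb-out (subst (w₂ ∈ₗ_) (esym eq) (there (here refl)))
    w₁≢w₂ : w₁ ≢ w₂
    w₁≢w₂ e with subst Unique eq (nb-unique F v)
    ... | (ne ∷ _) ∷ _ = ne e
  ... | w ∷ [] | v∈X , v∉P = go (E? v x) (E? v y)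
    where
    build : ∀ k → (∀ {u} → u ∈ P → E G v u → cp u ≡ k) → Good P R U L cp v
    build k pre = record
      { S = c₁ ∷ c₂ ∷ []
      ; sub = λ where
          (here refl) → proj₁ (proj₂ ch₁)
          (there (here refl)) → proj₁ (proj₂ ch₂)
      ; short = s≤s (s≤s z≤n)
      ; avoid = λ p e → λ where
          (here e′) → proj₂ (proj₂ ch₁) (here (trans (esym e′) (pre p e)))
          (there (here e′)) → proj₂ (proj₂ ch₂) (here (trans (esym e′) (pre p e)))
      ; choose = λ f → case f w ≟ c₁ of λ where
          (yes e) → c₂ , there (here refl) , λ {u} p q a e′ →
            proj₂ (proj₂ ch₂) (there (here (trans (esym e′) (trans (cong f (only p q a)) e))))
          (no e) → c₁ , here refl , λ {u} p q a e′ → e (trans (esym (cong f (only p q a))) e′) }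
      where
      ch₁ = pick-avoiding (L v) (k ∷ []) (≤-trans (s≤s (s≤s z≤n)) (rim-size v∈X v∉P))
      c₁ = proj₁ ch₁
      ch₂ = pick-avoiding (L v) (k ∷ c₁ ∷ []) (rim-size v∈X v∉P)
      c₂ = proj₁ ch₂
      only : ∀ {u} → u ∈ X → u ∉ P → E G v u → u ≡ w
      only p q a with subst (_ ∈ₗ_) eq (nb-in (∖-in p q) a)
      ... | here e = e
    go : Dec (E G v x) → Dec (E G v y) → Good P R U L cp v ⊎ Bad v
    go (yes p) (yes q) = let w∈ , e = nb-out (subst (w ∈ₗ_) (esym eq) (here refl)) in
      inj₂ (triangle p q w∈ e)
    go (no p) _ = inj₁ (build (cp y) λ a b → case pair-out a of λ where
      (inj₁ refl) → ⊥-elim (p b)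
      (inj₂ refl) → refl)
    go (yes _) (no q) = inj₁ (build (cp x) λ a b → case pair-out a of λ where
      (inj₁ refl) → refl
      (inj₂ refl) → ⊥-elim (q b))

  unless-good : ∀ {v} → v ∈ F → (Bad v → Goal) → Goal
  unless-good v∈ k with classify v∈ | ∖-out v∈
  ... | inj₂ bad | _ = k bad
  ... | inj₁ good | v∈X , v∉P = remove-good H v∈X v∉P cp∈ good
    λ L′ H′ → ih₂ G _ _ L′ x y x~y H′ (Absorb.smaller H v∈X)

  cut : Separation P R U → Goal
  cut sep = separate H sep (λ U′ → ih₂ G R U′ L x y x~y) (λ G′ a b U′ L′ → ih₂ G′ R U′ L′ a b)

  Touches : VSet n → Fin n → Set
  Touches Z c = ∃ λ z → z ∈ Z × E G c z

  touches? : ∀ Z → Decidable (Touches Z)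
  touches? Z c = any? λ z → (z ∈? Z) ×-dec E? c z

  module _ {h : Fin n} {t : List (Fin n)} (cyc : Cycle h t) (on-rim : ∀ {v} → v ∈ₗ h ∷ t → v ∈ X) where

    private
      l = h ∷ t
      O : VSet n
      O = setOf l

    no-three : ∀ {Z z} → Z ⊆ U ∖ O → Conn Z → z ∈ Z → z ∈ X → ¬ Three l (Touches Z)
    no-three {Z} Z⊆ cZ z∈ zX th = free (K₅-cycle cyc th
      (λ m → ∪-in (inj₂ (rim⊆ (on-rim m)))
           , (λ q → proj₂ (∖-out (Z⊆ q)) (setOf-in m))
           , (λ q → disj q (rim⊆ (on-rim m)))
           , proj₂ (rim-out (on-rim m)))
      (λ q → ∪-in (inj₂ (∖⊆ (Z⊆ q)))) (∪-in ∘ inj₁) cZ conn-R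
      ((λ q r → disj r (∖⊆ (Z⊆ q))) , let _ , r , r∈ , e = rim-out zX in _ , r , z∈ , r∈ , e))

    -- Both precoloured vertices lie on the cycle, so the component of `z` off the cycle contains
    -- neither of them and can be split off. The cycle has a third vertex besides the separating
    -- pair, and its arc supplies the detour.
    detach : x ∈ₗ l → y ∈ₗ l → ∀ {z} → z ∈ X → z ∉ₗ l → Goal
    detach x∈ y∈ {z} zX z∉ with component {U ∖ O} {z} (∖-in (rim⊆ zX) (z∉ ∘ setOf-out))
    ... | Z with analyse cyc (touches? (Component.set Z))
    ... | inj₂ th = ⊥-elim (no-three (Component.sub Z) (Component.conn Z) (Component.root Z) zX th)
    ... | inj₁ A with third _≟F_ (Cycle.distinct cyc) (Cycle.long cyc) (Attach.a A) (Attach.b A)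
    ... | k , k∈l , k≢a , k≢b = cut record
      { W = set ; a≢b = a≢b ; a-rim = on-rim a∈ ; b-rim = on-rim b∈
      ; W⊆ = ∖⊆ ∘ sub ; a∉ = off a∈ ; b∉ = off b∈
      ; off-P = λ p → case pair-out p of λ where
          (inj₁ refl) → off x∈
          (inj₂ refl) → off y∈
      ; closed = λ {u} {w} u∈ w∈ e → case w ∈? O of λ where
          (yes m) → inj₂ (only (setOf-out m) (u , u∈ , E-sym e))
          (no m) → inj₁ (closed u∈ (∖-in w∈ m) e)
      ; z∈ = root ; k∈ = rim⊆ (on-rim k∈l) ; k∉ = off k∈l ; k≢a = k≢a ; k≢b = k≢b
      ; link = case link of λ where
          (inj₁ e) → inj₁ e
          (inj₂ (_ , _ , arc)) → let module C = Arc arc in inj₂ record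
            { Q = C.set ; sub = rim⊆ ∘ on-rim ∘ setOf-out ∘ C.sub
            ; off-W = λ q → off (setOf-out (C.sub q))
            ; a∉ = C.a∉ ; b∉ = C.b∉ ; conn = C.conn
            ; s∈ = C.s∈ ; a~s = C.a~s ; t∈ = C.t∈ ; b~t = C.b~t } }
      where
      open Component Z
      open Attach A
      off : ∀ {v} → v ∈ₗ l → v ∉ set
      off m q = proj₂ (∖-out (sub q)) (setOf-in m)

    -- Here `y` is off the cycle, so its component stays and everything else is split off. The
    -- vertex `x`, being a neighbour of `y`, is in that component or is one of the two attachments.
    -- The detour runs through the component of `y`.
    around : y ∉ₗ l → Goal
    around y∉ with component {U ∖ O} {y} (∖-in (rim⊆ (pre-rim pairʳ)) (y∉ ∘ setOf-out))
    ... | Z with analyse cyc (touches? (Component.set Z))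
    ... | inj₂ th =
      ⊥-elim (no-three (Component.sub Z) (Component.conn Z) (Component.root Z) (pre-rim pairʳ) th)
    ... | inj₁ A with third _≟F_ (Cycle.distinct cyc) (Cycle.long cyc) (Attach.a A) (Attach.b A)
    ... | k , k∈l , k≢a , k≢b = cut record
      { W = W ; a≢b = a≢b ; a-rim = on-rim a∈ ; b-rim = on-rim b∈
      ; W⊆ = ∖⊆ ∘ ∖⊆ ; a∉ = λ q → proj₂ (∖-out q) pairˡ ; b∉ = λ q → proj₂ (∖-out q) pairʳ
      ; off-P = λ p → case pair-out p of λ where
          (inj₁ refl) → x∉W
          (inj₂ refl) → y∉W
      ; closed = λ {u} {w} u∈ w∈ e → case w ∈? pair a b of λ where
          (yes m) → inj₂ (pair-out m)
          (no m) → inj₁ (∖-in (∖-in w∈ (λ q → outside-Z u∈ q e)) m)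
      ; z∈ = ∖-in (∖-in (rim⊆ (on-rim k∈l)) (off k∈l)) (λ p → case pair-out p of λ where
          (inj₁ e) → k≢a e
          (inj₂ e) → k≢b e)
      ; k∈ = rim⊆ (pre-rim pairʳ) ; k∉ = y∉W
      ; k≢a = λ { refl → y∉ a∈ } ; k≢b = λ { refl → y∉ b∈ }
      ; link = case link of λ where
          (inj₁ e) → inj₁ e
          (inj₂ ((s , s∈ , a~s) , (t , t∈ , b~t) , _)) → inj₂ record
            { Q = set ; sub = ∖⊆ ∘ sub ; off-W = λ q w → proj₂ (∖-out (∖⊆ w)) q
            ; a∉ = off a∈ ; b∉ = off b∈ ; conn = conn
            ; s∈ = s∈ ; a~s = a~s ; t∈ = t∈ ; b~t = b~t } }
      where
      open Component Z
      open Attach A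
      W : VSet n
      W = U ∖ set ∖ pair a b
      off : ∀ {v} → v ∈ₗ l → v ∉ set
      off m q = proj₂ (∖-out (sub q)) (setOf-in m)
      outside-Z : ∀ {u w} → u ∈ W → w ∈ set → ¬ E G u w
      outside-Z {u} {w} u∈ w∈ e with u ∈? O
      ... | no m = proj₂ (∖-out (∖⊆ u∈)) (closed w∈ (∖-in (∖⊆ (∖⊆ u∈)) m) (E-sym e))
      ... | yes m = proj₂ (∖-out u∈) (case only (setOf-out m) (w , w∈ , e) of λ where
            (inj₁ refl) → pairˡ
            (inj₂ refl) → pairʳ)
      y∉W : y ∉ W
      y∉W p = proj₂ (∖-out (∖⊆ p)) root
      x∉W : x ∉ W
      x∉W p = outside-Z p root x~y

  avoiding : ∀ {v w₁ w₂} g → w₁ ≢ w₂ → w₁ ∈ F → E G v w₁ → w₂ ∈ F → E G v w₂ →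
             ∃ λ z → z ≢ g × z ∈ F × E G v z
  avoiding {w₁ = w₁} g ne m₁ e₁ m₂ e₂ with w₁ ≟F g
  ... | no p = _ , p , m₁ , e₁
  ... | yes refl = _ , ≢-sym ne , m₂ , e₂

  -- The cycle is the path y v g … x closed by the edge xy; a chord at v shortens it.
  along-edge : ∀ m v g t → length t < m → Linked (E G) (y ∷ v ∷ g ∷ t) → lastOf g t ≡ x →
               Unique (y ∷ v ∷ g ∷ t) → (∀ {u} → u ∈ₗ y ∷ v ∷ g ∷ t → u ∈ X) → v ∉ P → Goal
  along-edge (suc m) v g t lt (y~v ∷ v~g ∷ lk) last un on v∉ = unless-good (∖-in (on (there (here refl))) v∉) λ where
      (triangle v~x v~y z∈ v~z) → detach {h = y} {t = v ∷ x ∷ []}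
        (record { linked = y~v ∷ v~x ∷ [-] ; close = x~y
                ; distinct = ((≢-sym (proj₂ (∉P v∉)) ∷ ≢-sym x≢y ∷ []) ∷ (proj₁ (∉P v∉) ∷ []) ∷ [] ∷ [])
                ; long = s≤s (s≤s z≤n) })
        (λ where
          (here refl) → pre-rim pairʳ
          (there (here refl)) → on (there (here refl))
          (there (there (here refl))) → pre-rim pairˡ)
        (there (there (here refl))) (here refl) (proj₁ (∖-out z∈))
        (λ where
          (here refl) → proj₂ (∖-out z∈) pairʳ
          (there (here refl)) → E-irrefl v~z refl
          (there (there (here refl))) → proj₂ (∖-out z∈) pairˡ)
      (two ne m₁ e₁ m₂ e₂) → case avoiding g ne m₁ e₁ m₂ e₂ of λ where
        (z , z≢g , z∈ , v~z) → case z ∈ₗF? t of λ where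
          (no z∉) → detach {h = y} {t = v ∷ g ∷ t}
            (record { linked = y~v ∷ v~g ∷ lk ; close = subst (λ u → E G u y) (esym last) x~y
                    ; distinct = un ; long = s≤s (s≤s z≤n) })
            on (there (there (subst (_∈ₗ g ∷ t) last (lastOf-∈ g t)))) (here refl)
            (proj₁ (∖-out z∈))
            (λ where
              (here refl) → proj₂ (∖-out z∈) pairʳ
              (there (here refl)) → E-irrefl v~z refl
              (there (there (here refl))) → z≢g refl
              (there (there (there p))) → z∉ p)
          (yes p) → shorten z v~z (∈-∃++ p) un
    where
    shorten : ∀ z → E G v z → (∃ λ t₁ → ∃ λ t₂ → t ≡ t₁ ++ z ∷ t₂) → Unique (y ∷ v ∷ g ∷ t) → Goal
    shorten z v~z (t₁ , t₂ , refl) ((y≢v ∷ y∉) ∷ v∉′ ∷ un′) = along-edge m v z t₂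
      (<-≤-trans (begin-strict
        length t₂ <⟨ m≤n+m _ (length t₁) ⟩
        length t₁ + suc (length t₂) ≡⟨ esym (length-++ t₁) ⟩
        length (t₁ ++ z ∷ t₂) ∎) (s≤s⁻¹ lt))
      (y~v ∷ v~z ∷ linked-suffix (g ∷ t₁) lk) (trans (esym (lastOf-++ g t₁ z t₂)) last)
      ((y≢v ∷ AllP.++⁻ʳ (g ∷ t₁) y∉) ∷ AllP.++⁻ʳ (g ∷ t₁) v∉′ ∷ unique-++ʳ (g ∷ t₁) un′)
      (λ where
        (here refl) → on (here refl)
        (there (here refl)) → on (there (here refl))
        (there (there q)) → on (there (there (there (∈-++⁺ʳ t₁ q)))))
      v∉
      where open ≤-Reasoning

  -- A path in the rim from x that avoids y is extended until it closes a cycle.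
  search : ∀ m h g t → ∣ U ∖ setOf (h ∷ g ∷ t) ∣ < m → Linked (E G) (h ∷ g ∷ t) → lastOf g t ≡ x →
           Unique (h ∷ g ∷ t) → (∀ {u} → u ∈ₗ h ∷ g ∷ t → u ∈ X × u ≢ y) → h ∉ P → Goal
  search (suc m) h g t lt (h~g ∷ lk) last un on h∉ =
    unless-good (∖-in (proj₁ (on (here refl))) h∉) λ bad → case E? h y of λ where
      (yes h~y) → along-edge (suc (length t)) h g t ≤-refl (E-sym h~y ∷ h~g ∷ lk) last
        (All.tabulate (λ q e → proj₂ (on q) (esym e)) ∷ un)
        (λ where
          (here refl) → pre-rim pairʳ
          (there q) → proj₁ (on q))
        h∉
      -- Only `two` is possible now, and one of the two rim neighbours differs from the predecessor
      -- `g`: it lies further back on the path and closes a cycle missing `y`, or it prolongs the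
      -- path.
      (no h≁y) → case bad of λ where
        (triangle _ h~y _ _) → ⊥-elim (h≁y h~y)
        (two ne m₁ e₁ m₂ e₂) → case avoiding g ne m₁ e₁ m₂ e₂ of λ where
          (z , z≢g , z∈ , h~z) → case z ∈ₗF? t of λ where
            (yes p) → close-up z h~z (∈-∃++ p)
            (no z∉) → longer z z≢g z∈ h~z z∉
    where
    close-up : ∀ z → E G h z → (∃ λ t₁ → ∃ λ t₂ → t ≡ t₁ ++ z ∷ t₂) → Goal
    close-up z h~z (t₁ , t₂ , refl) = around {h = h} {t = g ∷ t₁ ++ z ∷ []}
      (record
        { linked = linked-prefix (h ∷ g ∷ t₁) (h~g ∷ lk)
        ; close = subst (λ u → E G u h) (esym (lastOf-++ g t₁ z [])) (E-sym h~z)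
        ; distinct = unique-++ˡ (h ∷ g ∷ t₁ ++ z ∷ [])
            (subst Unique (cong (λ r → h ∷ g ∷ r) (esym (++-assoc t₁ (z ∷ []) t₂))) un)
        ; long = s≤s (subst (1 ≤_) (esym (length-++ t₁)) (m≤n+m 1 (length t₁))) })
      (proj₁ ∘ on′) (λ q → proj₂ (on′ q) refl)
      where
      on′ : ∀ {u} → u ∈ₗ h ∷ g ∷ t₁ ++ z ∷ [] → u ∈ X × u ≢ y
      on′ {u} q = on (subst (u ∈ₗ_) (cong (λ r → h ∷ g ∷ r) (++-assoc t₁ (z ∷ []) t₂)) (∈-++⁺ˡ {xs = h ∷ g ∷ t₁ ++ z ∷ []} q))
    longer : ∀ z → z ≢ g → z ∈ F → E G h z → z ∉ₗ t → Goal
    longer z z≢g z∈ h~z z∉ = search m z h (g ∷ t)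
      (<-≤-trans (∣∣-< (λ q → let a , b = ∖-out q in ∖-in a (b ∘ setOf-in ∘ there ∘ setOf-out))
          (∖-in (rim⊆ (proj₁ (∖-out z∈))) (z∉′ ∘ setOf-out))
          (λ q → proj₂ (∖-out q) (setOf-in (here refl)))) (s≤s⁻¹ lt))
      (E-sym h~z ∷ h~g ∷ lk) last
      (All.tabulate (λ q e → z∉′ (subst (_∈ₗ h ∷ g ∷ t) (esym e) q)) ∷ un)
      (λ where
        (here refl) → proj₁ (∖-out z∈) , proj₂ (∉P (proj₂ (∖-out z∈)))
        (there q) → on q)
      (proj₂ (∖-out z∈))
      where
      z∉′ : z ∉ₗ h ∷ g ∷ t
      z∉′ (here refl) = E-irrefl h~z refl
      z∉′ (there (here e)) = z≢g e
      z∉′ (there (there q)) = z∉ q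

  colour : Goal
  colour with find (λ v → (v ∈? F) ×-dec E? x v)
  ... | inj₁ (v , v∈ , e) = search (suc ∣ U ∖ setOf (v ∷ x ∷ []) ∣) v x [] ≤-refl (E-sym e ∷ [-]) refl
        ((proj₁ (∉P (proj₂ (∖-out v∈))) ∷ []) ∷ [] ∷ [])
        (λ where
          (here refl) → proj₁ (∖-out v∈) , proj₂ (∉P (proj₂ (∖-out v∈)))
          (there (here refl)) → pre-rim pairˡ , x≢y)
        (proj₂ (∖-out v∈))
  ... | inj₂ absent = remove-pre {P′ = ｛ y ｝} H pairˡ (｛｝⊆ pairʳ)
        (λ p → x≢y (｛｝-out p))
        (λ p ne → case pair-out p of λ where
          (inj₁ e) → ⊥-elim (ne e)
          (inj₂ refl) → ｛｝-in)
        (λ {u} p e → case u ∈? P of λ where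
          (yes q) → q
          (no q) → ⊥-elim (absent u (∖-in p q , e)))
        (λ L′ H′ → ih₁ _ _ L′ y H′ (Absorb.smaller H (pre-rim pairˡ)))

-- Simultaneous induction for none, one or two precoloured vertices

∅ : VSet n
∅ = ⟦ never ⟧
  where
  never : Decidable {A = Fin n} (λ _ → ⊥)
  never _ = no λ ()

∉∅ : {v : Fin n} → v ∉ ∅
∉∅ = ⟦⟧-out _

Solve₀ Solve₁ Solve₂ : ℕ → ℕ → Set
Solve₀ n m = ∀ (G : Graph n) R U L → Rims.Hyp G ∅ R U L → ∣ U ∣ < m → Rims.Ext G ∅ U L
Solve₁ n m = ∀ (G : Graph n) R U L y → Rims.Hyp G ｛ y ｝ R U L → ∣ U ∣ < m → Rims.Ext G ｛ y ｝ U L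
Solve₂ n m = ∀ (G : Graph n) R U L x y → E G x y → Rims.Hyp G (pair x y) R U L → ∣ U ∣ < m →
             Rims.Ext G (pair x y) U L

-- A rim neighbour of `y` is precoloured as well, with a colour other than that of `y`, so that the
-- edge exempted by `Ext` is proper all the same. If there is no such neighbour, `y` itself can be
-- removed.
solve₁ : ∀ {m} → Solve₂ n m → (∀ (G : Graph n) R U L R′ U′ L′ → Rims.Hyp G ∅ R′ U′ L′ → ∣ U′ ∣ < ∣ U ∣ →
         ∣ U ∣ < m → Rims.Ext G ∅ U′ L′) → Solve₁ n m
solve₁ {n} s₂ s₀ G R U L y H lt with find (λ v → (v ∈? Rims.rim G R U) ×-dec OnGraph.E? G y v)
... | inj₂ absent = remove-pre {P′ = ∅} H ｛｝-in (λ p → ⊥-elim (∉∅ p)) ∉∅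
      (λ p ne → ⊥-elim (ne (｛｝-out p))) (λ p e → ⊥-elim (absent _ (p , e)))
      (λ L′ H′ → s₀ G R U L _ _ L′ H′ (Absorb.smaller H (Hyp.pre-rim H ｛｝-in)) lt)
  where
  open OnGraph G
  open Rims G
... | inj₁ (y′ , y′∈ , y~y′) = record
      { φ = φ ; chosen = λ {u} p → L′⊆ (chosen p)
      ; proper = λ {u} {v} p q e np eq → case (u ∈? pair y′ y) ×-dec (v ∈? pair y′ y) of λ where
          (no ¬b) → proper p q e (λ a b → ¬b (a , b)) eq
          (yes (a , b)) → case pair-out a of λ where
            (inj₁ refl) → case pair-out b of λ where
              (inj₁ refl) → E-irrefl e refl
              (inj₂ refl) → c≢c′ (trans (esym (at-y q)) (trans (esym eq) (at-y′ p)))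
            (inj₂ refl) → case pair-out b of λ where
              (inj₁ refl) → c≢c′ (trans (esym (at-y p)) (trans eq (at-y′ q)))
              (inj₂ refl) → E-irrefl e refl }
  where
  open OnGraph G
  open Rims G
  open Hyp H
  y∈ : y ∈ rim R U
  y∈ = pre-rim ｛｝-in
  c = proj₁ (pick (L y) (pre-size ｛｝-in))
  c∈ : c ∈ᶜ L y
  c∈ = proj₂ (pick (L y) (pre-size ｛｝-in))
  y′≢y : y′ ≢ y
  y′≢y = E-irrefl (E-sym y~y′)
  ch′ = pick-avoiding (L y′) (c ∷ []) (≤-trans (s≤s (s≤s z≤n)) (rim-size y′∈ (y′≢y ∘ ｛｝-out)))
  c′ = proj₁ ch′
  c≢c′ : c ≢ c′
  c≢c′ e = proj₂ (proj₂ ch′) (here (esym e))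
  L′ : Lists
  L′ u with u ≟F y | u ≟F y′
  ... | yes _ | _ = singleton c
  ... | no _ | yes _ = singleton c′
  ... | no _ | no _ = L u
  L′⊆ : ∀ {u k} → k ∈ᶜ L′ u → k ∈ᶜ L u
  L′⊆ {u} m with u ≟F y | u ≟F y′
  L′⊆ (here refl) | yes refl | _ = c∈
  L′⊆ (here refl) | no _ | yes refl = proj₁ (proj₂ ch′)
  ... | no _ | no _ = m
  L′-off : ∀ {u} → u ∉ pair y′ y → L′ u ≡ L u
  L′-off {u} p with u ≟F y | u ≟F y′
  ... | yes refl | _ = ⊥-elim (p pairʳ)
  ... | no _ | yes refl = ⊥-elim (p pairˡ)
  ... | no _ | no _ = refl
  L′-pair : ∀ {u} → u ∈ pair y′ y → 1 ≤ size (L′ u)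
  L′-pair {u} p with u ≟F y | u ≟F y′
  ... | yes refl | _ = ≤-refl
  ... | no _ | yes refl = ≤-refl
  ... | no a | no b = case pair-out p of λ where
        (inj₁ e) → ⊥-elim (b e)
        (inj₂ e) → ⊥-elim (a e)
  pair⊆ : pair y′ y ⊆ rim R U
  pair⊆ p with pair-out p
  ... | inj₁ refl = y′∈
  ... | inj₂ refl = y∈
  d : Ext (pair y′ y) U L′
  d = s₂ G R U L′ y′ y (E-sym y~y′) (record
    { conn-R = conn-R ; disj = disj ; free = free ; pre-rim = pair⊆ ; pre-size = L′-pair
    ; rim-size = λ p q → size-≥ (L′-off q)
        (rim-size p (λ r → q (｛｝⊆ pairʳ r)))
    ; in-size = λ p q → size-≥ (L′-off (q ∘ pair⊆)) (in-size p q) }) lt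
  open Ext d
  L′-y : L′ y ≡ singleton c
  L′-y with y ≟F y
  ... | yes _ = refl
  ... | no q = ⊥-elim (q refl)
  L′-y′ : L′ y′ ≡ singleton c′
  L′-y′ with y′ ≟F y | y′ ≟F y′
  ... | yes q | _ = ⊥-elim (y′≢y q)
  ... | no _ | yes _ = refl
  ... | no _ | no q = ⊥-elim (q refl)
  at-y : y ∈ U → φ y ≡ c
  at-y p with subst (φ y ∈ᶜ_) L′-y (chosen p)
  ... | here e = e
  at-y′ : y′ ∈ U → φ y′ ≡ c′
  at-y′ p with subst (φ y′ ∈ᶜ_) L′-y′ (chosen p)
  ... | here e = e

-- A rim vertex may be declared precoloured, as this only weakens what its list must satisfy. With
-- an empty rim, all lists have five colours; an arbitrary vertex is coloured, deleted and put in
-- the place of `R`.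
solve₀ : ∀ {m} → Solve₁ n m → (∀ (G : Graph n) R U L R′ U′ L′ → Rims.Hyp G ∅ R′ U′ L′ → ∣ U′ ∣ < ∣ U ∣ →
         ∣ U ∣ < m → Rims.Ext G ∅ U′ L′) → Solve₀ n m
solve₀ {n} s₁ s₀ G R U L H lt with find (_∈? Rims.rim G R U)
... | inj₁ (y , y∈) = record { φ = φ ; chosen = chosen ; proper = λ p q e _ → proper p q e
        (λ a b → OnGraph.E-irrefl G e (trans (｛｝-out a) (esym (｛｝-out b)))) }
  where
  open Rims G
  open Hyp H
  d : Ext ｛ y ｝ U L
  d = s₁ G R U L y (record
    { conn-R = conn-R ; disj = disj ; free = free
    ; pre-rim = ｛｝⊆ y∈
    ; pre-size = λ p → ≤-trans (s≤s z≤n) (subst (λ v → 3 ≤ size (L v)) (esym (｛｝-out p)) (rim-size y∈ ∉∅))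
    ; rim-size = λ p _ → rim-size p ∉∅ ; in-size = in-size }) lt
  open Ext d
... | inj₂ no-rim with find (_∈? U)
...   | inj₂ empty = record
        { φ = λ _ → 0 ; chosen = λ p → ⊥-elim (empty _ p) ; proper = λ p → ⊥-elim (empty _ p) }
...   | inj₁ (r , r∈) = extend {P′ = ∅} d id c∈ (λ _ → L′⊆) λ {u} p e _ eq →
        proj₂ (∖ᶜ-out {L u} (subst (Ext.φ d u ∈ᶜ_) (L′-near e) (Ext.chosen d p))) (here eq)
  where
  open OnGraph G
  open Minors G
  open Rims G
  open Hyp H
  five : ∀ {u} → u ∈ U → 5 ≤ size (L u)
  five p = in-size p (no-rim _)
  c = proj₁ (pick (L r) (≤-trans (s≤s z≤n) (five r∈)))
  c∈ : c ∈ᶜ L r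
  c∈ = proj₂ (pick (L r) (≤-trans (s≤s z≤n) (five r∈)))
  L′ : Lists
  L′ u with E? r u
  ... | yes _ = L u ∖ᶜ (c ∷ [])
  ... | no _ = L u
  L′-near : ∀ {u} → E G r u → L′ u ≡ L u ∖ᶜ (c ∷ [])
  L′-near {u} e with E? r u
  ... | yes _ = refl
  ... | no q = ⊥-elim (q e)
  L′-far : ∀ {u} → ¬ E G r u → L′ u ≡ L u
  L′-far {u} e with E? r u
  ... | yes q = ⊥-elim (e q)
  ... | no _ = refl
  L′⊆ : ∀ {u k} → k ∈ᶜ L′ u → k ∈ᶜ L u
  L′⊆ {u} m with E? r u
  ... | yes _ = proj₁ (∖ᶜ-out {L u} m)
  ... | no _ = m
  open ≤-Reasoning
  d : Ext ∅ (U - r) L′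
  d = s₀ G R U L ｛ r ｝ (U - r) L′ (record
    { conn-R = Conn-｛｝ ; disj = λ p q → proj₂ (minus-out q) (｛｝-out p)
    ; free = Free-mono (λ p → ∪-in (inj₂ (case ∪-out p of λ where
        (inj₁ q) → ｛｝⊆ r∈ q
        (inj₂ q) → minus⊆ q))) free
    ; pre-rim = λ p → ⊥-elim (∉∅ p) ; pre-size = λ p → ⊥-elim (∉∅ p)
    ; rim-size = λ {u} p _ → let q , s , s∈ , e = rim-out p in
        subst (λ l → 3 ≤ size l) (esym (L′-near (E-sym (subst (E G u) (｛｝-out s∈) e))))
          (+-cancelʳ-≤ 1 3 _ (begin
            4 ≤⟨ n≤1+n 4 ⟩
            5 ≤⟨ five (minus⊆ q) ⟩
            size (L u) ≤⟨ ∖ᶜ-size (L u) (c ∷ []) ⟩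
            size (L u ∖ᶜ (c ∷ [])) + 1 ∎))
    ; in-size = λ {u} p q → subst (λ l → 5 ≤ size l)
        (esym (L′-far (λ e → q (rim-in p ｛｝-in (E-sym e))))) (five (minus⊆ p)) })
    (minus-< r∈) lt

-- At a given size the case of two precoloured vertices comes first, since it calls smaller
-- instances only. The other two cases either pass to the next one at the same size or go down in
-- size.
solve : ∀ n m → Solve₀ n m × Solve₁ n m × Solve₂ n m
solve n zero = (λ _ _ _ _ _ ()) , (λ _ _ _ _ _ _ ()) , (λ _ _ _ _ _ _ _ _ ())
solve n (suc m) with solve n m
... | ih₀ , ih₁ , ih₂ = new₀ , new₁ , new₂
  where
  new₂ : Solve₂ n (suc m)
  new₂ G R U L x y e H lt = TwoPrecoloured.colour G R U L x y e H
    (λ R′ U′ L′ y′ H′ l → ih₁ G R′ U′ L′ y′ H′ (<-≤-trans l (s≤s⁻¹ lt)))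
    (λ G′ R′ U′ L′ x′ y′ e′ H′ l → ih₂ G′ R′ U′ L′ x′ y′ e′ H′ (<-≤-trans l (s≤s⁻¹ lt)))
  down : ∀ (G : Graph n) R U L R′ U′ L′ → Rims.Hyp G ∅ R′ U′ L′ → ∣ U′ ∣ < ∣ U ∣ → ∣ U ∣ < suc m →
         Rims.Ext G ∅ U′ L′
  down G R U L R′ U′ L′ H′ l lt = ih₀ G R′ U′ L′ H′ (<-≤-trans l (s≤s⁻¹ lt))
  new₁ : Solve₁ n (suc m)
  new₁ = solve₁ new₂ down
  new₀ : Solve₀ n (suc m)
  new₀ = solve₀ new₁ down

five-choosable : ∀ (G : Graph n) {U L} → Minors.Free G U → (∀ {v} → v ∈ U → 5 ≤ size (L v)) →
                 OnGraph.Col G U L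
five-choosable G {U} {L} fr five = record
  { φ = φ ; chosen = chosen ; proper = λ p q e → proper p q e (λ a _ → ∉∅ a) }
  where
  open Rims G
  d : Ext ∅ U L
  d = proj₁ (solve _ (suc ∣ U ∣)) G ∅ U L (record
    { conn-R = λ p → ⊥-elim (∉∅ p) ; disj = λ p → ⊥-elim (∉∅ p)
    ; free = Minors.Free-mono G (λ p → case ∪-out p of λ where
        (inj₁ q) → ⊥-elim (∉∅ q)
        (inj₂ q) → q) fr
    ; pre-rim = λ p → ⊥-elim (∉∅ p) ; pre-size = λ p → ⊥-elim (∉∅ p)
    ; rim-size = λ p _ → ≤-trans (s≤s (s≤s (s≤s z≤n))) (five (rim⊆ p))
    ; in-size = λ p _ → five p }) ≤-refl
  open Ext d

-- Brooks-type argument for a block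

even : ℕ → Bool
even zero = true
even (suc m) = not (even m)

even⇒double : ∀ m → even m ≡ true → ∃ λ r → m ≡ 2 * r
even⇒double zero _ = 0 , refl
even⇒double (suc (suc m)) e with even⇒double m (trans (esym (not-involutive (even m))) e)
... | r , refl = suc r , esym (*-suc 2 r)

module _ {m : ℕ} where

  next : (i : Fin (suc m)) → ∃ λ j → Consecutive i j
  next i with toℕ i <? m
  ... | yes p = fromℕ< (s≤s p) , inj₁ (toℕ-fromℕ< (s≤s p))
  ... | no p = fzero , inj₂ (≤-antisym (s≤s⁻¹ (toℕ<n i)) (≮⇒≥ p) , refl)

  previous : (i : Fin (suc m)) → ∃ λ j → Consecutive j i
  previous fzero = fromℕ< (n<1+n m) , inj₂ (toℕ-fromℕ< (n<1+n m) , refl)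
  previous (fsuc i) = fromℕ< (m≤n⇒m≤1+n (toℕ<n i)) ,
    inj₁ (cong suc (esym (toℕ-fromℕ< (m≤n⇒m≤1+n (toℕ<n i)))))

  next≢previous : 2 ≤ m → ∀ {i j k : Fin (suc m)} → Consecutive i j → Consecutive k i → j ≢ k
  next≢previous _ {i} (inj₁ p) (inj₁ q) refl = <-irrefl q (≤-trans (n≤1+n _) (s≤s (≤-reflexive (esym p))))
  next≢previous h {i} (inj₁ p) (inj₂ (q , r)) refl =
    case subst (2 ≤_) (trans (esym q) (trans p (cong suc r))) h of λ { (s≤s ()) }
  next≢previous h (inj₂ (p , q)) (inj₁ r) refl =
    case subst (2 ≤_) (trans (esym p) (trans r (cong suc q))) h of λ { (s≤s ()) }
  next≢previous h (inj₂ (p , q)) (inj₂ (r , s)) refl =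
    case subst (2 ≤_) (trans (esym p) s) h of λ ()

linked-lookup : {R : A → A → Set} {l : List A} → Linked R l → ∀ {i j} → toℕ j ≡ suc (toℕ i) →
                R (lookup l i) (lookup l j)
linked-lookup (r ∷ _) {fzero} {fsuc fzero} _ = r
linked-lookup (_ ∷ l) {fsuc i} {fsuc j} e = linked-lookup l (suc-injective e)
linked-lookup [-] {fzero} {fzero} ()
linked-lookup (_ ∷ _) {fzero} {fzero} ()
linked-lookup (_ ∷ _) {fzero} {fsuc (fsuc j)} ()
linked-lookup (_ ∷ _) {fsuc i} {fzero} ()

lookup-last : (h : A) (t : List A) (i : Fin (suc (length t))) → toℕ i ≡ length t → lookup (h ∷ t) i ≡ lastOf h t
lookup-last h [] fzero _ = refl
lookup-last h (g ∷ t) (fsuc i) e = lookup-last g t i (suc-injective e)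

data LastSuch {A : Set} (P : A → Set) (l : List A) : Set where
  none  : (∀ {v} → v ∈ₗ l → ¬ P v) → LastSuch P l
  found : ∀ p c q → l ≡ p ++ c ∷ q → P c → (∀ {v} → v ∈ₗ q → ¬ P v) → LastSuch P l

last-such : {P : A → Set} → Decidable P → ∀ l → LastSuch P l
last-such P? [] = none λ ()
last-such P? (x ∷ l) with last-such P? l | P? x
... | found p c q refl pc h | _ = found (x ∷ p) c q refl pc h
... | none h | yes p = found [] x l refl p h
... | none h | no ¬p = none λ { (here refl) → ¬p ; (there v) → h v }

module Brooks (G : Graph n) where
  open OnGraph G

  Complete : VSet n → Set
  Complete B = ∀ {u v} → u ∈ B → v ∈ B → u ≢ v → E G u v

  NoCut : VSet n → Set
  NoCut B = Conn B × (∀ {w} → w ∈ B → Conn (B - w))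

  -- The degree bound is kept next to the cycle because it is what excludes odd cycles among leaf
  -- blocks whose vertices have three neighbours in the block.
  OddCycle : VSet n → Set
  OddCycle B = IsOddCycle G B × (∀ {v} → v ∈ B → degIn B v ≤ 2)

  three-neighbours : ∀ {U v a b c} → a ∈ U → b ∈ U → c ∈ U → E G v a → E G v b → E G v c →
                     a ≢ b → a ≢ c → b ≢ c → 3 ≤ degIn U v
  three-neighbours {U} {v} {a} {b} {c} a∈ b∈ c∈ ea eb ec ab ac bc =
    unique⊆⇒length≤ _≟F_ {a ∷ b ∷ c ∷ []} ((ab ∷ ac ∷ []) ∷ (bc ∷ []) ∷ [] ∷ []) λ where
      (here refl) → nb-in a∈ ea
      (there (here refl)) → nb-in b∈ eb
      (there (there (here refl))) → nb-in c∈ ec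

  two-neighbours : ∀ {U v a b} → a ∈ U → b ∈ U → E G v a → E G v b → a ≢ b → 2 ≤ degIn U v
  two-neighbours {U} {v} {a} {b} a∈ b∈ ea eb ab =
    unique⊆⇒length≤ _≟F_ {a ∷ b ∷ []} ((ab ∷ []) ∷ [] ∷ []) λ where
      (here refl) → nb-in a∈ ea
      (there (here refl)) → nb-in b∈ eb

  module CycleGraph (B : VSet n) (L : Lists) (deg≤2 : ∀ {v} → v ∈ B → degIn B v ≤ 2)
    (m : ℕ) (2≤m : 2 ≤ m) (c : Fin (suc m) → Fin n) (inj : ∀ {i j} → c i ≡ c j → i ≡ j)
    (c∈ : ∀ i → c i ∈ B) (onto : ∀ {v} → v ∈ B → ∃ λ i → c i ≡ v)
    (consecutive : ∀ {i j} → Consecutive i j → E G (c i) (c j)) where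

    -- The successor and the predecessor of `i` already use up the degree bound, so the cycle has no
    -- chords.
    edge⇒consecutive : ∀ i j → E G (c i) (c j) → Consecutive i j ⊎ Consecutive j i
    edge⇒consecutive i j e with next i | previous i
    ... | a , ca | b , cb with j ≟F a | j ≟F b
    ... | yes refl | _ = inj₁ ca
    ... | _ | yes refl = inj₂ cb
    ... | no p | no q = ⊥-elim (<-irrefl refl (<-≤-trans
          (three-neighbours (c∈ j) (c∈ a) (c∈ b) e (consecutive ca) (E-sym (consecutive cb))
            (p ∘ inj) (q ∘ inj) (next≢previous 2≤m ca cb ∘ inj)) (deg≤2 (c∈ i))))

    -- The cycle has `suc m` vertices, so `m` odd means even length. Colours alternate with the
    -- parity of the index, and the closing edge joins index `m` to index 0.
    two-colour : even m ≡ false → ∀ {α β} → α ≢ β → (∀ {v} → v ∈ B → α ∈ᶜ L v) → (∀ {v} → v ∈ B → β ∈ᶜ L v) →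
                 Col B L
    two-colour odd {α} {β} α≢β α∈ β∈ = record { φ = f ; chosen = ch ; proper = pr }
      where
      shade : Bool → ℕ
      shade b = if b then α else β
      shade-inj : ∀ {a b} → shade a ≡ shade b → a ≡ b
      shade-inj {false} {false} _ = refl
      shade-inj {false} {true} e = ⊥-elim (α≢β (esym e))
      shade-inj {true} {false} e = ⊥-elim (α≢β e)
      shade-inj {true} {true} _ = refl
      f : Fin n → ℕ
      f v with any? (λ i → c i ≟F v)
      ... | yes (i , _) = shade (even (toℕ i))
      ... | no _ = α
      f-at : ∀ i → f (c i) ≡ shade (even (toℕ i))
      f-at i with any? (λ j → c j ≟F c i)
      ... | yes (j , e) = cong (λ k → shade (even (toℕ k))) (inj e)
      ... | no q = ⊥-elim (q (i , refl))
      shade∈ : ∀ b {v} → v ∈ B → shade b ∈ᶜ L v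
      shade∈ true = α∈
      shade∈ false = β∈
      ch : ∀ {v} → v ∈ B → f v ∈ᶜ L v
      ch v∈ with onto v∈
      ... | i , refl = subst (_∈ᶜ L (c i)) (esym (f-at i)) (shade∈ (even (toℕ i)) v∈)
      alternate : ∀ {i j : Fin (suc m)} → Consecutive i j → even (toℕ i) ≢ even (toℕ j)
      alternate (inj₁ e) eq = not-¬ (esym eq) (cong even e)
      alternate (inj₂ (p , q)) eq with trans (trans (esym odd) (cong even (esym p))) (trans eq (cong even q))
      ... | ()
      pr : ∀ {u v} → u ∈ B → v ∈ B → E G u v → f u ≢ f v
      pr u∈ v∈ e eq with onto u∈ | onto v∈
      ... | i , refl | j , refl with shade-inj (trans (esym (f-at i)) (trans eq (f-at j))) | edge⇒consecutive i j e
      ... | s | inj₁ cij = alternate cij s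
      ... | s | inj₂ cji = alternate cji (esym s)

  odd-cycle : ∀ {B} m → even m ≡ true → 2 ≤ m → (c : Fin (suc m) → Fin n) → (∀ {i j} → c i ≡ c j → i ≡ j) →
              (∀ i → c i ∈ B) → (∀ {v} → v ∈ B → ∃ λ i → c i ≡ v) →
              (∀ i j → E G (c i) (c j) → Consecutive i j ⊎ Consecutive j i) →
              (∀ {i j} → Consecutive i j → E G (c i) (c j)) → IsOddCycle G B
  odd-cycle m ev 2≤m c inj c∈ onto e⇒c c⇒e with even⇒double m ev
  odd-cycle _ ev () c inj c∈ onto e⇒c c⇒e | zero , refl
  ... | suc r , eq with trans eq (*-suc 2 r)
  ... | refl = r , c , inj
    , (λ v → (λ p → onto (mem p)) , λ { (i , refl) → _∈_.get (c∈ i) })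
    , (λ i j → e⇒c i j , λ { (inj₁ p) → c⇒e p ; (inj₂ p) → E-sym (c⇒e p) })

  cycle-minus : ∀ p {b a q h t} → h ∷ t ≡ p ++ b ∷ a ∷ q → Linked (E G) (h ∷ t) → E G (lastOf h t) h →
                Unique (h ∷ t) → Conn (setOf (h ∷ t) - b)
  cycle-minus p {b} {a} {q} {h} {t} eq lk close un = star-conn {r = lastOf a q} to-last
    where
    O′ = setOf (h ∷ t) - b
    un′ : Unique (p ++ b ∷ a ∷ q)
    un′ = subst Unique eq un
    lk′ : Linked (E G) (p ++ b ∷ a ∷ q)
    lk′ = subst (Linked (E G)) eq lk
    inO : ∀ {v} → v ∈ₗ p ++ b ∷ a ∷ q → v ≢ b → v ∈ O′
    inO m ne = minus-in (setOf-in (subst (_ ∈ₗ_) (esym eq) m)) ne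
    in-p : setOf p ⊆ O′
    in-p m = inO (∈-++⁺ˡ (setOf-out m)) λ { refl → unique-++ un′ (setOf-out m) (here refl) }
    in-q : setOf (a ∷ q) ⊆ O′
    in-q m = inO (∈-++⁺ʳ p (there (setOf-out m)))
      λ { refl → unique-++ {p = b ∷ []} (unique-++ʳ p un′) (here refl) (setOf-out m) }
    conn-q : Conn (setOf (a ∷ q))
    conn-q = Minors.linked-conn G (linked-suffix (b ∷ []) (linked-suffix p lk′))
    last∈ : lastOf a q ∈ setOf (a ∷ q)
    last∈ = setOf-in (lastOf-∈ a q)
    ends : ∀ p {h t} → h ∷ t ≡ p ++ b ∷ a ∷ q → lastOf h t ≡ lastOf a q × (∀ {v} → v ∈ₗ p → h ∈ₗ p)
    ends [] refl = refl , λ ()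
    ends (x ∷ p) refl = lastOf-++ x p b (a ∷ q) , λ _ → here refl
    conn-p : Conn (setOf p)
    conn-p = Minors.linked-conn G (linked-init p lk′)
    to-last : ∀ {v} → v ∈ O′ → Path O′ v (lastOf a q)
    to-last {v} v∈ with ∈-++⁻ p (subst (v ∈ₗ_) eq (setOf-out (minus⊆ v∈)))
    ... | inj₂ (here refl) = ⊥-elim (proj₂ (minus-out v∈) refl)
    ... | inj₂ (there m) = Path-mono in-q (conn-q (setOf-in m) last∈)
    ... | inj₁ m = Path-mono in-p (conn-p (setOf-in m) (setOf-in h∈)) ◅◅
          edge-path (in-p (setOf-in h∈)) (in-q last∈) (E-sym (subst (λ u → E G u h) (proj₁ (ends p eq)) close))
      where
      h∈ : h ∈ₗ p
      h∈ = proj₂ (ends p eq) m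

  missing : ∀ l l′ → Dec (∃ λ c → c ∈ᶜ l × c ∉ᶜ l′)
  missing l l′ with first (λ c → ¬? (c ∈ᶜ? l′)) (Colours.list l)
  ... | none h = no λ (c , p , q) → h p q
  ... | found p c q eq _ c∉ = yes (c , subst (c ∈ₗ_) (esym eq) (∈-++⁺ʳ p (here refl)) , c∉)

  module _ {B : VSet n} {L : Lists} (cB : Conn B) (cut : ∀ {w} → w ∈ B → Conn (B - w))
    (deg≤ : ∀ {v} → v ∈ B → degIn B v ≤ size (L v)) where

    private
      Result : Set
      Result = Col B L ⊎ (Complete B ⊎ OddCycle B)

    module EqualLists (tight : ∀ {v} → v ∈ B → size (L v) ≤ degIn B v)
      (same : ∀ {u v c} → u ∈ B → v ∈ B → c ∈ᶜ L u → c ∈ᶜ L v) where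

      -- The neighbour w of a outside the cycle O lends its colour to b, which is next to a.
      off-cycle : ∀ {h t} → Linked (E G) (h ∷ t) → E G (lastOf h t) h → Unique (h ∷ t) →
                  (∀ {v} → v ∈ₗ h ∷ t → v ∈ B) → (∀ {u} → u ∈ B → E G h u → u ∈ₗ h ∷ t) →
                  ∀ {w₀} → w₀ ∈ B → w₀ ∉ₗ h ∷ t → Col B L
      off-cycle {h} {t} lk close un l⊆ inside w₀∈ w₀∉ with first out? (h ∷ t)
        where
        O = setOf (h ∷ t)
        out? : Decidable (λ v → ∃ λ w → w ∈ B ∖ O × E G v w)
        out? v = any? λ w → (w ∈? B ∖ O) ×-dec E? v w
      ... | none nobody with first-entry (setOf (h ∷ t)) (cB w₀∈ (l⊆ (here refl))) (w₀∉ ∘ setOf-out) (setOf-in (here refl))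
      ...   | a , b , path , _ , b∈ , e = ⊥-elim (nobody (setOf-out b∈) (a , Path-end path , E-sym e))
      off-cycle {h} {t} lk close un l⊆ inside w₀∈ w₀∉ | found p a q eq before (w , w∈ , a~w) with initLast p
      -- All neighbours of `h` are on the cycle, so the first vertex with a neighbour off it is not
      -- `h` and has a predecessor.
      off-cycle lk close un l⊆ inside w₀∈ w₀∉ | found .[] a q refl before (w , w∈ , a~w) | [] =
        ⊥-elim (proj₂ (∖-out w∈) (setOf-in (inside (∖⊆ w∈) a~w)))
      off-cycle {h} {t} lk close un l⊆ inside w₀∈ w₀∉ | found .(p ∷ʳ b) a q eq before (w , w∈ , a~w) | p ∷ʳ′ b =
        merge c₁ (swap (λ v∈ → res-deg (φ c₁) {U = B} {L = L} (λ z _ → ∖⊆ z) (λ z _ → O⊆ z)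
                         (λ y z → proj₂ (∖-out y) z) (deg≤ (O⊆ v∈)))
                       (cycle-minus p eq′ lk close un) b∈ a∈ b~a k∈b k∉a)
          (∖-cover O)
        where
        open Col
        O = setOf (h ∷ t)
        O⊆ : O ⊆ B
        O⊆ = l⊆ ∘ setOf-out
        eq′ : h ∷ t ≡ p ++ b ∷ a ∷ q
        eq′ = trans eq (++-assoc p (b ∷ []) (a ∷ q))
        b∈ : b ∈ O
        b∈ = setOf-in (subst (b ∈ₗ_) (esym eq′) (∈-++⁺ʳ p (here refl)))
        a∈ : a ∈ O
        a∈ = setOf-in (subst (a ∈ₗ_) (esym eq′) (∈-++⁺ʳ p (there (here refl))))
        b~a : E G b a
        b~a with linked-suffix p (subst (Linked (E G)) eq′ lk)
        ... | e ∷ _ = e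
        c₁ : Col (B ∖ O) L
        c₁ = outside (conn-grow cB O⊆ b∈) (λ v∈ _ → deg≤ v∈)
        k = φ c₁ w
        -- `b` precedes the first vertex with a neighbour off the cycle, so it has lost no colour,
        -- whereas `a` has lost the colour of `w`.
        k∈b : k ∈ᶜ res (φ c₁) (B ∖ O) L b
        k∈b = res-in (same (∖⊆ w∈) (O⊆ b∈) (chosen c₁ w∈))
          λ u∈ e _ → before (∈-++⁺ʳ p (here refl)) (_ , u∈ , e)
        k∉a : k ∉ᶜ res (φ c₁) (B ∖ O) L a
        k∉a m = proj₂ (res-out m) w∈ a~w refl

      module Spanning {h t} (lk : Linked (E G) (h ∷ t)) (close : E G (lastOf h t) h) (un : Unique (h ∷ t))
        (l⊆ : ∀ {v} → v ∈ₗ h ∷ t → v ∈ B) (all : ∀ {v} → v ∈ B → v ∈ₗ h ∷ t) where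

        -- A vertex v with two non-adjacent equally coloured neighbours has a colour to spare.
        identify : ∀ s {v₁ v₂ v₃ u} → h ∷ t ≡ s ++ v₃ ∷ v₂ ∷ v₁ ∷ [] → ¬ E G v₁ v₃ → v₁ ≢ v₃ →
                   u ∈ B → E G v₂ u → u ≢ v₁ → u ≢ v₃ → Col B L
        identify s {v₁} {v₂} {v₃} {u} eq v₁≁v₃ v₁≢v₃ u∈ v₂~u u≢v₁ u≢v₃ = merge c₁
          (greedy (star-conn {r = v₂} to-v₂) v₂∈T
            (λ v∈ → res-deg (λ _ → k) {U = B} {L = L} (λ p _ → S⊆ p) (λ p _ → ∖⊆ p)
                      (λ p q → proj₂ (∖-out q) p) (deg≤ (∖⊆ v∈)))
            (+-cancelʳ-< (degIn S v₂) _ _ (begin-strict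
              degIn T v₂ + degIn S v₂ ≤⟨ degIn-+ (λ p _ → ∖⊆ p) (λ p _ → S⊆ p) (λ p q → proj₂ (∖-out p) q) ⟩
              degIn B v₂ ≤⟨ deg≤ (v∈ᵢ (there (here refl))) ⟩
              size (L v₂) <⟨ res-size-spare pairˡ v₂~v₁ (inj₂ (v₃ , pairʳ , ≢-sym v₁≢v₃ , v₂~v₃ , refl)) ⟩
              size (res (λ _ → k) S L v₂) + degIn S v₂ ∎)))
          (cover-∖ S)
          where
          open ≤-Reasoning
          S = pair v₁ v₃
          T = B ∖ S
          lk′ : Linked (E G) (s ++ v₃ ∷ v₂ ∷ v₁ ∷ [])
          lk′ = subst (Linked (E G)) eq lk
          un′ : Unique (s ++ v₃ ∷ v₂ ∷ v₁ ∷ [])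
          un′ = subst Unique eq un
          v∈ᵢ : ∀ {v} → v ∈ₗ v₃ ∷ v₂ ∷ v₁ ∷ [] → v ∈ B
          v∈ᵢ m = l⊆ (subst (_ ∈ₗ_) (esym eq) (∈-++⁺ʳ s m))
          v₂~v₃ : E G v₂ v₃
          v₂~v₃ with linked-suffix s lk′
          ... | e ∷ _ = E-sym e
          v₂~v₁ : E G v₂ v₁
          v₂~v₁ with linked-suffix s lk′
          ... | _ ∷ e ∷ _ = e
          S⊆ : S ⊆ B
          S⊆ p with pair-out p
          ... | inj₁ refl = v∈ᵢ (there (there (here refl)))
          ... | inj₂ refl = v∈ᵢ (here refl)
          k-pick = pick (L v₁) (≤-trans (degIn-pos (v∈ᵢ (there (here refl))) (E-sym v₂~v₁))
                                        (deg≤ (v∈ᵢ (there (there (here refl))))))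
          k = proj₁ k-pick
          c₁ : Col S L
          c₁ = record
            { φ = λ _ → k
            ; chosen = λ p → same (v∈ᵢ (there (there (here refl)))) (S⊆ p) (proj₂ k-pick)
            ; proper = λ p q e → case pair-out p of λ where
                (inj₁ refl) → case pair-out q of λ where
                  (inj₁ refl) → ⊥-elim (E-irrefl e refl)
                  (inj₂ refl) → ⊥-elim (v₁≁v₃ e)
                (inj₂ refl) → case pair-out q of λ where
                  (inj₁ refl) → ⊥-elim (v₁≁v₃ (E-sym e))
                  (inj₂ refl) → ⊥-elim (E-irrefl e refl) }
          v₂∈T : v₂ ∈ T
          v₂∈T = ∖-in (v∈ᵢ (there (here refl))) λ p → case pair-out p of λ where
            (inj₁ e) → E-irrefl v₂~v₁ e
            (inj₂ e) → E-irrefl v₂~v₃ e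
          s⊆T : setOf s ⊆ T
          s⊆T m = ∖-in (l⊆ (subst (_ ∈ₗ_) (esym eq) (∈-++⁺ˡ (setOf-out m)))) λ p → case pair-out p of λ where
            (inj₁ refl) → unique-++ un′ (setOf-out m) (there (there (here refl)))
            (inj₂ refl) → unique-++ un′ (setOf-out m) (here refl)
          locate : ∀ {v} → v ∈ T → v ≡ v₂ ⊎ v ∈ setOf s
          locate {v} v∈ with ∈-++⁻ s (subst (v ∈ₗ_) eq (all (∖⊆ v∈)))
          ... | inj₁ m = inj₂ (setOf-in m)
          ... | inj₂ (here refl) = ⊥-elim (proj₂ (∖-out v∈) pairʳ)
          ... | inj₂ (there (here refl)) = inj₁ refl
          ... | inj₂ (there (there (here refl))) = ⊥-elim (proj₂ (∖-out v∈) pairˡ)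
          u∈s : u ∈ setOf s
          u∈s with ∈-++⁻ s (subst (u ∈ₗ_) eq (all u∈))
          ... | inj₁ m = setOf-in m
          ... | inj₂ (here refl) = ⊥-elim (u≢v₃ refl)
          ... | inj₂ (there (here refl)) = ⊥-elim (E-irrefl v₂~u refl)
          ... | inj₂ (there (there (here refl))) = ⊥-elim (u≢v₁ refl)
          -- The part `s` of the cycle is a path through `u`, so `v₂` stays joined to all that is
          -- left when `v₁` and `v₃` are gone.
          to-v₂ : ∀ {v} → v ∈ T → Path T v v₂
          to-v₂ v∈ with locate v∈
          ... | inj₁ refl = nil v∈
          ... | inj₂ m = Path-mono s⊆T (Minors.linked-conn G (linked-init s lk′) m u∈s)
                ◅◅ edge-path (s⊆T u∈s) v₂∈T (E-sym v₂~u)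

        two-regular : 2 ≤ length t → (∀ {v} → v ∈ B → degIn B v ≤ 2) → Result
        two-regular 2≤ deg≤2 = by-parity (even (length t)) refl
          where
          c : Fin (suc (length t)) → Fin n
          c = lookup (h ∷ t)
          inj : ∀ {i j} → c i ≡ c j → i ≡ j
          inj {i} {j} e with i ≟F j
          ... | yes p = p
          ... | no p = ⊥-elim (allPairs-lookup ≢-sym un p e)
          c∈ : ∀ i → c i ∈ B
          c∈ i = l⊆ (∈-lookup i)
          onto : ∀ {v} → v ∈ B → ∃ λ i → c i ≡ v
          onto v∈ = index (all v∈) , esym (lookup-index (all v∈))
          consecutive : ∀ {i j} → Consecutive i j → E G (c i) (c j)
          consecutive (inj₁ e) = linked-lookup lk e
          consecutive {i} {fzero} (inj₂ (e , _)) = subst (λ v → E G v h) (esym (lookup-last h t i e)) close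
          open CycleGraph B L deg≤2 (length t) 2≤ c inj c∈ onto consecutive
          by-parity : ∀ b → even (length t) ≡ b → Result
          by-parity true ev = inj₂ (inj₂ (odd-cycle (length t) ev 2≤ c inj c∈ onto edge⇒consecutive consecutive , deg≤2))
          by-parity false od = inj₁ (two-colour od (λ e → proj₂ (proj₂ pβ) (here (esym e)))
            (λ v∈ → same (l⊆ (here refl)) v∈ (proj₂ pα)) (λ v∈ → same (l⊆ (here refl)) v∈ (proj₁ (proj₂ pβ))))
            where
            2≤h : 2 ≤ size (L h)
            2≤h with next {length t} fzero | previous {length t} fzero
            ... | i , ci | j , cj = ≤-trans
              (two-neighbours (c∈ i) (c∈ j) (consecutive ci) (E-sym (consecutive cj))
                (next≢previous 2≤ ci cj ∘ inj)) (deg≤ (l⊆ (here refl)))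
            pα = pick (L h) (≤-trans (s≤s z≤n) 2≤h)
            pβ = pick-avoiding (L h) (proj₁ pα ∷ []) 2≤h

      module InducedPath {v₁ v₂ v₃} (v₁∈ : v₁ ∈ B) (v₂∈ : v₂ ∈ B) (v₃∈ : v₃ ∈ B) (v₁~v₂ : E G v₁ v₂)
        (v₂~v₃ : E G v₂ v₃) (v₁≢v₃ : v₁ ≢ v₃) (v₁≁v₃ : ¬ E G v₁ v₃) where

        equal-degree : ∀ {v} → v ∈ B → degIn B v ≤ degIn B v₂
        equal-degree {v} v∈ = ≤-trans (deg≤ v∈) (≤-trans (size-⊆ {L v} {L v₂} (same v∈ v₂∈)) (tight v₂∈))

        spanning : ∀ s {h t} → h ∷ t ≡ s ++ v₃ ∷ v₂ ∷ v₁ ∷ [] → Linked (E G) (h ∷ t) → E G (lastOf h t) h →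
                   Unique (h ∷ t) → (∀ {v} → v ∈ₗ h ∷ t → v ∈ B) → (∀ {v} → v ∈ B → v ∈ₗ h ∷ t) → Result
        spanning s {h} {t} eq lk close un l⊆ all
          with find (λ u → (u ∈? B) ×-dec E? v₂ u ×-dec ¬? (u ≟F v₁) ×-dec ¬? (u ≟F v₃))
        ... | inj₁ (u , u∈ , e , p , q) =
          inj₁ (Spanning.identify lk close un l⊆ all s eq v₁≁v₃ v₁≢v₃ u∈ e p q)
        ... | inj₂ absent = Spanning.two-regular lk close un l⊆ all (long s eq)
              (λ v∈ → ≤-trans (equal-degree v∈) deg-v₂)
          where
          long : ∀ s {h t} → h ∷ t ≡ s ++ v₃ ∷ v₂ ∷ v₁ ∷ [] → 2 ≤ length t
          long [] refl = s≤s (s≤s z≤n)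
          long (x ∷ s) refl = subst (2 ≤_) (esym (length-++ s)) (m≤n⇒m≤o+n (length s) (s≤s (s≤s z≤n)))
          deg-v₂ : degIn B v₂ ≤ 2
          deg-v₂ = unique⊆⇒length≤ _≟F_ {nb B v₂} {v₁ ∷ v₃ ∷ []} (nb-unique B v₂) λ {u} m →
            let u∈ , e = nb-out m in case u ≟F v₁ of λ where
              (yes p) → here p
              (no p) → case u ≟F v₃ of λ where
                (yes q) → there (here q)
                (no q) → ⊥-elim (absent u (u∈ , e , p , q))

        -- The path keeps its end `v₃ v₂ v₁` and grows at its head until all neighbours of the head
        -- lie on it. Closing it at the last of these neighbours gives a cycle that contains every
        -- neighbour of the head. If it misses a vertex of `B`, `off-cycle` applies; if not, it
        -- contains `v₁`, so nothing was cut off and `v₃ v₂ v₁` are still consecutive on it.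
        grow-path : ∀ m s {h t} → h ∷ t ≡ s ++ v₃ ∷ v₂ ∷ v₁ ∷ [] → Linked (E G) (h ∷ t) → Unique (h ∷ t) →
                    (∀ {v} → v ∈ₗ h ∷ t → v ∈ B) → ∣ B ∖ setOf (h ∷ t) ∣ < m → Result
        grow-path (suc m) s {h} {t} eq lk un l⊆ lt
          with find (λ u → (u ∈? B ∖ setOf (h ∷ t)) ×-dec E? h u)
        ... | inj₁ (u , u∈ , e) = grow-path m (u ∷ s) (cong (u ∷_) eq) (E-sym e ∷ lk)
              (All.tabulate (λ q r → proj₂ (∖-out u∈) (setOf-in (subst (_∈ₗ h ∷ t) (esym r) q))) ∷ un)
              (λ where
                (here refl) → ∖⊆ u∈
                (there q) → l⊆ q)
              (<-≤-trans (∣∣-< (λ q → let a , b = ∖-out q in ∖-in a (b ∘ setOf-in ∘ there ∘ setOf-out))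
                 u∈ (λ q → proj₂ (∖-out q) (setOf-in (here refl)))) (s≤s⁻¹ lt))
        ... | inj₂ stuck with last-such (E? h) t
        ...   | none h≁t = ⊥-elim (alone s eq lk)
          where
          alone : ∀ s → h ∷ t ≡ s ++ v₃ ∷ v₂ ∷ v₁ ∷ [] → Linked (E G) (h ∷ t) → ⊥
          alone [] refl (e ∷ _) = h≁t (here refl) e
          alone (_ ∷ []) refl (e ∷ _) = h≁t (here refl) e
          alone (_ ∷ _ ∷ s) refl (e ∷ _) = h≁t (here refl) e
        ...   | found p z q t≡ h~z after = finish (find (λ u → (u ∈? B) ×-dec ¬? (u ∈ₗF? h ∷ p ++ z ∷ [])))
          where
          -- With `p` empty this is a single edge traversed both ways, which `off-cycle` accepts
          -- too.
          cyc = h ∷ p ++ z ∷ []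
          whole : h ∷ t ≡ cyc ++ q
          whole = trans (cong (h ∷_) t≡) (cong (h ∷_) (esym (++-assoc p (z ∷ []) q)))
          lk′ : Linked (E G) cyc
          lk′ = linked-init cyc (subst (Linked (E G)) whole lk)
          un′ : Unique cyc
          un′ = unique-++ˡ cyc (subst Unique whole un)
          cyc⊆ : ∀ {v} → v ∈ₗ cyc → v ∈ B
          cyc⊆ {v} m = l⊆ (subst (v ∈ₗ_) (esym whole) (∈-++⁺ˡ {xs = cyc} m))
          close : E G (lastOf h (p ++ z ∷ [])) h
          close = subst (λ u → E G u h) (esym (lastOf-++ h p z [])) (E-sym h~z)
          inside : ∀ {u} → u ∈ B → E G h u → u ∈ₗ cyc
          inside {u} u∈ e with u ∈ₗF? h ∷ t
          ... | no u∉ = ⊥-elim (stuck u (∖-in u∈ (u∉ ∘ setOf-out) , e))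
          ... | yes m with ∈-++⁻ cyc (subst (u ∈ₗ_) whole m)
          ...   | inj₁ m′ = m′
          ...   | inj₂ m′ = ⊥-elim (after m′ e)
          finish : ((∃ λ u → u ∈ B × u ∉ₗ cyc) ⊎ (∀ u → ¬ (u ∈ B × u ∉ₗ cyc))) → Result
          finish (inj₁ (u , u∈ , u∉)) = inj₁ (off-cycle lk′ close un′ cyc⊆ inside u∈ u∉)
          finish (inj₂ spans) = spanning s (trans (q-empty q refl) eq) lk′ close un′ cyc⊆ all
            where
            all : ∀ {v} → v ∈ B → v ∈ₗ cyc
            all {v} v∈ with v ∈ₗF? cyc
            ... | yes m = m
            ... | no m = ⊥-elim (spans v (v∈ , m))
            v₁-last : ∀ s {h t} → h ∷ t ≡ s ++ v₃ ∷ v₂ ∷ v₁ ∷ [] → lastOf h t ≡ v₁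
            v₁-last [] refl = refl
            v₁-last (x ∷ s) refl = lastOf-++ x s v₃ (v₂ ∷ v₁ ∷ [])
            q-empty : ∀ q′ → q′ ≡ q → cyc ≡ h ∷ t
            q-empty [] refl = esym (trans whole (++-identityʳ cyc))
            q-empty (x ∷ q′) refl = ⊥-elim (unique-++ (subst Unique whole un) (all v₁∈)
              (subst (_∈ₗ x ∷ q′) v₁≡ (lastOf-∈ x q′)))
              where
              v₁≡ : lastOf x q′ ≡ v₁
              v₁≡ = trans (esym (trans (cong (λ r → lastOf h r) t≡) (lastOf-++ h p z (x ∷ q′))))
                      (v₁-last s eq)

        result : Result
        result = grow-path (suc ∣ B ∖ setOf (v₃ ∷ v₂ ∷ v₁ ∷ []) ∣) [] refl
          (E-sym v₂~v₃ ∷ E-sym v₁~v₂ ∷ [-])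
          ((E-irrefl (E-sym v₂~v₃) ∷ ≢-sym v₁≢v₃ ∷ []) ∷ (E-irrefl (E-sym v₁~v₂) ∷ []) ∷ [] ∷ [])
          (λ where
            (here refl) → v₃∈
            (there (here refl)) → v₂∈
            (there (there (here refl))) → v₁∈)
          ≤-refl

      result : Result
      result with find (λ v₁ → any? (λ v₂ → any? (λ v₃ → ((v₁ ∈? B) ×-dec (v₂ ∈? B) ×-dec (v₃ ∈? B)) ×-dec
                   (E? v₁ v₂ ×-dec E? v₂ v₃ ×-dec ¬? (v₁ ≟F v₃) ×-dec ¬? (E? v₁ v₃)))))
      ... | inj₁ (v₁ , v₂ , v₃ , (a , b , c) , d , e , f , g) = InducedPath.result a b c d e f g
      ... | inj₂ absent = inj₂ (inj₁ λ p q ne → case clique (cB p q) of λ where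
              (inj₁ e) → ⊥-elim (ne e)
              (inj₂ e) → e)
        where
        clique : ∀ {u v} → Path B u v → u ≡ v ⊎ E G u v
        clique (nil _) = inj₁ refl
        clique {u} {v} (cons p e r) with clique r
        ... | inj₁ refl = inj₂ e
        ... | inj₂ e′ with u ≟F v | E? u v
        ...   | yes q | _ = inj₁ q
        ...   | no _ | yes q = inj₂ q
        ...   | no q | no q′ = ⊥-elim (absent u (_ , v , (p , Path-start r , Path-end r) , e , e′ , q , q′))

    -- A surplus vertex serves as a root for `greedy`, and adjacent vertices with different lists
    -- allow `swap`. Otherwise connectivity makes all lists equal, with size equal to the degree,
    -- and the situation is that of Brooks' theorem for a regular graph.
    colourable-or-Gallai : Result
    colourable-or-Gallai with find (λ v → (v ∈? B) ×-dec (degIn B v <? size (L v)))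
    ... | inj₁ (v , v∈ , lt) = inj₁ (greedy cB v∈ deg≤ lt)
    ... | inj₂ no-surplus with find (λ u → any? (λ v → ((u ∈? B) ×-dec (v ∈? B)) ×-dec (E? u v ×-dec missing (L u) (L v))))
    ...   | inj₁ (u , v , (u∈ , v∈) , e , c , c∈ , c∉) = inj₁ (swap deg≤ (cut u∈) u∈ v∈ e c∈ c∉)
    ...   | inj₂ agree = EqualLists.result (λ {v} v∈ → ≮⇒≥ (λ lt → no-surplus v (v∈ , lt)))
              (λ u∈ v∈ → along (cB u∈ v∈))
      where
      along : ∀ {u v c} → Path B u v → c ∈ᶜ L u → c ∈ᶜ L v
      along (nil _) m = m
      along {u} {c = c} (cons {w = w} p e r) m with c ∈ᶜ? L w
      ... | yes m′ = along r m′
      ... | no m′ = ⊥-elim (agree u (w , (p , Path-start r) , e , c , m , m′))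

-- Leaf blocks

-- A search over a disjunction in which `B` need not be the negation of `A`, so no decision
-- procedure for `A` is required.
search-all : ∀ {n} {A B : Fin n → Set} → (∀ v → A v ⊎ B v) → ∃ A ⊎ (∀ v → B v)
search-all {zero} h = inj₂ λ ()
search-all {suc n} h with h fzero | search-all (h ∘ fsuc)
... | inj₁ a | _ = inj₁ (fzero , a)
... | inj₂ _ | inj₁ (v , a) = inj₁ (fsuc v , a)
... | inj₂ b | inj₂ r = inj₂ λ { fzero → b ; (fsuc v) → r v }

module Leaves (G : Graph n) where
  open OnGraph G
  open Brooks G

  -- An end block `B` of `C` attached at `x₀`. If `C` has no cut vertex, then `B` is all of `C` and
  -- `x₀` is just a chosen root.
  record Leaf (C : VSet n) : Set where
    field
      {x₀ d}     : Fin n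
      B          : VSet n
      x₀∈        : x₀ ∈ B
      B⊆         : B ⊆ C
      no-cut     : NoCut B
      d∈         : d ∈ B
      d≢         : d ≢ x₀
      closed     : ∀ {u v} → u ∈ B → u ≢ x₀ → v ∈ C → E G u v → v ∈ B
      to-x₀      : ∀ {v} → v ∈ C → v ∉ B - x₀ → Path (C ∖ (B - x₀)) v x₀
      conn-minus : ∀ {u} → u ∈ B → u ≢ x₀ → Conn (C - u)

  module _ {C : VSet n} (cC : Conn C) where

    private
      record Branch (x₀ : Fin n) (D : VSet n) : Set where
        field
          x₀∈    : x₀ ∈ C
          {d}    : Fin n
          d∈     : d ∈ D
          D⊆     : D ⊆ C - x₀
          conn   : Conn D
          closed : Closed (C - x₀) D

    module AtBranch {x₀ D} (br : Branch x₀ D) where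
      open Branch br

      B : VSet n
      B = D ∪ ｛ x₀ ｝

      x₀∈B : x₀ ∈ B
      x₀∈B = ∪-in (inj₂ ｛｝-in)

      x₀∉D : x₀ ∉ D
      x₀∉D p = proj₂ (minus-out (D⊆ p)) refl

      D≢ : ∀ {v} → v ∈ B → v ≢ x₀ → v ∈ D
      D≢ p ne with ∪-out p
      ... | inj₁ q = q
      ... | inj₂ q = ⊥-elim (ne (｛｝-out q))

      B⊆C : B ⊆ C
      B⊆C p with ∪-out p
      ... | inj₁ q = minus⊆ (D⊆ q)
      ... | inj₂ q = ｛｝⊆ x₀∈ q

      closedB : ∀ {u v} → u ∈ B → u ≢ x₀ → v ∈ C → E G u v → v ∈ B
      closedB {u} {v} p ne q e with v ≟F x₀
      ... | yes refl = x₀∈B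
      ... | no r = ∪-in (inj₁ (closed (D≢ p ne) (minus-in q r) e))

      conn-B : Conn B
      conn-B with first-entry (C ∖ D) (cC (minus⊆ (D⊆ d∈)) x₀∈) (λ p → proj₂ (∖-out p) d∈) (∖-in x₀∈ x₀∉D)
      ... | a , b , path , _ , b∈ , e with a ∈? D | b ≟F x₀
      ... | yes a∈ | yes refl = Conn-∪ conn Conn-｛｝ a∈ ｛｝-in e
      ... | yes a∈ | no ne = ⊥-elim (proj₂ (∖-out b∈) (closed a∈ (minus-in (∖⊆ b∈) ne) e))
      ... | no a∉ | _ = let p , q = ∖-out (Path-end path) in ⊥-elim (q (∖-in p a∉))

      to-root : ∀ {v} → Path C v x₀ → v ∉ D → Path (C ∖ D) v x₀
      to-root (nil p) q = nil (∖-in p q)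
      to-root (cons {u} {w} p e r) q with u ≟F x₀
      ... | yes refl = nil (∖-in p q)
      ... | no ne = cons (∖-in p q) e (to-root r λ w∈ → q (closed w∈ (minus-in p ne) (E-sym e)))

      Smaller : Fin n → Set
      Smaller u = u ∈ D × Σ (VSet n) λ D′ → Branch u D′ × ∣ D′ ∣ < ∣ D ∣

      -- If `B` falls apart without `u`, a part that misses `x₀` has no neighbours outside `B`. It
      -- is therefore a component of `C` without `u`, and lies in `D` without `u`, so it is a
      -- smaller branch. A smallest branch thus yields a leaf block.
      inspect : ∀ u → Smaller u ⊎ (u ∈ D → Conn (B - u))
      inspect u with u ∈? D
      ... | no u∉ = inj₂ (⊥-elim ∘ u∉)
      ... | yes u∈ with component {B - u} {x₀} (minus-in x₀∈B (∈-≢ u∈ x₀∉D ∘ esym))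
      ... | K with find (λ v → (v ∈? B - u) ×-dec ¬? (v ∈? Component.set K))
      ... | inj₂ all = inj₂ λ _ → Conn-≐ (Component.sub K) covers (Component.conn K)
        where
        covers : B - u ⊆ Component.set K
        covers {v} p with v ∈? Component.set K
        ... | yes q = q
        ... | no q = ⊥-elim (all v (p , q))
      ... | inj₁ (v , v∈ , v∉) with component {B - u} {v} v∈
      ... | K′ = inj₁ (u∈ , K′.set , record
        { x₀∈ = minus⊆ (D⊆ u∈) ; d∈ = K′.root
        ; D⊆ = λ p → let a , b = minus-out (K′.sub p) in minus-in (B⊆C a) b
        ; conn = K′.conn
        ; closed = λ p q e → let a , _ = minus-out (K′.sub p) ; c , d = minus-out q in
            K′.closed p (minus-in (closedB a (∈-≢ p x₀∉) c e) d) e }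
        , ∣∣-< inD u∈ (λ p → proj₂ (minus-out (K′.sub p)) refl))
        where
        module K′ = Component K′
        x₀∉ : x₀ ∉ K′.set
        x₀∉ p = v∉ (Closed-end (Component.closed K) (Component.root K) (Path-mono K′.sub (K′.conn p K′.root)))
        inD : K′.set ⊆ D
        inD p = D≢ (minus⊆ (K′.sub p)) (∈-≢ p x₀∉)

      as-leaf : (∀ u → u ∈ D → Conn (B - u)) → Leaf C
      as-leaf h = record
        { B = B ; x₀∈ = x₀∈B ; B⊆ = B⊆C
        ; no-cut = conn-B , λ {w} p → cut w p
        ; d∈ = ∪-in (inj₁ d∈) ; d≢ = ∈-≢ d∈ x₀∉D ; closed = closedB
        ; to-x₀ = λ p q → Path-mono D⇐ (to-root (cC p x₀∈) (q ∘ inc))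
        ; conn-minus = minus }
        where
        inc : D ⊆ B - x₀
        inc p = minus-in (∪-in (inj₁ p)) (∈-≢ p x₀∉D)
        D⇐ : C ∖ D ⊆ C ∖ (B - x₀)
        D⇐ p = let a , b = ∖-out p in ∖-in a λ q → let c , d = minus-out q in b (D≢ c d)
        cut : ∀ w → w ∈ B → Conn (B - w)
        cut w p with w ≟F x₀
        ... | no ne = h w (D≢ p ne)
        ... | yes refl = Conn-≐ inc (λ q → let a , b = minus-out q in D≢ a b) conn
        minus : ∀ {u} → u ∈ B → u ≢ x₀ → Conn (C - u)
        minus {u} u∈ ne = star-conn {r = x₀} λ {v} p → case v ∈? D of λ where
          (yes q) → Path-mono (λ z → let a , b = minus-out z in minus-in (B⊆C a) b)
            (h u (D≢ u∈ ne) (minus-in (∪-in (inj₁ q)) (proj₂ (minus-out p))) (minus-in x₀∈B (≢-sym ne)))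
          (no q) → Path-mono (λ z → let a , b = ∖-out z in minus-in a λ { refl → b (D≢ u∈ ne) })
            (to-root (cC (minus⊆ p) x₀∈) q)

    descend : ∀ m {x₀ D} → Branch x₀ D → ∣ D ∣ < m → Leaf C
    descend (suc m) br lt with search-all (AtBranch.inspect br)
    ... | inj₁ (_ , _ , _ , br′ , lt′) = descend m br′ (<-≤-trans lt′ (s≤s⁻¹ lt))
    ... | inj₂ h = AtBranch.as-leaf br h

    leaf : ∀ {x y} → x ∈ C → y ∈ C → x ≢ y → Leaf C
    leaf {x} {y} x∈ y∈ ne with component {C - x} {y} (minus-in y∈ (≢-sym ne))
    ... | K = descend _ (record
      { x₀∈ = x∈ ; d∈ = K.root ; D⊆ = K.sub ; conn = K.conn ; closed = K.closed }) ≤-refl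
      where module K = Component K

-- Colouring the components of low vertices

module Extension (G : Graph n) (Low : VSet n) (k : ℕ) (8≤k : 8 ≤ k)
  (low-deg : ∀ {U v} → v ∈ Low → OnGraph.degIn G U v < k) (free : ∀ {M} → Minors.Free G M) where
  open OnGraph G
  open Brooks G
  open Minors G using (model; Apart)
  open Leaves G using (Leaf; leaf)

  degIn-∪ : ∀ {S T U v} → (∀ {u} → u ∈ U → E G v u → u ∈ S ⊎ u ∈ T) → degIn U v ≤ degIn S v + degIn T v
  degIn-∪ {S} {T} {U} {v} h = subst (degIn U v ≤_) (length-++ (nb S v))
    (unique⊆⇒length≤ _≟F_ (nb-unique U v) λ m → let u∈ , e = nb-out m in case h u∈ e of λ where
      (inj₁ s) → ∈-++⁺ˡ (nb-in s e)
      (inj₂ t) → ∈-++⁺ʳ (nb S v) (nb-in t e))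

  -- `apart` is the distance hypothesis in the form in which it is used: all low neighbours of a
  -- high vertex lie in one low component. Until that component is coloured the vertex has `k`
  -- colours, afterwards five suffice. `slack` replaces the existence of a high neighbour: a low
  -- component may lose all of them, provided that a surplus colour makes up for it.
  record Inv (U : VSet n) (L : Lists) : Set where
    field
      apart     : ∀ {t a b} → t ∈ U → t ∉ Low → a ∈ U ∩ Low → b ∈ U ∩ Low → E G t a → E G t b →
                  Path (U ∩ Low) a b
      low-size  : ∀ {v} → v ∈ U → v ∈ Low → degIn U v ≤ size (L v)
      high-size : ∀ {v} → v ∈ U → v ∉ Low → 5 ≤ size (L v)
      near-size : ∀ {v a} → v ∈ U → v ∉ Low → a ∈ U ∩ Low → E G v a → k ≤ size (L v)
      slack     : ∀ {v} → v ∈ U ∩ Low → ∃ λ r → Path (U ∩ Low) v r × degIn (U ∩ Low) r < size (L r)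

  module AtComponent {U L} (I : Inv U L) (ih : ∀ {U′ L′} → Inv U′ L′ → ∣ U′ ∣ < ∣ U ∣ → Col U′ L′)
    {c₀} (K : Component (U ∩ Low) c₀) where
    open Inv I
    open Col
    open Component K renaming (set to C; root to c₀∈; sub to C⊆UL; closed to C-closed; conn to C-conn)

    C⊆U : C ⊆ U
    C⊆U p = proj₁ (∩-out (C⊆UL p))

    C⊆Low : C ⊆ Low
    C⊆Low p = proj₂ (∩-out (C⊆UL p))

    High : Fin n → Set
    High v = v ∈ U × v ∉ Low

    low-neighbour : ∀ {u v} → u ∈ C → v ∈ U → v ∈ Low → E G u v → v ∈ C
    low-neighbour p q r = C-closed p (∩-in q r)

    high-neighbour : ∀ {u v} → u ∈ C → v ∈ U ∖ C → E G u v → High v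
    high-neighbour p q e = ∖⊆ q , λ r → proj₂ (∖-out q) (low-neighbour p (∖⊆ q) r e)

    High⇒∉C : ∀ {v} → High v → v ∈ U ∖ C
    High⇒∉C (p , q) = ∖-in p (q ∘ C⊆Low)

    one-component : ∀ {t a b} → High t → a ∈ C → b ∈ U ∩ Low → E G t a → E G t b → b ∈ C
    one-component (p , q) a∈ b∈ e e′ = Closed-end C-closed a∈ (apart p q (C⊆UL a∈) b∈ e e′)

    away : ∀ {u v} → u ∉ C → Path (U ∩ Low) u v → Path ((U ∖ C) ∩ Low) u v
    away p r = Path-mono (λ z → let a , b = ∖-out z ; c , d = ∩-out a in ∩-in (∖-in c b) d)
      (Path-avoid C-closed p r)

    -- Everything but `C` is coloured first, with `F w` forbidden at each high neighbour `w` of `C`.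
    -- Such a `w` has no low neighbours outside `C`, so `near-size` asks nothing of it any more and
    -- five colours are enough.
    module Finish (F : Fin n → List ℕ)
      (short : ∀ {w a} → High w → a ∈ C → E G w a → length (F w) + 5 ≤ k) where

      near? : Decidable (λ w → w ∉ Low × ∃ λ a → a ∈ C × E G w a)
      near? w = ¬? (w ∈? Low) ×-dec any? (λ a → (a ∈? C) ×-dec E? w a)

      L′ : Lists
      L′ w with near? w
      ... | yes _ = L w ∖ᶜ F w
      ... | no _ = L w

      L′-low : ∀ {w} → w ∈ Low → L′ w ≡ L w
      L′-low {w} p with near? w
      ... | yes (q , _) = ⊥-elim (q p)
      ... | no _ = refl

      L′-near : ∀ {w a} → w ∉ Low → a ∈ C → E G w a → L′ w ≡ L w ∖ᶜ F w
      L′-near {w} p q e with near? w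
      ... | yes _ = refl
      ... | no r = ⊥-elim (r (p , _ , q , e))

      L′⊆ : ∀ {w c} → c ∈ᶜ L′ w → c ∈ᶜ L w
      L′⊆ {w} m with near? w
      ... | yes _ = proj₁ (∖ᶜ-out {L w} m)
      ... | no _ = m

      inv′ : Inv (U ∖ C) L′
      inv′ = record
        { apart = λ t∈ t∉ a∈ b∈ e e′ → let a , b = ∩-out a∈ in
            away (proj₂ (∖-out a)) (apart (∖⊆ t∈) t∉ (up a∈) (up b∈) e e′)
        ; low-size = λ {v} p q → subst (λ l → degIn (U ∖ C) v ≤ size l) (esym (L′-low q))
            (≤-trans (degIn-mono (λ z _ → ∖⊆ z)) (low-size (∖⊆ p) q))
        ; high-size = high
        -- A high vertex with a low neighbour outside `C` has none in `C`, so its list is untouched.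
        ; near-size = λ {v} {b} p q b∈ e → subst (k ≤_)
            (cong size (esym (far p q λ a∈ e′ →
              proj₂ (∖-out (proj₁ (∩-out b∈))) (one-component (∖⊆ p , q) a∈ (up b∈) e′ e))))
            (near-size (∖⊆ p) q (up b∈) e)
        ; slack = λ {v} p → let r , path , lt = slack (up p)
                                path′ = away (proj₂ (∖-out (proj₁ (∩-out p)))) path in
            r , path′ , subst (λ l → degIn ((U ∖ C) ∩ Low) r < size l)
              (esym (L′-low (proj₂ (∩-out (Path-end path)))))
              (≤-<-trans (degIn-mono (λ z _ → up z)) lt) }
        where
        open ≤-Reasoning
        up : ∀ {v} → v ∈ (U ∖ C) ∩ Low → v ∈ U ∩ Low
        up p = let a , b = ∩-out p in ∩-in (∖⊆ a) b
        far : ∀ {w} → w ∈ U ∖ C → w ∉ Low → (∀ {a} → a ∈ C → ¬ E G w a) → L′ w ≡ L w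
        far {w} _ _ h with near? w
        ... | yes (_ , _ , p , e) = ⊥-elim (h p e)
        ... | no _ = refl
        high : ∀ {w} → w ∈ U ∖ C → w ∉ Low → 5 ≤ size (L′ w)
        high {w} p q with near? w
        ... | no _ = high-size (∖⊆ p) q
        ... | yes (_ , a , a∈ , e) = +-cancelˡ-≤ (length (F w)) 5 _ (begin
          length (F w) + 5 ≤⟨ short (∖⊆ p , q) a∈ e ⟩
          k ≤⟨ near-size (∖⊆ p) q (C⊆UL a∈) e ⟩
          size (L w) ≤⟨ ∖ᶜ-size (L w) (F w) ⟩
          size (L w ∖ᶜ F w) + length (F w) ≡⟨ +-comm _ (length (F w)) ⟩
          length (F w) + size (L w ∖ᶜ F w) ∎)

      rest : Col (U ∖ C) L
      rest = Col-lists (λ _ → L′⊆) c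
        where
        c : Col (U ∖ C) L′
        c = ih inv′ (∖-< (C⊆U c₀∈) c₀∈)

      f : Fin n → ℕ
      f = φ rest

      avoids : ∀ {w a} → High w → a ∈ C → E G w a → f w ∉ₗ F w
      avoids {w} {a} (p , q) a∈ e = proj₂ (∖ᶜ-out {L w} (subst (f w ∈ᶜ_) (L′-near q a∈ e)
        (chosen (ih inv′ (∖-< (C⊆U c₀∈) c₀∈)) (High⇒∉C (p , q)))))

      LC : Lists
      LC = res f (U ∖ C) L

      LC-deg : ∀ {v} → v ∈ C → degIn C v ≤ size (LC v)
      LC-deg p = res-deg f {U = U} {L = L} (λ q _ → ∖⊆ q) (λ q _ → C⊆U q)
        (λ q r → proj₂ (∖-out q) r) (low-size (C⊆U p) (C⊆Low p))

      LC-spare : ∀ {v w} → v ∈ C → w ∈ U ∖ C → E G v w →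
        (f w ∉ᶜ L v ⊎ ∃ λ w′ → w′ ∈ U ∖ C × w′ ≢ w × E G v w′ × f w′ ≡ f w) → degIn U v ≤ size (L v) →
        degIn C v < size (LC v)
      LC-spare {v} v∈ w∈ e h le = +-cancelʳ-< (degIn (U ∖ C) v) _ _ (begin-strict
        degIn C v + degIn (U ∖ C) v
          ≤⟨ degIn-+ (λ q _ → C⊆U q) (λ q _ → ∖⊆ q) (λ q r → proj₂ (∖-out r) q) ⟩
        degIn U v ≤⟨ le ⟩
        size (L v) <⟨ res-size-spare w∈ e h ⟩
        size (LC v) + degIn (U ∖ C) v ∎)
        where open ≤-Reasoning

      done : Col C LC → Col U L
      done c = merge rest c (∖-cover C)

      surplus : ∀ {v} → v ∈ C → degIn C v < size (LC v) → Col U L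
      surplus p lt = done (greedy C-conn p LC-deg lt)

    module NoRemoval = Finish (λ _ → []) (λ _ _ _ → ≤-trans (m≤m+n 5 3) 8≤k)

    surplus-vertex : ∀ {v} → v ∈ C → degIn U v < size (L v) → Col U L
    surplus-vertex p lt = NoRemoval.surplus p (res-deg< NoRemoval.f {U = U} {L = L} (λ q _ → ∖⊆ q)
      (λ q _ → C⊆U q) (λ q r → proj₂ (∖-out q) r) lt)

    3+5≤k : ∀ {m} → m ≤ 3 → m + 5 ≤ k
    3+5≤k h = ≤-trans (+-monoˡ-≤ 5 h) 8≤k

    take-⊆ : ∀ m (l : List ℕ) {c} → c ∈ₗ take m l → c ∈ₗ l
    take-⊆ m l p = subst (_ ∈ₗ_) (take++drop≡id m l) (∈-++⁺ˡ p)

    -- Three colours of x forbidden on its high neighbours outnumber its neighbours in C.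
    reserve : ∀ {x t} → x ∈ C → High t → E G x t → degIn C x ≤ 2 → Col U L
    reserve {x} {t} x∈ ht e le = surplus x∈ (<-≤-trans lt
        (unique⊆⇒length≤ _≟_ {A₀} {Colours.list (LC x)} (UniqueP.take⁺ 3 (Colours.unique (L x))) kept))
      where
      A₀ = take 3 (Colours.list (L x))
      F : Fin n → List ℕ
      F w with E? w x
      ... | yes _ = A₀
      ... | no _ = []
      len-A : length A₀ ≤ 3
      len-A = subst (_≤ 3) (esym (length-take 3 (Colours.list (L x)))) (m⊓n≤m 3 _)
      F-len : ∀ w → length (F w) ≤ 3
      F-len w with E? w x
      ... | yes _ = len-A
      ... | no _ = z≤n
      F-at : ∀ {w} → E G w x → F w ≡ A₀
      F-at {w} p with E? w x
      ... | yes _ = refl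
      ... | no q = ⊥-elim (q p)
      open Finish F (λ {w} _ _ _ → 3+5≤k (F-len w))
      kept : ∀ {c} → c ∈ₗ A₀ → c ∈ₗ Colours.list (LC x)
      kept p = res-in (take-⊆ 3 (Colours.list (L x)) p) λ {u} u∈ e′ eq →
        avoids (high-neighbour x∈ u∈ e′) x∈ (E-sym e′)
          (subst (_∈ₗ F u) (esym eq) (subst (_ ∈ₗ_) (esym (F-at (E-sym e′))) p))
      -- `A₀` may have fewer than three colours, but then it is the whole list, which is longer than
      -- the degree in `C` because of the high neighbour `t`.
      lt : degIn C x < length A₀
      lt = subst (degIn C x <_) (esym (length-take 3 (Colours.list (L x)))) (⊓-glb (s≤s le)
        (≤-trans (begin-strict
          degIn C x <⟨ m<m+n _ (degIn-pos (High⇒∉C ht) e) ⟩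
          degIn C x + degIn (U ∖ C) x
            ≤⟨ degIn-+ (λ q _ → C⊆U q) (λ q _ → ∖⊆ q) (λ q r → proj₂ (∖-out r) q) ⟩
          degIn U x ∎) (low-size (C⊆U x∈) (C⊆Low x∈))))
        where open ≤-Reasoning

    -- With no high neighbours, `z` takes colours only from vertices of `C`, and `C` stays connected
    -- without it. The vertex providing `slack` is not `z`: all neighbours of `z` are low and its
    -- list is no longer than its degree.
    peel : ∀ {z y} → z ∈ C → y ∈ C → y ≢ z → Conn (C - z) → (∀ {t} → High t → ¬ E G z t) →
           size (L z) ≤ degIn U z → Col U L
    peel {z} {y} z∈ y∈ y≢z conn-z no-high tight =
      merge (single-col {z} {L} c∈) (ih inv′ (minus-< (C⊆U z∈)))
        (minus-cover z)
      where
      open ≤-Reasoning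
      z-edge : ∃ λ v → v ∈ U × E G z v
      z-edge with C-conn z∈ y∈
      ... | nil _ = ⊥-elim (y≢z refl)
      ... | cons _ e r = _ , C⊆U (Path-start r) , e
      pk = pick (L z) (≤-trans (degIn-pos (proj₁ (proj₂ z-edge)) (proj₂ (proj₂ z-edge)))
                               (low-size (C⊆U z∈) (C⊆Low z∈)))
      c = proj₁ pk
      c∈ : c ∈ᶜ L z
      c∈ = proj₂ pk
      L′ = res (λ _ → c) ｛ z ｝ L
      up : ∀ {v} → v ∈ (U - z) ∩ Low → v ∈ U ∩ Low
      up p = let a , b = ∩-out p in ∩-in (minus⊆ a) b
      z-sub : ∀ {v u} → u ∈ ｛ z ｝ → E G v u → u ∈ U
      z-sub p _ = ｛｝⊆ (C⊆U z∈) p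
      z-dis : ∀ {u} → u ∈ ｛ z ｝ → u ∈ U - z → ⊥
      z-dis p q = proj₂ (minus-out q) (｛｝-out p)
      keep : ∀ {w} → High w → size (L w) ≤ size (L′ w)
      keep {w} hw = subst (size (L w) ≤_) (trans (cong (size (L′ w) +_) none-z) (+-identityʳ _))
        (res-size (λ _ → c) ｛ z ｝ L w)
        where
        none-z : degIn ｛ z ｝ w ≡ 0
        none-z = degIn-zero λ p e → no-high hw (E-sym (subst (E G w) (｛｝-out p) e))
      inC : ∀ {u} → u ∈ C - z → u ∈ (U - z) ∩ Low
      inC p = let a , b = minus-out p in ∩-in (minus-in (C⊆U a) b) (C⊆Low a)
      off : ∀ {u v} → u ∉ C → Path (U ∩ Low) u v → Path ((U - z) ∩ Low) u v
      off p r = Path-mono (λ q → let a , b = ∩-out q ; c , d = ∖-out a in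
        ∩-in (minus-in c (λ { refl → d z∈ })) b) (away p r)
      low-path : ∀ {a b} → a ∈ (U - z) ∩ Low → b ≢ z → Path (U ∩ Low) a b → Path ((U - z) ∩ Low) a b
      low-path {a} {b} p q r with a ∈? C
      ... | no a∉ = off a∉ r
      ... | yes a∈ = Path-mono inC (conn-z (minus-in a∈ (proj₂ (minus-out (proj₁ (∩-out p)))))
            (minus-in (Closed-end C-closed a∈ r) q))
      z-no-slack : ¬ degIn (U ∩ Low) z < size (L z)
      z-no-slack lt = <⇒≱ lt (≤-trans tight (degIn-mono λ {u} u∈ e → case u ∈? Low of λ where
        (yes q) → ∩-in u∈ q
        (no q) → ⊥-elim (no-high (u∈ , q) e)))
      inv′ : Inv (U - z) L′
      inv′ = record
        { apart = λ t∈ t∉ a∈ b∈ e e′ → low-path a∈ (proj₂ (minus-out (proj₁ (∩-out b∈))))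
            (apart (minus⊆ t∈) t∉ (up a∈) (up b∈) e e′)
        ; low-size = λ p q → res-deg (λ _ → c) {U = U} {L = L} z-sub (λ r _ → minus⊆ r) z-dis
            (low-size (minus⊆ p) q)
        ; high-size = λ p q → ≤-trans (high-size (minus⊆ p) q) (keep (minus⊆ p , q))
        ; near-size = λ p q a∈ e → ≤-trans (near-size (minus⊆ p) q (up a∈) e) (keep (minus⊆ p , q))
        ; slack = λ p → let r , path , lt = slack (up p) in
            r , low-path p (λ e → z-no-slack (subst (λ w → degIn (U ∩ Low) w < size (L w)) e lt)) path
              , res-deg< (λ _ → c) {U = U ∩ Low} {L = L}
                  (λ q _ → ｛｝⊆ (C⊆UL z∈) q) (λ q _ → up q)
                  (λ q r → z-dis q (proj₁ (∩-out r))) lt }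

    neighbour : ∀ {S v} → 0 < degIn S v → ∃ λ u → u ∈ S × E G v u
    neighbour {S} {v} lt with find (λ u → (u ∈? S) ×-dec E? v u)
    ... | inj₁ r = r
    ... | inj₂ h = ⊥-elim (<-irrefl (esym (degIn-zero λ p e → h _ (p , e))) lt)

    High? : Decidable High
    High? v = (v ∈? U) ×-dec ¬? (v ∈? Low)

    module AtLeaf (tight : ∀ {v} → v ∈ C → size (L v) ≤ degIn U v)
      (big : ∀ {x t} → x ∈ C → High t → E G x t → 3 ≤ degIn C x) (lf : Leaf C) where

      open Leaf lf

      D : VSet n
      D = B - x₀

      D⊆B : D ⊆ B
      D⊆B = minus⊆

      D⊆C : D ⊆ C
      D⊆C p = B⊆ (D⊆B p)

      D≢x₀ : ∀ {v} → v ∈ D → v ≢ x₀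
      D≢x₀ p = proj₂ (minus-out p)

      deg-B : ∀ {v} → v ∈ D → degIn C v ≤ degIn B v
      deg-B p = degIn-mono (λ q e → closed (D⊆B p) (D≢x₀ p) q e)

      -- Leaf blocks that are complete on four vertices

      module Quad (high-at : ∀ {v} → v ∈ D → ∃ λ t → High t × E G v t) (complete : Complete B)
        {x₁ x₂ x₃} (x₁∈D : x₁ ∈ D) (x₂∈D : x₂ ∈ D) (x₃∈D : x₃ ∈ D)
        (x₁≢x₂ : x₁ ≢ x₂) (x₁≢x₃ : x₁ ≢ x₃) (x₂≢x₃ : x₂ ≢ x₃) (K₀ : Component (U ∖ D) x₀) where

        d∈₁ : x₁ ∈ B
        d∈₁ = D⊆B x₁∈D

        everything : VSet n
        everything = ⟦ (λ w → w ≟F w) ⟧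

        in-everything : ∀ {v} → v ∈ everything
        in-everything = ⟦⟧-in (λ w → w ≟F w) refl

        single : ∀ {u} → (｛ u ｝ ⊆ everything) × Conn ｛ u ｝
        single = (λ _ → in-everything) , Conn-｛｝

        point : ∀ {u v} → E G u v → Apart ｛ u ｝ ｛ v ｝
        point e = (λ p q → E-irrefl e (trans (esym (｛｝-out p)) (｛｝-out q))) , _ , _ , ｛｝-in , ｛｝-in , e

        four : ∀ {v} → v ∈ B → v ≡ x₀ ⊎ v ≡ x₁ ⊎ v ≡ x₂ ⊎ v ≡ x₃
        four {v} v∈ with v ≟F x₀ | v ≟F x₁ | v ≟F x₂ | v ≟F x₃
        ... | yes p | _ | _ | _ = inj₁ p
        ... | _ | yes p | _ | _ = inj₂ (inj₁ p)
        ... | _ | _ | yes p | _ = inj₂ (inj₂ (inj₁ p))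
        ... | _ | _ | _ | yes p = inj₂ (inj₂ (inj₂ p))
        ... | no p | no q | no r | no s = ⊥-elim (free {everything} (model
          (single ∷ single ∷ single ∷ single ∷ single ∷ [])
          ((point (complete v∈ x₀∈ p) ∷ point (complete v∈ d∈₁ q) ∷ point (complete v∈ (D⊆B x₂∈D) r) ∷
              point (complete v∈ (D⊆B x₃∈D) s) ∷ []) ∷
           (point (complete x₀∈ d∈₁ (≢-sym (D≢x₀ x₁∈D))) ∷ point (complete x₀∈ (D⊆B x₂∈D) (≢-sym (D≢x₀ x₂∈D))) ∷
              point (complete x₀∈ (D⊆B x₃∈D) (≢-sym (D≢x₀ x₃∈D))) ∷ []) ∷
           (point (complete d∈₁ (D⊆B x₂∈D) x₁≢x₂) ∷ point (complete d∈₁ (D⊆B x₃∈D) x₁≢x₃) ∷ []) ∷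
           (point (complete (D⊆B x₂∈D) (D⊆B x₃∈D) x₂≢x₃) ∷ []) ∷ [] ∷ [])))

        module K₀ = Component K₀

        C∖D⊆K₀ : ∀ {v} → v ∈ C → v ∉ D → v ∈ K₀.set
        C∖D⊆K₀ p q = Closed-end K₀.closed K₀.root (Path-sym (Path-mono
          (λ z → let a , b = ∖-out z in ∖-in (C⊆U a) b) (to-x₀ p q)))

        -- D separates the high vertex w from x₀: colour the side of x₀ first. This leaves D
        -- with the slack provided by w.
        beyond : ∀ {w a} → High w → a ∈ D → E G w a → w ∉ K₀.set → Col U L
        beyond {w} {a} (w∈U , w∉Low) a∈ w~a w∉ = merge c (ih inv₁ (∖-< (∖⊆ (K₀.sub K₀.root)) K₀.root)) (cover-∖ K₀.set)
          where
          open ≤-Reasoning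
          K⊆U : K₀.set ⊆ U
          K⊆U p = ∖⊆ (K₀.sub p)
          up₀ : ∀ {v} → v ∈ K₀.set ∩ Low → v ∈ U ∩ Low
          up₀ p = let a , b = ∩-out p in ∩-in (K⊆U a) b
          outer : VSet n
          outer = (U ∖ C) ∩ Low
          outer-closed : Closed outer K₀.set
          outer-closed p q e = let a , _ = ∩-out q ; b , c = ∖-out a in K₀.closed p (∖-in b (c ∘ D⊆C)) e
          path₀ : ∀ {u v} → u ∈ K₀.set ∩ Low → v ∈ K₀.set ∩ Low → Path (U ∩ Low) u v → Path (K₀.set ∩ Low) u v
          path₀ {u} p q r with u ∈? C
          ... | no u∉ = Path-mono (λ z → let a , b = ∩-out z in ∩-in b (proj₂ (∩-out a)))
                (Path-closed outer-closed (proj₁ (∩-out p)) (away u∉ r))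
          ... | yes u∈ = Path-mono inner (to-x₀ u∈ (off-D p)) ◅◅
                Path-sym (Path-mono inner (to-x₀ (Closed-end C-closed u∈ r) (off-D q)))
            where
            inner : C ∖ D ⊆ K₀.set ∩ Low
            inner z = let a , b = ∖-out z in ∩-in (C∖D⊆K₀ a b) (C⊆Low a)
            off-D : ∀ {v} → v ∈ K₀.set ∩ Low → v ∉ D
            off-D z = proj₂ (∖-out (K₀.sub (proj₁ (∩-out z))))
          x₀∈L : x₀ ∈ K₀.set ∩ Low
          x₀∈L = ∩-in K₀.root (C⊆Low (B⊆ x₀∈))
          -- The rest of `C` hangs together through `x₀`, whose list no longer has to pay for its
          -- neighbours in `D`.
          slack-x₀ : degIn (K₀.set ∩ Low) x₀ < size (L x₀)
          slack-x₀ = begin-strict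
            degIn (K₀.set ∩ Low) x₀ <⟨ m<m+n _ (degIn-pos x₁∈D (complete x₀∈ d∈₁ (≢-sym (D≢x₀ x₁∈D)))) ⟩
            degIn (K₀.set ∩ Low) x₀ + degIn D x₀
              ≤⟨ degIn-+ (λ p _ → K⊆U (proj₁ (∩-out p))) (λ p _ → C⊆U (D⊆C p))
                         (λ p q → proj₂ (∖-out (K₀.sub (proj₁ (∩-out p)))) q) ⟩
            degIn U x₀ ≤⟨ low-size (C⊆U (B⊆ x₀∈)) (C⊆Low (B⊆ x₀∈)) ⟩
            size (L x₀) ∎
          slack₁ : ∀ {v} → v ∈ K₀.set ∩ Low →
                   ∃ λ r → Path (K₀.set ∩ Low) v r × degIn (K₀.set ∩ Low) r < size (L r)
          slack₁ {v} p with v ∈? C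
          ... | yes v∈ = x₀ , path₀ p x₀∈L (Path-mono C⊆UL (C-conn v∈ (B⊆ x₀∈))) , slack-x₀
          ... | no v∉ = let r , path , lt = slack (up₀ p)
                            path′ = Path-closed outer-closed (proj₁ (∩-out p)) (away v∉ path)
                            r∈ = proj₂ (∩-out (Path-end path′)) in
            r , path₀ p (∩-in r∈ (proj₂ (∩-out (Path-end path)))) path
              , ≤-<-trans (degIn-mono (λ z _ → up₀ z)) lt
          inv₀ : Inv K₀.set L
          inv₀ = record
            { apart = λ t∈ t∉ a∈ b∈ e e′ → path₀ a∈ b∈ (apart (K⊆U t∈) t∉ (up₀ a∈) (up₀ b∈) e e′)
            ; low-size = λ p q → ≤-trans (degIn-mono (λ z _ → K⊆U z)) (low-size (K⊆U p) q)
            ; high-size = λ p → high-size (K⊆U p)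
            ; near-size = λ p q b∈ → near-size (K⊆U p) q (up₀ b∈)
            ; slack = slack₁ }
          c : Col K₀.set L
          c = ih inv₀ (∣∣-< K⊆U w∈U w∉)
          U₁ = U ∖ K₀.set
          L₁ = res (φ c) K₀.set L
          up₁ : ∀ {v} → v ∈ U₁ ∩ Low → v ∈ U ∩ Low
          up₁ p = let a , b = ∩-out p in ∩-in (∖⊆ a) b
          -- Only vertices of `D` have neighbours in the component of `x₀`, so all other lists keep
          -- their length.
          same : ∀ {v} → v ∈ U₁ → v ∉ D → size (L v) ≤ size (L₁ v)
          same {v} p q = subst (size (L v) ≤_)
            (trans (cong (size (L₁ v) +_) (degIn-zero λ z e →
              proj₂ (∖-out p) (K₀.closed z (∖-in (∖⊆ p) q) (E-sym e)))) (+-identityʳ _))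
            (res-size (φ c) K₀.set L v)
          in-D : ∀ {v} → v ∈ C → v ∈ U₁ → v ∈ D
          in-D {v} p q with v ∈? D
          ... | yes r = r
          ... | no r = ⊥-elim (proj₂ (∖-out q) (C∖D⊆K₀ p r))
          across-D : ∀ {u v} → u ∈ D → v ∈ D → u ∈ U₁ ∩ Low → v ∈ U₁ ∩ Low → Path (U₁ ∩ Low) u v
          across-D {u} {v} p q p′ q′ with u ≟F v
          ... | yes refl = nil p′
          ... | no ne = edge-path p′ q′ (complete (D⊆B p) (D⊆B q) ne)
          path₁ : ∀ {u v} → u ∈ U₁ ∩ Low → v ∈ U₁ ∩ Low → Path (U ∩ Low) u v → Path (U₁ ∩ Low) u v
          path₁ {u} p q r with u ∈? C
          ... | yes u∈ = across-D (in-D u∈ (proj₁ (∩-out p)))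
                (in-D (Closed-end C-closed u∈ r) (proj₁ (∩-out q))) p q
          ... | no u∉ = Path-mono
                (λ z → let a , b = ∖-out z ; c , d = ∩-out a in ∩-in (∖-in (∖⊆ c) b) d)
                (Path-avoid outer-closed (proj₂ (∖-out (proj₁ (∩-out p)))) (away u∉ r))
          w∈₁ : w ∈ U₁
          w∈₁ = ∖-in w∈U w∉
          a∈₁ : a ∈ U₁ ∩ Low
          a∈₁ = ∩-in (∖-in (C⊆U (D⊆C a∈)) (λ z → proj₂ (∖-out (K₀.sub z)) a∈)) (C⊆Low (D⊆C a∈))
          low₁ : ∀ {v} → v ∈ U₁ → v ∈ Low → degIn U₁ v ≤ size (L₁ v)
          low₁ p q = res-deg (φ c) {U = U} {L = L} (λ z _ → K⊆U z) (λ z _ → ∖⊆ z)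
            (λ y z → proj₂ (∖-out z) y) (low-size (∖⊆ p) q)
          slack-a : degIn (U₁ ∩ Low) a < size (L₁ a)
          slack-a = begin-strict
            degIn (U₁ ∩ Low) a <⟨ m<m+n _ (degIn-pos ｛｝-in (E-sym w~a)) ⟩
            degIn (U₁ ∩ Low) a + degIn ｛ w ｝ a
              ≤⟨ degIn-+ (λ p _ → proj₁ (∩-out p)) (λ p _ → ｛｝⊆ w∈₁ p)
                   (λ p q → w∉Low (subst (_∈ Low) (｛｝-out q) (proj₂ (∩-out p)))) ⟩
            degIn U₁ a ≤⟨ low₁ (proj₁ (∩-out a∈₁)) (proj₂ (∩-out a∈₁)) ⟩
            size (L₁ a) ∎
          slack₂ : ∀ {v} → v ∈ U₁ ∩ Low →
                   ∃ λ r → Path (U₁ ∩ Low) v r × degIn (U₁ ∩ Low) r < size (L₁ r)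
          slack₂ {v} p with v ∈? C
          ... | yes v∈ = a , across-D (in-D v∈ (proj₁ (∩-out p))) a∈ p a∈₁ , slack-a
          ... | no v∉ = let r , path , lt = slack (up₁ p)
                            path′ = Path-avoid outer-closed (proj₂ (∖-out (proj₁ (∩-out p)))) (away v∉ path)
                            s , r∉K = ∖-out (Path-end path′)
                            r∈U , r∉C = ∖-out (proj₁ (∩-out s)) in
            r , path₁ p (∩-in (∖-in r∈U r∉K) (proj₂ (∩-out s))) path
              , <-≤-trans (≤-<-trans (degIn-mono (λ z _ → up₁ z)) lt)
                          (same (∖-in r∈U r∉K) (r∉C ∘ D⊆C))
          inv₁ : Inv U₁ L₁
          inv₁ = record
            { apart = λ t∈ t∉ a∈ b∈ e e′ → path₁ a∈ b∈ (apart (∖⊆ t∈) t∉ (up₁ a∈) (up₁ b∈) e e′)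
            ; low-size = low₁
            ; high-size = λ p q → ≤-trans (high-size (∖⊆ p) q) (same p (q ∘ C⊆Low ∘ D⊆C))
            ; near-size = λ p q b∈ e → ≤-trans (near-size (∖⊆ p) q (up₁ b∈) e) (same p (q ∘ C⊆Low ∘ D⊆C))
            ; slack = slack₂ }

        module Near (near : ∀ {w a} → High w → a ∈ D → E G w a → w ∈ K₀.set) where

          -- The fifth bag is the component of `x₀` after `w` is removed. It touches the three
          -- vertices at `x₀`, and it touches `w` because `w` can be reached from `x₀` without
          -- passing through `D`. With four single vertices this is a K₅ minor.
          no-common : ∀ {w} → High w → E G w x₁ → E G w x₂ → E G w x₃ → ⊥
          no-common {w} hw e₁ e₂ e₃ with component {K₀.set - w} {x₀}
            (minus-in K₀.root λ { refl → proj₂ hw (C⊆Low (B⊆ x₀∈)) })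
          ... | M with first-entry ｛ w ｝ (K₀.conn K₀.root (near hw x₁∈D e₁))
                         (λ p → proj₂ hw (subst (_∈ Low) (｛｝-out p) (C⊆Low (B⊆ x₀∈)))) ｛｝-in
          ... | a , b , path , _ , b∈ , e = free {everything} (model
            (single ∷ single ∷ single ∷ single ∷ ((λ _ → in-everything) , M.conn) ∷ [])
            ((point (complete d∈₁ (D⊆B x₂∈D) x₁≢x₂) ∷ point (complete d∈₁ (D⊆B x₃∈D) x₁≢x₃) ∷
                point (E-sym e₁) ∷ toward x₁∈D ∷ []) ∷
             (point (complete (D⊆B x₂∈D) (D⊆B x₃∈D) x₂≢x₃) ∷ point (E-sym e₂) ∷ toward x₂∈D ∷ []) ∷
             (point (E-sym e₃) ∷ toward x₃∈D ∷ []) ∷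
             (((λ p q → proj₂ (minus-out (M.sub q)) (｛｝-out p))
               , w , a , ｛｝-in , a∈M , E-sym (subst (E G a) (｛｝-out b∈) e)) ∷ []) ∷
             [] ∷ []))
            where
            module M = Component M
            toward : ∀ {x} → x ∈ D → Apart ｛ x ｝ M.set
            toward p = (λ q r → proj₂ (∖-out (K₀.sub (minus⊆ (M.sub r))))
                (｛｝⊆ p q))
              , _ , x₀ , ｛｝-in , M.root , complete (D⊆B p) x₀∈ (D≢x₀ p)
            a∈M : a ∈ M.set
            a∈M = Closed-end M.closed M.root (Path-mono
              (λ z → let p , q = ∖-out z in minus-in p λ { refl → q ｛｝-in }) path)

          -- Forbidding `c` at the high neighbours of `a` keeps it available at `a`. As `b` never
          -- had it, `swap` applies.
          exchange : ∀ {a b c} → a ∈ D → b ∈ D → c ∈ᶜ L a → c ∉ᶜ L b → Col U L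
          exchange {a} {b} {c} a∈ b∈ c∈ c∉ = done (swap LC-deg (conn-minus (D⊆B a∈) (D≢x₀ a∈)) (D⊆C a∈) (D⊆C b∈)
              (complete (D⊆B a∈) (D⊆B b∈) λ { refl → c∉ c∈ }) c∈′ (c∉ ∘ proj₁ ∘ res-out))
            where
            F : Fin n → List ℕ
            F w with E? w a
            ... | yes _ = c ∷ []
            ... | no _ = []
            F-len : ∀ w → length (F w) ≤ 3
            F-len w with E? w a
            ... | yes _ = s≤s z≤n
            ... | no _ = z≤n
            F-at : ∀ {w} → E G w a → c ∈ₗ F w
            F-at {w} e with E? w a
            ... | yes _ = here refl
            ... | no q = ⊥-elim (q e)
            open Finish F (λ {w} _ _ _ → 3+5≤k (F-len w))
            c∈′ : c ∈ᶜ LC a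
            c∈′ = res-in c∈ λ {u} u∈ e eq → avoids (high-neighbour (D⊆C a∈) u∈ e) (D⊆C a∈) (E-sym e)
              (subst (_∈ₗ F u) (esym eq) (F-at (E-sym e)))

          module SameLists (same : ∀ {a b c} → a ∈ D → b ∈ D → c ∈ᶜ L a → c ∈ᶜ L b) where

            l A₀ R : List ℕ
            l = Colours.list (L x₁)
            A₀ = take 3 l
            R = drop 3 l

            A-len : length A₀ ≤ 3
            A-len = subst (_≤ 3) (esym (length-take 3 l)) (m⊓n≤m 3 _)

            A⊆ : ∀ {b c} → b ∈ D → c ∈ₗ A₀ → c ∈ᶜ L b
            A⊆ b∈ p = same x₁∈D b∈ (take-⊆ 3 l p)

            A-or-R : ∀ {c} → c ∈ᶜ L x₁ → c ∈ₗ A₀ ⊎ c ∈ₗ R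
            A-or-R {c} p = ∈-++⁻ A₀ (subst (c ∈ₗ_) (esym (take++drop≡id 3 l)) p)

            -- The two ways in which colours on the neighbours of `x₁` help. Either `x₁` has lost a
            -- colour of `A₀`, which the vertex `b` retains, and `swap` applies; or some neighbour
            -- costs `x₁` no colour, and `x₁` has a surplus.
            Outcome : (Fin n → ℕ) → Set
            Outcome f =
              (∃ λ u → u ∈ U ∖ C × E G x₁ u × f u ∈ₗ A₀) ⊎
              (∃ λ w → w ∈ U ∖ C × E G x₁ w ×
                 (f w ∉ᶜ L x₁ ⊎ ∃ λ w′ → w′ ∈ U ∖ C × w′ ≢ w × E G x₁ w′ × f w′ ≡ f w))

            -- High neighbours of b avoid A₀, the remaining ones of x₁ avoid R′. So if the lists
            -- left for x₁ and b are both minimal and equal, then both are A₀.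
            last-step : ∀ {b} R′ → b ∈ D → b ≢ x₁ → length R′ + 5 ≤ k →
              (∀ f → (∀ {u} → High u → E G x₁ u → ¬ E G b u → f u ∉ₗ R′) → Outcome f) → Col U L
            last-step {b} R′ b∈ b≢ R′-len decide = finish (decide f λ {u} hu e ¬e p →
                avoids hu (D⊆C x₁∈D) (E-sym e) (subst (f u ∈ₗ_) (esym (F-far (E-sym e) (¬e ∘ E-sym))) p))
              where
              F : Fin n → List ℕ
              F w with E? w b | E? w x₁
              ... | yes _ | _ = A₀
              ... | no _ | yes _ = R′
              ... | no _ | no _ = []
              F-short : ∀ w → length (F w) + 5 ≤ k
              F-short w with E? w b | E? w x₁
              ... | yes _ | _ = 3+5≤k A-len
              ... | no _ | yes _ = R′-len
              ... | no _ | no _ = ≤-trans (m≤m+n 5 3) 8≤k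
              F-near : ∀ {w} → E G w b → F w ≡ A₀
              F-near {w} e with E? w b
              ... | yes _ = refl
              ... | no q = ⊥-elim (q e)
              F-far : ∀ {w} → E G w x₁ → ¬ E G w b → F w ≡ R′
              F-far {w} e ¬e with E? w b | E? w x₁
              ... | yes q | _ = ⊥-elim (¬e q)
              ... | no _ | yes _ = refl
              ... | no _ | no q = ⊥-elim (q e)
              open Finish F (λ {w} _ _ _ → F-short w)
              finish : Outcome f → Col U L
              finish (inj₂ (w , w∈ , e , h)) = surplus (D⊆C x₁∈D) (LC-spare (D⊆C x₁∈D) w∈ e h
                (low-size (C⊆U (D⊆C x₁∈D)) (C⊆Low (D⊆C x₁∈D))))
              finish (inj₁ (u , u∈ , e , p)) = done (swap LC-deg (conn-minus (D⊆B b∈) (D≢x₀ b∈)) (D⊆C b∈)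
                (D⊆C x₁∈D) (complete (D⊆B b∈) d∈₁ b≢) in-b (λ q → proj₂ (res-out q) u∈ e refl))
                where
                in-b : f u ∈ᶜ LC b
                in-b = res-in (A⊆ b∈ p) λ {v} v∈ e′ eq →
                  avoids (high-neighbour (D⊆C b∈) v∈ e′) (D⊆C b∈) (E-sym e′)
                    (subst (_∈ₗ F v) (esym eq) (subst (f u ∈ₗ_) (esym (F-near (E-sym e′))) p))

            -- `R` is short enough to be forbidden entirely at `w`. The colour of `w` is then in
            -- `A₀` or off the list of `x₁`, and either helps.
            one-private : ∀ {b w} → length R ≤ 2 → b ∈ D → b ≢ x₁ → High w → E G x₁ w → ¬ E G b w → Col U L
            one-private {b} {w} R-len b∈ b≢ hw e ¬e = last-step R b∈ b≢ (3+5≤k (m≤n⇒m≤1+n R-len)) λ f av →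
              case f w ∈ᶜ? L x₁ of λ where
                (no p) → inj₂ (w , High⇒∉C hw , e , inj₁ p)
                (yes p) → case A-or-R p of λ where
                  (inj₁ q) → inj₁ (w , High⇒∉C hw , e , q)
                  (inj₂ q) → ⊥-elim (av hw e ¬e q)

            side : ∀ {w} → High w → E G x₁ w → ¬ E G x₂ w ⊎ ¬ E G x₃ w
            side {w} hw e with E? x₂ w | E? x₃ w
            ... | yes p | yes q = ⊥-elim (no-common hw (E-sym e) (E-sym p) (E-sym q))
            ... | no p | _ = inj₁ p
            ... | yes _ | no q = inj₂ q

            few : length R ≤ 2 → Col U L
            few R-len with high-at x₁∈D
            ... | w , hw , e with side hw e
            ...   | inj₁ p = one-private R-len x₂∈D (≢-sym x₁≢x₂) hw e p
            ...   | inj₂ p = one-private R-len x₃∈D (≢-sym x₁≢x₃) hw e p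

            -- `R` may be one colour too long to be forbidden, so `γ` stays allowed. If neither `w`
            -- nor `w′` helps on its own, both have colour `γ`, and the repetition saves a colour at
            -- `x₁`.
            two-private : ∀ {γ R′ b w w′} → R ≡ γ ∷ R′ → length R′ + 5 ≤ k → b ∈ D → b ≢ x₁ → w ≢ w′ →
              High w → E G x₁ w → ¬ E G b w → High w′ → E G x₁ w′ → ¬ E G b w′ → Col U L
            two-private {γ} {R′} {b} {w} {w′} R≡ len b∈ b≢ ne hw e ¬e hw′ e′ ¬e′ =
              last-step R′ b∈ b≢ len λ f av → case inspect f av hw e ¬e of λ where
                (inj₁ o) → o
                (inj₂ p) → case inspect f av hw′ e′ ¬e′ of λ where
                  (inj₁ o) → o
                  (inj₂ q) → inj₂ (w , High⇒∉C hw , e ,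
                    inj₂ (w′ , High⇒∉C hw′ , ≢-sym ne , e′ , trans q (esym p)))
              where
              inspect : ∀ f → (∀ {u} → High u → E G x₁ u → ¬ E G b u → f u ∉ₗ R′) →
                        ∀ {u} → High u → E G x₁ u → ¬ E G b u → Outcome f ⊎ f u ≡ γ
              inspect f av {u} hu eu ¬eu with f u ∈ᶜ? L x₁
              ... | no p = inj₁ (inj₂ (u , High⇒∉C hu , eu , inj₁ p))
              ... | yes p with A-or-R p
              ...   | inj₁ q = inj₁ (inj₁ (u , High⇒∉C hu , eu , q))
              ...   | inj₂ q with subst (f u ∈ₗ_) R≡ q
              ...     | here r = inj₂ r
              ...     | there r = ⊥-elim (av hu eu ¬eu r)

            Three-high : Set
            Three-high = ∃ λ w₁ → ∃ λ w₂ → ∃ λ w₃ → (w₁ ≢ w₂ × w₁ ≢ w₃ × w₂ ≢ w₃) ×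
              (High w₁ × E G x₁ w₁) × (High w₂ × E G x₁ w₂) × (High w₃ × E G x₁ w₃)

            -- Each of the three high neighbours of `x₁` misses `x₂` or `x₃`, so two of them miss
            -- the same one.
            many : ∀ {γ R′} → R ≡ γ ∷ R′ → length R′ + 5 ≤ k → Three-high → Col U L
            many R≡ len (w₁ , w₂ , w₃ , (n₁₂ , n₁₃ , n₂₃) , (h₁ , e₁) , (h₂ , e₂) , (h₃ , e₃))
              with side h₁ e₁ | side h₂ e₂ | side h₃ e₃
            ... | inj₁ p | inj₁ q | _ = two-private R≡ len x₂∈D (≢-sym x₁≢x₂) n₁₂ h₁ e₁ p h₂ e₂ q
            ... | inj₁ p | inj₂ _ | inj₁ q = two-private R≡ len x₂∈D (≢-sym x₁≢x₂) n₁₃ h₁ e₁ p h₃ e₃ q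
            ... | inj₁ _ | inj₂ p | inj₂ q = two-private R≡ len x₃∈D (≢-sym x₁≢x₃) n₂₃ h₂ e₂ p h₃ e₃ q
            ... | inj₂ p | inj₂ q | _ = two-private R≡ len x₃∈D (≢-sym x₁≢x₃) n₁₂ h₁ e₁ p h₂ e₂ q
            ... | inj₂ p | inj₁ _ | inj₂ q = two-private R≡ len x₃∈D (≢-sym x₁≢x₃) n₁₃ h₁ e₁ p h₃ e₃ q
            ... | inj₂ _ | inj₁ p | inj₁ q = two-private R≡ len x₂∈D (≢-sym x₁≢x₂) n₂₃ h₂ e₂ p h₃ e₃ q

            x₁-deg : degIn C x₁ ≤ 3
            x₁-deg = ≤-trans (deg-B x₁∈D) (unique⊆⇒length≤ _≟F_ {nb B x₁} {x₀ ∷ x₂ ∷ x₃ ∷ []} (nb-unique B x₁)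
              λ {u} m → let u∈ , e = nb-out m in case four u∈ of λ where
                (inj₁ p) → here p
                (inj₂ (inj₁ p)) → ⊥-elim (E-irrefl e (esym p))
                (inj₂ (inj₂ (inj₁ p))) → there (here p)
                (inj₂ (inj₂ (inj₂ p))) → there (there (here p)))

            deg≤size : degIn U x₁ ≤ size (L x₁)
            deg≤size = low-size (C⊆U (D⊆C x₁∈D)) (C⊆Low (D⊆C x₁∈D))

            size<k : size (L x₁) < k
            size<k = ≤-<-trans (tight (D⊆C x₁∈D)) (low-deg (C⊆Low (D⊆C x₁∈D)))

            three-high : 3 ≤ length R → Three-high
            three-high R-len with nb (U ∖ C) x₁ in eq | long
              where
              open ≤-Reasoning
              -- The list of `x₁` has at least six colours and is no longer than its degree, of
              -- which the K₄ accounts for at most three.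
              long : 3 ≤ degIn (U ∖ C) x₁
              long = +-cancelˡ-≤ 3 3 _ (begin
                3 + 3 ≤⟨ +-monoʳ-≤ 3 R-len ⟩
                3 + length R ≡⟨ cong (3 +_) (length-drop 3 l) ⟩
                3 + (size (L x₁) ∸ 3) ≡⟨ m+[n∸m]≡n (≤-trans 3≤deg deg≤size) ⟩
                size (L x₁) ≤⟨ tight (D⊆C x₁∈D) ⟩
                degIn U x₁ ≤⟨ degIn-∪ (λ {u} p _ → case u ∈? C of λ where
                  (yes q) → inj₁ q
                  (no q) → inj₂ (∖-in p q)) ⟩
                degIn C x₁ + degIn (U ∖ C) x₁ ≤⟨ +-monoˡ-≤ _ x₁-deg ⟩
                3 + degIn (U ∖ C) x₁ ∎)
                where
                3≤deg : 3 ≤ degIn U x₁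
                3≤deg = let _ , h , e = high-at x₁∈D in
                  ≤-trans (big (D⊆C x₁∈D) h e) (degIn-mono (λ p _ → C⊆U p))
            ... | [] | ()
            ... | _ ∷ [] | s≤s ()
            ... | _ ∷ _ ∷ [] | s≤s (s≤s ())
            ... | w₁ ∷ w₂ ∷ w₃ ∷ ws | _ with subst Unique eq (nb-unique (U ∖ C) x₁)
            ...   | (n₁₂ ∷ n₁₃ ∷ _) ∷ (n₂₃ ∷ _) ∷ _ = w₁ , w₂ , w₃ , (n₁₂ , n₁₃ , n₂₃)
                  , at (here refl) , at (there (here refl)) , at (there (there (here refl)))
              where
              at : ∀ {w} → w ∈ₗ w₁ ∷ w₂ ∷ w₃ ∷ ws → High w × E G x₁ w
              at {w} m = let p , e = nb-out (subst (w ∈ₗ_) (esym eq) m) in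
                high-neighbour (D⊆C x₁∈D) p e , e

            result : Col U L
            result with length R ≤? 2
            ... | yes p = few p
            ... | no p = by-head R refl
              where
              3≤R : 3 ≤ length R
              3≤R = ≰⇒> p
              by-head : ∀ r → r ≡ R → Col U L
              by-head [] eq = ⊥-elim (p (subst (λ r → length r ≤ 2) eq z≤n))
              by-head (γ ∷ R′) eq = many (esym eq) len (three-high 3≤R)
                where
                open ≤-Reasoning
                lenR : suc (length R′) ≡ size (L x₁) ∸ 3
                lenR = trans (cong length eq) (length-drop 3 l)
                -- `R′` is the list of `x₁` without `A₀` and without `γ`, four colours fewer than a
                -- list shorter than `k`.
                len : length R′ + 5 ≤ k
                len = begin
                  length R′ + 5 ≡⟨ +-comm _ 5 ⟩
                  4 + suc (length R′) ≡⟨ cong (4 +_) lenR ⟩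
                  4 + (size (L x₁) ∸ 3)
                    ≡⟨ cong suc (m+[n∸m]≡n (<⇒≤ (m<n⇒0<n∸m′ lenR))) ⟩
                  suc (size (L x₁)) ≤⟨ size<k ⟩
                  k ∎
                  where
                  m<n⇒0<n∸m′ : ∀ {m n} → suc m ≡ n ∸ 3 → 3 < n
                  m<n⇒0<n∸m′ {m} {n} e = m∸n≢0⇒n<m λ z → case trans e z of λ ()

          near-colour : Col U L
          near-colour with find (λ a → any? (λ b → ((a ∈? D) ×-dec (b ∈? D)) ×-dec missing (L a) (L b)))
          ... | inj₁ (a , b , (a∈ , b∈) , c , c∈ , c∉) = exchange a∈ b∈ c∈ c∉
          ... | inj₂ h = SameLists.result λ {a} {b} {c} a∈ b∈ c∈ → case c ∈ᶜ? L b of λ where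
                (yes p) → p
                (no p) → ⊥-elim (h a (b , (a∈ , b∈) , c , c∈ , p))

        quad-colour : Col U L
        quad-colour with find (λ w → High? w ×-dec ¬? (w ∈? K₀.set) ×-dec any? (λ a → (a ∈? D) ×-dec E? w a))
        ... | inj₁ (w , hw , w∉ , a , a∈ , e) = beyond hw a∈ e w∉
        ... | inj₂ h = Near.near-colour (λ {w} {a} hw a∈ e → case w ∈? K₀.set of λ where
              (yes p) → p
              (no p) → ⊥-elim (h w (hw , p , a , a∈ , e)))

      module LeafHigh (high-at : ∀ {v} → v ∈ D → ∃ λ t → High t × E G v t) where

        B-big : ∀ {v} → v ∈ D → 3 ≤ degIn B v
        B-big p = let _ , h , e = high-at p in ≤-trans (big (D⊆C p) h e) (deg-B p)

        -- When the rest of `C` has been coloured towards `B`, an uncolourable `B` could only be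
        -- complete or an odd cycle, and its non-root vertices have too many neighbours in `B` for
        -- the latter.
        incomplete : ¬ Complete B → Col U L
        incomplete ¬complete = done (merge c col-B (∖-cover B))
          where
          open NoRemoval
          c : Col (C ∖ B) LC
          c = outside (conn-grow C-conn B⊆ x₀∈) (λ p _ → LC-deg p)
          col-B : Col B (res (φ c) (C ∖ B) LC)
          col-B with colourable-or-Gallai (proj₁ no-cut) (proj₂ no-cut)
                       (λ p → res-deg (φ c) {U = C} {L = LC} (λ q _ → ∖⊆ q) (λ q _ → B⊆ q)
                                (λ q r → proj₂ (∖-out q) r) (LC-deg (B⊆ p)))
          ... | inj₁ c′ = c′
          ... | inj₂ (inj₁ complete) = ⊥-elim (¬complete complete)
          ... | inj₂ (inj₂ (_ , deg≤2)) = ⊥-elim (<⇒≱ (B-big (minus-in d∈ d≢)) (deg≤2 d∈))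

        another : ∀ {v} → v ∈ D → ∀ a b → ∃ λ u → u ∈ B × E G v u × u ≢ a × u ≢ b
        another {v} v∈ a b with find (λ u → (u ∈? B) ×-dec E? v u ×-dec ¬? (u ≟F a) ×-dec ¬? (u ≟F b))
        ... | inj₁ h = h
        ... | inj₂ h = ⊥-elim (<⇒≱ (B-big v∈) (unique⊆⇒length≤ _≟F_ {nb B v} {a ∷ b ∷ []} (nb-unique B v)
                λ {u} m → let u∈ , e = nb-out m in case u ≟F a of λ where
                  (yes p) → here p
                  (no p) → case u ≟F b of λ where
                    (yes q) → there (here q)
                    (no q) → ⊥-elim (h u (u∈ , e , p , q))))

        complete-colour : Complete B → Col U L
        complete-colour complete = Quad.quad-colour high-at complete x₁∈D
          (minus-in (proj₁ (proj₂ more₂)) (proj₁ (proj₂ (proj₂ (proj₂ more₂)))))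
          (minus-in (proj₁ (proj₂ more₃)) (proj₁ (proj₂ (proj₂ (proj₂ more₃)))))
          (E-irrefl (proj₁ (proj₂ (proj₂ more₂)))) (E-irrefl (proj₁ (proj₂ (proj₂ more₃))))
          (≢-sym (proj₂ (proj₂ (proj₂ (proj₂ more₃)))))
          (component (∖-in (C⊆U (B⊆ x₀∈)) (λ p → D≢x₀ p refl)))
          where
          x₁∈D : d ∈ D
          x₁∈D = minus-in d∈ d≢
          more₂ = another x₁∈D x₀ x₀
          more₃ = another x₁∈D x₀ (proj₁ more₂)

        leaf-colour : Col U L
        leaf-colour with find (λ u → any? (λ v → ((u ∈? B) ×-dec (v ∈? B)) ×-dec (¬? (u ≟F v) ×-dec ¬? (E? u v))))
        ... | inj₁ (u , v , (u∈ , v∈) , ne , ¬e) = incomplete λ complete → ¬e (complete u∈ v∈ ne)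
        ... | inj₂ h = complete-colour λ {u} {v} u∈ v∈ ne → case E? u v of λ where
              (yes e) → e
              (no ¬e) → ⊥-elim (h u (v , (u∈ , v∈) , ne , ¬e))

      tight-colour : Col U L
      tight-colour with find (λ v → (v ∈? D) ×-dec ¬? (any? (λ t → High? t ×-dec E? v t)))
      ... | inj₁ (v , v∈ , no-high) = peel (D⊆C v∈) (B⊆ x₀∈) (≢-sym (D≢x₀ v∈))
            (conn-minus (D⊆B v∈) (D≢x₀ v∈)) (λ ht e → no-high (_ , ht , e)) (tight (D⊆C v∈))
      ... | inj₂ h = LeafHigh.leaf-colour λ {v} v∈ → case any? (λ t → High? t ×-dec E? v t) of λ where
            (yes p) → p
            (no p) → ⊥-elim (h v (v∈ , p))

    component-colour : Col U L
    component-colour with find (λ v → (v ∈? C) ×-dec (degIn U v <? size (L v)))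
    ... | inj₁ (v , v∈ , lt) = surplus-vertex v∈ lt
    ... | inj₂ no-surplus
      with find (λ x → any? (λ t → (x ∈? C) ×-dec High? t ×-dec E? x t ×-dec (degIn C x ≤? 2)))
    ... | inj₁ (x , t , x∈ , ht , e , le) = reserve x∈ ht e le
    ... | inj₂ no-small = AtLeaf.tight-colour tight big
            (leaf C-conn r∈ (proj₁ (proj₂ r-low)) (E-irrefl (proj₂ (proj₂ r-low))))
      where
      tight : ∀ {v} → v ∈ C → size (L v) ≤ degIn U v
      tight {v} v∈ = ≮⇒≥ λ lt → no-surplus v (v∈ , lt)
      big : ∀ {x t} → x ∈ C → High t → E G x t → 3 ≤ degIn C x
      big {x} x∈ ht e = ≰⇒> λ le → no-small x (_ , x∈ , ht , e , le)
      r : Fin n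
      r = proj₁ (slack (C⊆UL c₀∈))
      r∈ : r ∈ C
      r∈ = Closed-end C-closed c₀∈ (proj₁ (proj₂ (slack (C⊆UL c₀∈))))
      -- The list of `r` is no longer than its degree in `U`, so `slack` can only stem from a high
      -- neighbour. By `big` this also provides a second vertex of `C`, as needed for a leaf block.
      r-high : ∃ λ t → High t × E G r t
      r-high with find (λ t → High? t ×-dec E? r t)
      ... | inj₁ h = h
      ... | inj₂ h = ⊥-elim (<⇒≱ (proj₂ (proj₂ (slack (C⊆UL c₀∈)))) (≤-trans (tight r∈)
              (degIn-mono λ {u} u∈ e → case u ∈? Low of λ where
                (yes q) → ∩-in u∈ q
                (no q) → ⊥-elim (h u ((u∈ , q) , e)))))
      r-low : ∃ λ y → y ∈ C × E G r y
      r-low = let _ , h , e = r-high in neighbour (≤-trans (s≤s z≤n) (big r∈ h e))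

  colour : ∀ m {U L} → Inv U L → ∣ U ∣ < m → Col U L
  colour (suc m) {U} {L} I lt with find (_∈? U ∩ Low)
  ... | inj₁ (v , v∈) = AtComponent.component-colour I
        (λ I′ lt′ → colour m I′ (<-≤-trans lt′ (s≤s⁻¹ lt))) (component v∈)
  ... | inj₂ no-low = five-choosable G free λ {v} p → Inv.high-size I p λ q → no-low v (∩-in p q)

-- Degree-choosability and the assembly of the proof

─-out : ∀ (S : VSet n) w v → (S ─ w) v ≡ true → S v ≡ true × v ≢ w
─-out S fzero fzero e with S fzero
─-out S fzero fzero () | true
─-out S fzero fzero () | false
─-out S fzero (fsuc v) e with S (fsuc v)
... | true = refl , λ ()
─-out S (fsuc w) fzero e with S fzero
... | true = refl , λ ()
─-out S (fsuc w) (fsuc v) e = let p , q = ─-out (S ∘ fsuc) w v e in p , λ { refl → q refl }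

─-in : ∀ (S : VSet n) w v → S v ≡ true → v ≢ w → (S ─ w) v ≡ true
─-in S fzero fzero _ ne = ⊥-elim (ne refl)
─-in S fzero (fsuc v) e _ rewrite e = refl
─-in S (fsuc w) fzero e _ rewrite e = refl
─-in S (fsuc w) (fsuc v) e ne = ─-in (S ∘ fsuc) w v e (ne ∘ cong fsuc)

module Translation (G : Graph n) where
  open OnGraph G
  open Minors G
  open Brooks G
  open _∈_

  walk⇒path : ∀ {P u v ℓ} → Walk G P u v ℓ → Path P u v
  walk⇒path (here p) = nil (mem p)
  walk⇒path (step p e w) = cons (mem p) e (walk⇒path w)

  path⇒joined : ∀ {P u v} → Path P u v → Joined G P u v
  path⇒joined (nil (mem p)) = 0 , here p
  path⇒joined (cons (mem p) e r) = let ℓ , w = path⇒joined r in suc ℓ , step p e w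

  connected⇒conn : ∀ {P} → ConnectedIn G P → Conn P
  connected⇒conn c (mem p) (mem q) = walk⇒path (proj₂ (c _ _ p q))

  conn⇒connected : ∀ {P} → Conn P → ConnectedIn G P
  conn⇒connected c u v p q = path⇒joined (c (mem p) (mem q))

  noCutVertex⇒noCut : ∀ {B} → NoCutVertex G B → NoCut B
  noCutVertex⇒noCut {B} (c , h) = connected⇒conn c , λ {w} w∈ → Conn-≐
    (λ (mem p) → let q , ne = ─-out B w _ p in minus-in (mem q) ne)
    (λ p → let q , ne = minus-out p in mem (─-in B w _ (get q) ne))
    (connected⇒conn (h w (get w∈)))

  component-isComponent : ∀ {v} (K : Component fullSet v) → IsComponent G (Component.set K)
  component-isComponent K = (_ , get root) , conn⇒connected conn , λ D sub-D cD u u∈ →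
    get (Closed-end closed root (Path-mono (λ _ → mem refl)
      (connected⇒conn cD (mem (sub-D _ (get root))) (mem u∈))))
    where open Component K

  free : K5MinorFree G → ∀ {M} → Free M
  free fr m = fr record
    { branch = bag
    ; disjoint = λ i j v p q → case i ≟F j of λ where
        (yes e) → e
        (no ne) → ⊥-elim (proj₁ (apart ne) (mem p) (mem q))
    ; nonempty = λ where
        fzero → let _ , u , _ , u∈ , _ = apart {fzero} {fsuc fzero} (λ ()) in u , get u∈
        (fsuc i) → let _ , u , _ , u∈ , _ = apart {fsuc i} {fzero} (λ ()) in u , get u∈
    ; connected = λ i → conn⇒connected (conn i)
    ; joined = λ i j ne → let _ , u , v , u∈ , v∈ , e = apart ne in u , v , get u∈ , get v∈ , e }
    where open Model m

  -- Not being a Gallai tree is a negated universal statement and yields no particular block.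
  -- Decidable colourability permits the converse argument: in an uncolourable component every block
  -- is complete or an odd cycle.
  col? : ∀ m U L → ∣ U ∣ < m → Dec (Col U L)
  col? (suc m) U L lt with find (_∈? U)
  ... | inj₂ empty = yes record
        { φ = λ _ → 0 ; chosen = λ p → ⊥-elim (empty _ p) ; proper = λ p → ⊥-elim (empty _ p) }
  ... | inj₁ (z , z∈) with first (λ c → col? m (U - z) (res (λ _ → c) ｛ z ｝ L)
          (<-≤-trans (minus-< z∈) (s≤s⁻¹ lt))) (Colours.list (L z))
  ...   | found p c q eq _ rest = yes (merge (single-col {z} {L} (subst (c ∈ₗ_) (esym eq) (∈-++⁺ʳ p (here refl)))) rest
          (minus-cover z))
  ...   | none h = no λ c → let open Col c in h (chosen z∈) record
          { φ = φ
          ; chosen = λ p → res-in (chosen (minus⊆ p)) λ {u} u∈ e eq →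
              proper (minus⊆ p) z∈ (subst (E G _) (｛｝-out u∈) e) (esym eq)
          ; proper = λ p q → proper (minus⊆ p) (minus⊆ q) }

  by-components : ∀ {L} → (∀ {v} (K : Component fullSet v) → Col (Component.set K) L) →
                  ∀ m U → Closed fullSet U → ∣ U ∣ < m → Col U L
  by-components {L} h (suc m) U closed-U lt with find (_∈? U)
  ... | inj₂ empty = record
        { φ = λ _ → 0 ; chosen = λ p → ⊥-elim (empty _ p) ; proper = λ p → ⊥-elim (empty _ p) }
  ... | inj₁ (v , v∈) = merge (h K) (Col-lists (λ p c∈ → res-in c∈ λ u∈ e _ →
            proj₂ (∖-out p) (K.closed u∈ (mem refl) (E-sym e)))
          (by-components h m (U ∖ K.set)
            (λ p q e → let a , b = ∖-out p in ∖-in (closed-U a q e) λ r → b (K.closed r (mem refl) (E-sym e)))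
            (<-≤-trans (∖-< v∈ K.root) (s≤s⁻¹ lt))))
          (cover-∖ K.set)
    where
    K : Component fullSet v
    K = component (mem refl)
    module K = Component K

  -- The rest of the component is coloured towards a block `B`, whose remaining lists are still as
  -- long as the degrees in `B`. A colouring of `B` would then finish the component, so in an
  -- uncolourable component the other alternative holds for every block.
  degree-choosable : ∀ {v L} (K : Component fullSet v) → ¬ IsGallaiTree G (Component.set K) →
                     (∀ {u} → u ∈ Component.set K → deg G u ≤ size (L u)) → Col (Component.set K) L
  degree-choosable {v} {L} K not-Gallai deg≤ with col? _ Z L ≤-refl
    where open Component K renaming (set to Z)
  ... | yes c = c
  ... | no ¬c = ⊥-elim (not-Gallai λ B (B⊆Z , (b , b∈) , nc , _) → block B B⊆Z (mem b∈) (noCutVertex⇒noCut nc))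
    where
    open Component K renaming (set to Z)
    degIn≤ : ∀ {u} → u ∈ Z → degIn Z u ≤ size (L u)
    degIn≤ {u} p = ≤-trans (degIn-mono λ _ _ → mem refl)
      (≤-trans (≤-reflexive (degIn-full u)) (deg≤ p))
    block : ∀ B → B ⊆ᵥ Z → ∀ {b} → b ∈ B → NoCut B → IsComplete G B ⊎ IsOddCycle G B
    block B sub-B b∈ (cB , cut)
      with outside {L = L} (conn-grow conn (λ {u} (mem p) → mem (sub-B u p)) b∈) (λ p _ → degIn≤ p)
    ... | c with colourable-or-Gallai cB (λ {w} → cut {w}) (λ {u} p → res-deg (Col.φ c) {U = Z} {L = L}
                  (λ q _ → ∖⊆ q) (λ (mem q) _ → mem (sub-B _ q)) (λ q r → proj₂ (∖-out q) r)
                  (degIn≤ (mem (sub-B u (get p)))))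
    ... | inj₁ d = ⊥-elim (¬c (merge c d (∖-cover B)))
    ... | inj₂ (inj₁ complete) = inj₁ λ u w p q → complete (mem p) (mem q)
    ... | inj₂ (inj₂ (odd , _)) = inj₂ odd

theorem7 : (k : ℕ) → 8 ≤ k → (n : ℕ) → (G : Graph n) →
    K5MinorFree G → DistS≥3 G k →
    (∀ C → IsComponent G C → ¬ IsGallaiTree G C) →
    FListColorable G (λ v → deg G v ⊓ k)
theorem7 k 8≤k n G fr (_ , far) not-Gallai L₀ assignment =
  φ , (λ v → chosen (mem refl)) , (λ u v → proper (mem refl) (mem refl))
  where
  open OnGraph G
  open Translation G
  open _∈_
  Low : VSet n
  Low = S< G k
  L : Lists
  L v = colours (L₀ v) (proj₁ (assignment v))
  size-L : ∀ v → size (L v) ≡ deg G v ⊓ k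
  size-L v = proj₂ (assignment v)
  low⇒< : ∀ {v} → v ∈ Low → deg G v < k
  low⇒< {v} p = <ᵇ⇒< (deg G v) k (Equivalence.from T-≡ (get p))
  <⇒low : ∀ {v} → deg G v < k → v ∈ Low
  <⇒low p = mem (Equivalence.to T-≡ (<⇒<ᵇ p))
  low-size : ∀ {v} → v ∈ Low → deg G v ≡ size (L v)
  low-size {v} p = esym (trans (size-L v) (m≤n⇒m⊓n≡m (<⇒≤ (low⇒< p))))
  high-size : ∀ {v} → v ∉ Low → k ≡ size (L v)
  high-size {v} p = esym (trans (size-L v) (m≥n⇒m⊓n≡n (≮⇒≥ (p ∘ <⇒low))))
  degIn≤deg : ∀ {U} v → degIn U v ≤ deg G v
  degIn≤deg v = ≤-trans (degIn-mono λ _ _ → mem refl) (≤-reflexive (degIn-full v))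
  open Extension G Low k 8≤k (λ {U} {v} p → ≤-<-trans (degIn≤deg v) (low⇒< p)) (free fr)

  module _ {v} (K : Component fullSet v) where
    open Component K renaming (set to Z)

    -- Two low neighbours of `t` are joined by a walk of length two through `t`, too short for
    -- vertices of different low components.
    same-low-component : ∀ {t a b} → a ∈ Low → b ∈ Low → E G t a → E G t b → Path Low a b
    same-low-component {t} {a} {b} a∈ b∈ e e′ with component {Low} {a} a∈
    ... | M with b ∈? Component.set M
    ...   | yes p = Path-mono (Component.sub M) (Component.conn M (Component.root M) p)
    ...   | no p = case far a b (get a∈) (get b∈)
              (λ (_ , w) → p (Closed-end (Component.closed M) (Component.root M) (walk⇒path w)))
              2 (step refl (E-sym e) (step refl e′ (here refl))) of λ { (s≤s (s≤s ())) }

    inv : ∀ {t} → t ∈ Z → t ∉ Low → Inv Z L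
    inv {t} t∈ t∉ = record
      { apart = λ _ _ a∈ b∈ e e′ → let a , a′ = ∩-out a∈ ; _ , b′ = ∩-out b∈ in
          Path-mono (λ z → let p , q = ∩-out z in ∩-in q p)
            (Path-closed (λ p _ → closed p (mem refl)) a (same-low-component a′ b′ e e′))
      ; low-size = λ {u} _ p → ≤-trans (degIn≤deg u) (≤-reflexive (low-size p))
      ; high-size = λ _ p → ≤-trans (≤-trans (m≤m+n 5 3) 8≤k) (≤-reflexive (high-size p))
      ; near-size = λ _ p _ _ → ≤-reflexive (high-size p)
      ; slack = slack }
      where
      slack : ∀ {u} → u ∈ Z ∩ Low → ∃ λ r → Path (Z ∩ Low) u r × degIn (Z ∩ Low) r < size (L r)
      slack {u} u∈ with first-entry (Z ∖ Low) (conn (proj₁ (∩-out u∈)) t∈)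
                          (λ p → proj₂ (∖-out p) (proj₂ (∩-out u∈))) (∖-in t∈ t∉)
      -- The path towards the high vertex `t` leaves the low vertices along the edge from `a` to
      -- `b`. The neighbour `b` counts in the list size of `a` but not in its degree among low
      -- vertices.
      ... | a , b , path , b∈Z , b∈ , e = a , path′ , (begin-strict
          degIn (Z ∩ Low) a <⟨ m<m+n _ (degIn-pos ｛｝-in e) ⟩
          degIn (Z ∩ Low) a + degIn ｛ b ｝ a
            ≤⟨ degIn-+ (λ p _ → proj₁ (∩-out p)) (λ p _ → ｛｝⊆ b∈Z p)
                 (λ p q → proj₂ (∖-out b∈) (subst (_∈ Low) (｛｝-out q) (proj₂ (∩-out p)))) ⟩
          degIn Z a ≤⟨ degIn≤deg a ⟩
          deg G a ≡⟨ low-size (proj₂ (∩-out (Path-end path′))) ⟩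
          size (L a) ∎)
        where
        open ≤-Reasoning
        path′ : Path (Z ∩ Low) u a
        path′ = Path-mono (λ {w} z → let p , q = ∖-out z in ∩-in p (case w ∈? Low of λ where
          (yes r) → r
          (no r) → ⊥-elim (q (∖-in p r)))) path

    component-col : Col Z L
    component-col with find (λ t → (t ∈? Z) ×-dec ¬? (t ∈? Low))
    ... | inj₁ (t , t∈ , t∉) = colour _ (inv t∈ t∉) ≤-refl
    ... | inj₂ all-low = degree-choosable K (not-Gallai Z (component-isComponent K)) λ {u} p →
          case u ∈? Low of λ where
            (yes q) → ≤-reflexive (low-size q)
            (no q) → ⊥-elim (all-low u (p , q))

  open Col (by-components component-col _ fullSet (λ _ _ _ → mem refl) ≤-refl)
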